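{- For every $\delta>0$ and every $n\in\mathbb{N}$ there exists $N\in\mathbb{N}$ such that every $N$-partitioned hypergraph $H$ with density at least $4/27+\delta$ has a $4n$-partitioned subhypergraph $H_0$ with index set $I=\{i_1,\ldots,i_{4n}\}$, $i_1<i_2<\cdots<i_{4n}$, such that (writing all triples below as edges of $H_0$) one of the following holds. (1) There exist vertices $\alpha_{ij},\beta_{ij},\gamma^0_{ij},\omega_{ij},\alpha^{\omega}_{ij},\gamma^{\omega}_{ij}\in V_{ij}$ for all $i<j$, $i,j\in I$, such that for all $i<j<k$, $i,j,k\in I$: $\{\alpha_{ij},\beta_{jk},\gamma^0_{ik}\}$, $\{\omega_{ij},\beta_{jk},\gamma^{\omega}_{ik}\}$ and $\{\alpha^{\omega}_{ij},\omega_{jk},\gamma^0_{ik}\}$ are edges. (2) There exist vertices $\alpha_{ij},\beta_{ij},\gamma^0_{ij},\omega_{ij},\beta^{\omega}_{ij},\gamma^{\omega}_{ij}\in V_{ij}$ for all $i<j$, $i,j\in I$, such that for all $i<j<k$, $i,j,k\in I$: $\{\alpha_{ij},\beta_{jk},\gamma^0_{ik}\}$, $\{\alpha_{ij},\omega_{jk},\gamma^{\omega}_{ik}\}$ and $\{\omega_{ij},\beta^{\omega}_{jk},\gamma^0_{ik}\}$ are edges. (3) There exist vertices $\alpha_{ij},\beta_{ij},\alpha'_{ij},\beta'_{ij},\gamma^0_{ij},\gamma^{\bullet}_{ij}\in V_{ij}$ for all $i<j$, $i,j\in I$, and vertices $\beta^{\bullet}_{ijkst}\in V_{jk}$ and $\alpha^{\bullet}_{ijkst}\in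 V_{ks}$ for all $i<j<k<s<t$, $i,j,k,s,t\in I$, such that for all $i<j<k<s<t$, $i,j,k,s,t\in I$: $\{\alpha_{ij},\beta_{jk},\gamma^0_{ik}\}$ and $\{\alpha'_{ij},\beta^{\bullet}_{ijkst},\gamma^0_{ik}\}$ are edges in the $(i,j,k)$-triad, $\{\beta^{\bullet}_{ijkst},\alpha^{\bullet}_{ijkst},\gamma^{\bullet}_{js}\}$ is an edge in the $(j,k,s)$-triad, and $\{\alpha^{\bullet}_{ijkst},\beta'_{st},\gamma^0_{kt}\}$ is an edge in the $(k,s,t)$-triad. (4) There exist vertices $\alpha^*_{ij},\beta^*_{ij},\gamma_{ij},\alpha^1_{ij},\beta^1_{ij},\gamma^1_{ij},\alpha^2_{ij},\beta^2_{ij},\gamma^2_{ij}\in V_{ij}$ for all $i<j$, $i,j\in I$, such that for all $i<j<k$, $i,j,k\in I$: $\{\gamma^1_{ij},\beta^*_{jk},\gamma_{ik}\}$, $\{\alpha^*_{ij},\gamma^2_{jk},\gamma_{ik}\}$, $\{\alpha^1_{ij},\beta^1_{jk},\gamma^1_{ik}\}$ and $\{\alpha^2_{ij},\beta^2_{jk},\gamma^2_{ik}\}$ are edges; and in addition there exist $\alpha\in V_{i_{2n}i_{2n+1}}$ and $\beta\in V_{i_{2n+1}i_{2n+2}}$ such that $\alpha$ is a left neighbor of $\gamma^1_{i_{2n}i_{3n+1}}$ in the $(i_{2n},i_{2n+1},i_{3n+1})$-triad, $\beta$ is a right neighbor of $\gamma^2_{i_ni_{2n+2}}$ in the $(i_n,i_{2n+1},i_{2n+2})$-triad,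 and the $(i_{2n},i_{2n+1},i_{2n+2})$-triad contains an edge containing both $\alpha$ and $\beta$.
   Context: An $n$-partitioned hypergraph $H$ is a $3$-uniform hypergraph whose vertex set is partitioned into nonempty finite sets $V_{ij}$, $1\le i<j\le n$, such that every edge has one vertex in each of $V_{ij},V_{ik},V_{jk}$ for some $1\le i<j<k\le n$. For $i<j<k$, the $(i,j,k)$-triad is the set of edges with one vertex in each of $V_{ij}$, $V_{ik}$, $V_{jk}$; vertices of $V_{ij}$, $V_{jk}$, $V_{ik}$ are its left, right and top vertices, respectively. The density of a triad is its number of edges divided by $|V_{ij}||V_{ik}||V_{jk}|$, and the density of $H$ is the minimum density of its triads. For $I\subseteq[n]$, the subhypergraph induced by $I$ is the $|I|$-partitioned hypergraph with parts $V_{ij}$, $i<j$, $i,j\in I$ (keeping the original indices) and all edges of $H$ contained in the union of these parts; $I$ is its index set. A subhypergraph of $H$ is obtained from an induced subhypergraph by deleting some edges. For a top vertex $v\in V_{ik}$ of the $(i,j,k)$-triad, a vertex $w\in V_{ij}$ is a left neighbor of $v$ (in that triad) if some edge of the triad contains both $v$ and $w$, and a vertex $w\in V_{jk}$ is a right neighbor of $v$ if some edge of the triad contains both. -}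

module Defs where

open import Data.Nat as ℕ using (ℕ; suc)
open import Data.Fin using (Fin; toℕ; _<_)
open import Data.Bool using (Bool; T; if_then_else_)
open import Data.List using (map)
open import Data.Nat.ListAction using (sum)
open import Relation.Binary.PropositionalEquality using (_≡_)
open import Data.List.Base using (allFin)
open import Data.Integer using (+_)
open import Data.Rational using (ℚ; _/_) renaming (_+_ to _+ℚ_; _*_ to _*ℚ_; _≤_ to _≤ℚ_)
open import Data.Product using (Σ; ∃; _×_)

-- N-partitioned 3-uniform hypergraphs.
-- Index set [N] is represented by Fin N (0-based).  For i < j the part
-- V_ij has  suc (psize i j)  elements (so it is automatically nonempty
-- and finite), its vertices are Fin (suc (psize i j)); the parts are
-- disjoint by construction.  Values for i ≥ j are irrelevant junk.
-- For i < j < k, edge i j k l r t says that {l, r, t} is an edge of the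
-- (i,j,k)-triad with left vertex l ∈ V_ij, right vertex r ∈ V_jk and
-- top vertex t ∈ V_ik.  Values for non-increasing triples are junk.

record PHG (N : ℕ) : Set where
  field
    psize : Fin N → Fin N → ℕ
  V : Fin N → Fin N → Set
  V i j = Fin (suc (psize i j))
  field
    edge : (i j k : Fin N) → V i j → V j k → V i k → Bool

open PHG public

card : ∀ {N} (H : PHG N) → Fin N → Fin N → ℕ
card H i j = suc (psize H i j)

triadEdges : ∀ {N} (H : PHG N) (i j k : Fin N) → ℕ
triadEdges H i j k =
  sum (map (λ l → sum (map (λ r → sum (map (λ t → if edge H i j k l r t then 1 else 0)
        (allFin (card H i k)))) (allFin (card H j k)))) (allFin (card H i j)))

-- the density of H is at least d  (every triad has density ≥ d,
-- i.e. d * |V_ij||V_ik||V_jk| ≤ #edges, written without division)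
DensityAtLeast : ∀ {N} → PHG N → ℚ → Set
DensityAtLeast {N} H d =
  (i j k : Fin N) → i < j → j < k →
  d *ℚ ((+ (card H i j ℕ.* card H i k ℕ.* card H j k)) / 1) ≤ℚ ((+ triadEdges H i j k) / 1)

-- m-partitioned subhypergraphs of H: an index set {ι 0 < ι 1 < ... }
-- of size m (original indices kept via ι) and a subset of the edges
-- of the induced subhypergraph.

record Sub {N} (H : PHG N) (m : ℕ) : Set₁ where
  field
    ι      : Fin m → Fin N
    ι-mono : ∀ a b → a < b → ι a < ι b
    E      : (a b c : Fin m) → V H (ι a) (ι b) → V H (ι b) (ι c) → V H (ι a) (ι c) → Set
    E⊆     : ∀ a b c l r t → E a b c l r t → T (edge H (ι a) (ι b) (ι c) l r t)

open Sub public

module _ {N m : ℕ} {H : PHG N} (H₀ : Sub H m) where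

  -- vertex choice for each pair of indices of H₀ (used for a < b)
  VF : Set
  VF = (a b : Fin m) → V H (ι H₀ a) (ι H₀ b)

  E' = E H₀

  Case1 : Set
  Case1 = Σ VF λ α → Σ VF λ β → Σ VF λ γ⁰ → Σ VF λ ω → Σ VF λ αω → Σ VF λ γω →
    ∀ a b c → a < b → b < c →
      E' a b c (α a b) (β b c) (γ⁰ a c) ×
      E' a b c (ω a b) (β b c) (γω a c) ×
      E' a b c (αω a b) (ω b c) (γ⁰ a c)

  Case2 : Set
  Case2 = Σ VF λ α → Σ VF λ β → Σ VF λ γ⁰ → Σ VF λ ω → Σ VF λ βω → Σ VF λ γω →
    ∀ a b c → a < b → b < c →
      E' a b c (α a b) (β b c) (γ⁰ a c) ×
      E' a b c (α a b) (ω b c) (γω a c) ×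
      E' a b c (ω a b) (βω b c) (γ⁰ a c)

  Case3 : Set
  Case3 = Σ VF λ α → Σ VF λ β → Σ VF λ α' → Σ VF λ β' → Σ VF λ γ⁰ → Σ VF λ γ• →
    Σ ((i j k s t : Fin m) → V H (ι H₀ j) (ι H₀ k)) λ β• →
    Σ ((i j k s t : Fin m) → V H (ι H₀ k) (ι H₀ s)) λ α• →
    ∀ i j k s t → i < j → j < k → k < s → s < t →
      E' i j k (α i j) (β j k) (γ⁰ i k) ×
      E' i j k (α' i j) (β• i j k s t) (γ⁰ i k) ×
      E' j k s (β• i j k s t) (α• i j k s t) (γ• j s) ×
      E' k s t (α• i j k s t) (β' s t) (γ⁰ k t)

  -- Case 4, with m = 4n.  The (1-based) positions i_n, i_{2n}, i_{2n+1},
  -- i_{2n+2}, i_{3n+1} are the elements p₁,…,p₅ of Fin m with 0-based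
  -- ranks n-1, 2n-1, 2n, 2n+1, 3n.
  Case4 : ℕ → Set
  Case4 n = Σ VF λ α* → Σ VF λ β* → Σ VF λ γ → Σ VF λ α¹ → Σ VF λ β¹ → Σ VF λ γ¹ →
    Σ VF λ α² → Σ VF λ β² → Σ VF λ γ² →
    (∀ a b c → a < b → b < c →
      E' a b c (γ¹ a b) (β* b c) (γ a c) ×
      E' a b c (α* a b) (γ² b c) (γ a c) ×
      E' a b c (α¹ a b) (β¹ b c) (γ¹ a c) ×
      E' a b c (α² a b) (β² b c) (γ² a c)) ×
    (Σ (Fin m) λ p₁ → Σ (Fin m) λ p₂ → Σ (Fin m) λ p₃ → Σ (Fin m) λ p₄ → Σ (Fin m) λ p₅ →
      suc (toℕ p₁) ≡ n × suc (toℕ p₂) ≡ 2 ℕ.* n × toℕ p₃ ≡ 2 ℕ.* n ×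
      toℕ p₄ ≡ suc (2 ℕ.* n) × toℕ p₅ ≡ 3 ℕ.* n ×
      Σ (V H (ι H₀ p₂) (ι H₀ p₃)) λ α → Σ (V H (ι H₀ p₃) (ι H₀ p₄)) λ β →
        (∃ λ r → E' p₂ p₃ p₅ α r (γ¹ p₂ p₅)) ×
        (∃ λ l → E' p₁ p₃ p₄ l β (γ² p₁ p₄)) ×
        (∃ λ t → E' p₂ p₃ p₄ α β t))

{-# OPTIONS --safe #-}
-- Fix a large Q. A vertex of V_ij (of V_jk) is a left (right) neighbour of a top vertex v ∈ V_ik if it lies in at
-- least a 1/Q² proportion of the possible edges of the triad containing v. By Ramsey's theorem and averaging,
-- vertices that exist with positive density for all choices of the surrounding indices can be chosen consistently
-- on a large set of indices. Choose in this way top vertices γ⁰ with links of the largest density e₀, left neighbours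
-- γ¹ of γ⁰ with links of the largest density e₁, and right neighbours γ² of γ⁰ with links of the largest density e₂.
-- Let L_s and R_s be the left and right neighbourhoods of γˢ, let a and b be the densities of L₀ and R₀ ∖ L₀, and
-- let c = 1 - a - b. If (1), (2) and (3) fail, the links have almost no pairs in R_s × R_s, in L_s × L_s and in
-- R_s × L_s; if (4) fails, the links of γ¹ and γ² have almost none in L₁ × R₂. Hence e₀ ≤ ab. Moreover the pairs
-- counted by e₁ + e₂ join X = L₁ ∪ R₂ to its complement, each unordered pair is counted once, and no pair lies
-- within L₀ or within R₀, so that e₁ + e₂ is at most 1/4, at most a(1 - a) if a ≥ 1/2, and at most b(1 - b) if
-- b ≥ 1/2. The maximality of the choices bounds the density of H by a e₁ + b e₂ + c e₀, which is at most 4/27.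
module Submission where

open import Data.Bool using (Bool; T; _∧_; _∨_; false; if_then_else_; not; true)
open import Data.Bool.ListAction using (all)
open import Data.Bool.Properties using (T-∧; T?)
open import Data.Empty using (⊥; ⊥-elim)
open import Data.Fin as Fin using (Fin; suc; zero)
open import Data.Fin.Properties as Fin using ()
import Data.Integer as ℤ
import Data.Integer.Properties as ℤ
open import Data.List using (List; []; _++_; _∷_; allFin; cartesianProduct; drop; filter; length; lookup; map; tabulate; take; upTo)
open import Data.List.Membership.Propositional using (_∈_)
open import Data.List.Membership.Propositional.Properties using (∈-allFin; ∈-cartesianProduct⁺; ∈-filter⁺; ∈-lookup; ∈-map⁺; ∈-upTo⁺)
open import Data.List.Properties using (length-++; length-filter; length-map; length-tabulate; length-take; map-++; map-∘)
open import Data.List.Relation.Binary.Sublist.Propositional using ([]; _∷_; _∷ʳ_; _⊆_; from∈; minimum; ⊆-trans)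
open import Data.List.Relation.Binary.Sublist.Propositional.Properties using (++⁺; All-resp-⊆; filter-⊆; map⁺; take-⊆)
open import Data.List.Relation.Unary.All as All using (All; []; _∷_; all?)
open import Data.List.Relation.Unary.All.Properties as AllP using (all-filter; all⁺)
open import Data.List.Relation.Unary.AllPairs as AllPairs using (AllPairs; []; _∷_)
import Data.List.Relation.Unary.AllPairs.Properties as AllPairsP
open import Data.List.Relation.Unary.Any using (here; there)
open import Data.Nat
open import Data.Nat.Coprimality using (Coprime)
open import Data.Nat.DivMod using (/-monoˡ-≤; _%_; _/_; m%n<n; m*n/n≡m; m/n*n≤m; m≡m%n+[m/n]*n)
open import Data.Nat.ListAction using (sum)
open import Data.Nat.Properties
open import Data.Nat.Tactic.RingSolver using (solve-∀)
open import Data.Product using (_,_; _×_; proj₁; proj₂; Σ; ∃)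
open import Data.Rational using (0ℚ; mkℚ; positive; toℚᵘ; ℚ)
import Data.Rational as ℚ
import Data.Rational.Properties as ℚ
open import Data.Rational.Unnormalised using (mkℚᵘ; ℚᵘ)
import Data.Rational.Unnormalised as ℚᵘ
import Data.Rational.Unnormalised.Properties as ℚᵘ
open import Data.Sum using (_⊎_; inj₁; inj₂)
open import Data.Unit using (tt; ⊤)
open import Defs
open import Function using (Equivalence; _∘_; id)
open import Relation.Binary.PropositionalEquality
open import Relation.Nullary using (Dec; _×-dec_; contradiction; no; yes; ¬?; ¬_)
open import Relation.Nullary.Decidable using (fromWitness; isYes; toWitness)
open import Relation.Unary using (Decidable)

-- All densities are handled as integers, in units of 1/Q for vertices and links and of 1/Q² in the
-- comparison with pairs of types; "largest density" thus becomes a finite descent, and each error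
-- is a small multiple of a unit. The threshold 1/Q² for neighbours is finer than the unit 1/Q:
-- discarding the edges at non-neighbours costs a link only a multiple of 1/Q², while a link of
-- density 2/Q still has a 1/Q proportion of neighbours, among which γ¹ and γ² can be chosen.
-- Outcome (3) is the obstacle on the combinatorial side: α′ and β′ may depend on two indices only,
-- the vertices between them on five. Averaging does not produce such α′ and β′; they come from an
-- absorption argument, in which a failed choice shrinks the neighbourhood. The level of γ¹ or γ²
-- may round down to 0. Its links then guarantee no edges, so no outcome can be drawn from them, and
-- this case is separated; there e₀ ≤ ab is enough. The value 4/27 is reached by the final bound at
-- a = 2/3, b = 1/3, c = 0, and with a and b exchanged.

⟦_⟧ : Bool → ℕ
⟦ b ⟧ = if b then 1 else 0

⟦⟧-mono : ∀ {a b} → (T a → T b) → ⟦ a ⟧ ≤ ⟦ b ⟧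
⟦⟧-mono {false}         _ = z≤n
⟦⟧-mono {true}  {true}  _ = ≤-refl
⟦⟧-mono {true}  {false} f with () ← f tt

⟦⟧≤1 : ∀ b → ⟦ b ⟧ ≤ 1
⟦⟧≤1 true  = ≤-refl
⟦⟧≤1 false = z≤n

⟦⟧-∧ : ∀ a b → ⟦ a ∧ b ⟧ ≡ ⟦ a ⟧ * ⟦ b ⟧
⟦⟧-∧ true  b = sym (*-identityˡ ⟦ b ⟧)
⟦⟧-∧ false b = refl

-- Finite sums, counting and density

∑ : ∀ {A : Set} → List A → (A → ℕ) → ℕ
∑ xs f = sum (map f xs)

module _ {A : Set} where

  ∑-mono : ∀ (xs : List A) {f g : A → ℕ} → (∀ x → f x ≤ g x) → ∑ xs f ≤ ∑ xs g
  ∑-mono []       le = z≤n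
  ∑-mono (x ∷ xs) le = +-mono-≤ (le x) (∑-mono xs le)

  ∑-cong : ∀ (xs : List A) {f g : A → ℕ} → (∀ x → f x ≡ g x) → ∑ xs f ≡ ∑ xs g
  ∑-cong []       eq = refl
  ∑-cong (x ∷ xs) eq = cong₂ _+_ (eq x) (∑-cong xs eq)

  ∑-+ : ∀ (xs : List A) (f g : A → ℕ) → ∑ xs (λ x → f x + g x) ≡ ∑ xs f + ∑ xs g
  ∑-+ []       f g = refl
  ∑-+ (x ∷ xs) f g rewrite ∑-+ xs f g = interchange (f x) (g x) (∑ xs f) (∑ xs g)
    where
    interchange : ∀ a b c d → a + b + (c + d) ≡ a + c + (b + d)
    interchange = solve-∀

  ∑-*ˡ : ∀ (xs : List A) c (f : A → ℕ) → ∑ xs (λ x → c * f x) ≡ c * ∑ xs f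
  ∑-*ˡ []       c f = sym (*-zeroʳ c)
  ∑-*ˡ (x ∷ xs) c f rewrite ∑-*ˡ xs c f = sym (*-distribˡ-+ c (f x) (∑ xs f))

  ∑-*ʳ : ∀ (xs : List A) c (f : A → ℕ) → ∑ xs (λ x → f x * c) ≡ ∑ xs f * c
  ∑-*ʳ []       c f = refl
  ∑-*ʳ (x ∷ xs) c f rewrite ∑-*ʳ xs c f = sym (*-distribʳ-+ c (f x) (∑ xs f))

  ∑-const : ∀ (xs : List A) c → ∑ xs (λ _ → c) ≡ length xs * c
  ∑-const []       c = refl
  ∑-const (x ∷ xs) c = cong (c +_) (∑-const xs c)

  ∑-max : ∀ (x : A) xs (f : A → ℕ) → ∃ λ y → ∑ (x ∷ xs) f ≤ length (x ∷ xs) * f y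
  ∑-max x []        f = x , ≤-refl
  ∑-max x (x′ ∷ xs) f with y , le ← ∑-max x′ xs f with ≤-total (f x) (f y)
  ... | inj₁ fx≤fy = y , +-mono-≤ fx≤fy le
  ... | inj₂ fy≤fx = x , +-monoʳ-≤ (f x) (≤-trans le (*-monoʳ-≤ (length (x′ ∷ xs)) fy≤fx))

  ∑-∈ : ∀ {xs : List A} {x} (f : A → ℕ) → x ∈ xs → f x ≤ ∑ xs f
  ∑-∈ f (here refl) = m≤m+n _ _
  ∑-∈ f (there x∈)  = ≤-trans (∑-∈ f x∈) (m≤n+m _ _)

∑-swap : ∀ {A B : Set} (xs : List A) (ys : List B) (f : A → B → ℕ) →
  ∑ xs (λ x → ∑ ys (f x)) ≡ ∑ ys (λ y → ∑ xs (λ x → f x y))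
∑-swap []       ys f = sym (trans (∑-const ys 0) (*-zeroʳ (length ys)))
∑-swap (x ∷ xs) ys f =
  trans (cong (∑ ys (f x) +_) (∑-swap xs ys f)) (sym (∑-+ ys (f x) (λ y → ∑ xs (λ x → f x y))))

∑∑-* : ∀ {A B : Set} (xs : List A) (ys : List B) (f : A → ℕ) (g : B → ℕ) →
  ∑ xs (λ x → ∑ ys (λ y → f x * g y)) ≡ ∑ xs f * ∑ ys g
∑∑-* xs ys f g = trans (∑-cong xs λ x → ∑-*ˡ ys (f x) g) (∑-*ʳ xs (∑ ys g) f)

length-allFin : ∀ n → length (allFin n) ≡ n
length-allFin n = length-tabulate id

∑F-const : ∀ n c → ∑ (allFin n) (λ _ → c) ≡ n * c
∑F-const n c = trans (∑-const (allFin n) c) (cong (_* c) (length-allFin n))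

opaque

  -- Opaque, so that counts remain atoms in goals; `count-∑` and `count₂-∑` reopen them where the
  -- sum is needed.
  count : ∀ {n} → (Fin n → Bool) → ℕ
  count p = ∑ (allFin _) (λ v → ⟦ p v ⟧)

  count₂ : ∀ {n m} → (Fin n → Fin m → Bool) → ℕ
  count₂ p = ∑ (allFin _) (λ v → count (p v))

  count-∑ : ∀ {n} (p : Fin n → Bool) → count p ≡ ∑ (allFin n) (λ v → ⟦ p v ⟧)
  count-∑ p = refl

  count₂-∑ : ∀ {n m} (p : Fin n → Fin m → Bool) → count₂ p ≡ ∑ (allFin n) (λ v → count (p v))
  count₂-∑ p = refl

-- Proportion at least 1/q, without division. A larger `q` demands less, so losses appear as factors
-- on `q`.
Dense : ℕ → ∀ {n} → (Fin n → Bool) → Set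
Dense q {n} p = n ≤ q * count p

Dense₂ : ℕ → ∀ {n m} → (Fin n → Fin m → Bool) → Set
Dense₂ q {n} {m} p = n * m ≤ q * count₂ p

opaque
  unfolding count

  count-mono : ∀ {n} {p p′ : Fin n → Bool} → (∀ v → T (p v) → T (p′ v)) → count p ≤ count p′
  count-mono le = ∑-mono (allFin _) (λ v → ⟦⟧-mono (le v))

  count≤ : ∀ {n} (p : Fin n → Bool) → count p ≤ n
  count≤ {n} p = subst (count p ≤_) (trans (∑F-const n 1) (*-identityʳ n))
    (∑-mono (allFin n) (λ v → ⟦⟧≤1 (p v)))

  count₂≤ : ∀ {n m} (p : Fin n → Fin m → Bool) → count₂ p ≤ n * m
  count₂≤ {n} {m} p = subst (count₂ p ≤_) (∑F-const n m) (∑-mono (allFin n) (λ v → count≤ (p v)))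

  count₂-swap : ∀ {n m} (p : Fin n → Fin m → Bool) → count₂ p ≡ count₂ (λ w v → p v w)
  count₂-swap p = ∑-swap (allFin _) (allFin _) (λ v w → ⟦ p v w ⟧)

dense-mono : ∀ {q n} {p p′ : Fin n → Bool} → (∀ v → T (p v) → T (p′ v)) → Dense q p → Dense q p′
dense-mono {q} le d = ≤-trans d (*-monoʳ-≤ q (count-mono le))

dense₂-swap : ∀ q {n m} (p : Fin n → Fin m → Bool) → Dense₂ q p → Dense₂ q (λ w v → p v w)
dense₂-swap q {n} {m} p d = subst₂ _≤_ (*-comm n m) (cong (q *_) (count₂-swap p)) d

∑-witness : ∀ {A : Set} (xs : List A) (p : A → Bool) → 0 < ∑ xs (λ v → ⟦ p v ⟧) → ∃ λ v → T (p v)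
∑-witness (x ∷ xs) p pos with p x in eq
... | true  = x , subst T (sym eq) tt
... | false = ∑-witness xs p pos

count-witness : ∀ {n} (p : Fin n → Bool) → 0 < count p → ∃ λ v → T (p v)
count-witness p pos = ∑-witness (allFin _) p (subst (0 <_) (count-∑ p) pos)

dense-witness : ∀ q {n} {p : Fin (suc n) → Bool} → Dense q p → ∃ λ v → T (p v)
dense-witness q {n} {p} d = count-witness p (n≢0⇒n>0 λ eq → contradiction (≤-trans d (≤-reflexive (trans (cong (q *_) eq) (*-zeroʳ q)))) λ ())

opaque
  unfolding count

  count-false : ∀ n → count {n} (λ _ → false) ≡ 0
  count-false n = trans (∑F-const n 0) (*-zeroʳ n)

  -- Markov's inequality: half of the mass lies on rows of at least half the average weight.
  dense-rows : ∀ q {n m} {p : Fin n → Fin (suc m) → Bool} → Dense₂ q p →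
    Dense (2 * q) (λ v → suc m ≤ᵇ 2 * q * count (p v))
  dense-rows q {n} {m} {p} d = *-cancelʳ-≤ n (2 * q * count good) (suc m) (+-cancelˡ-≤ (n * suc m) _ _ (begin
    n * suc m + n * suc m  ≡⟨ dbl (n * suc m) ⟩
    2 * (n * suc m)  ≤⟨ *-monoʳ-≤ 2 d ⟩
    2 * (q * count₂ p)  ≡⟨ *-assoc 2 q _ ⟨
    2 * q * count₂ p  ≡⟨ ∑-*ˡ (allFin n) (2 * q) (λ v → count (p v)) ⟨
    ∑ (allFin n) (λ v → 2 * q * count (p v))  ≤⟨ ∑-mono (allFin n) row ⟩
    ∑ (allFin n) (λ v → suc m + 2 * q * ⟦ good v ⟧ * suc m)
      ≡⟨ ∑-+ (allFin n) (λ _ → suc m) (λ v → 2 * q * ⟦ good v ⟧ * suc m) ⟩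
    ∑ (allFin n) (λ _ → suc m) + ∑ (allFin n) (λ v → 2 * q * ⟦ good v ⟧ * suc m)
      ≡⟨ cong₂ _+_ (∑F-const n (suc m)) (trans (∑-*ʳ (allFin n) (suc m) _) (cong (_* suc m) (∑-*ˡ (allFin n) (2 * q) _))) ⟩
    n * suc m + 2 * q * count good * suc m  ∎))
    where
    open ≤-Reasoning
    good : Fin n → Bool
    good v = suc m ≤ᵇ 2 * q * count (p v)
    dbl : ∀ a → a + a ≡ 2 * a
    dbl = solve-∀
    row : ∀ v → 2 * q * count (p v) ≤ suc m + 2 * q * ⟦ good v ⟧ * suc m
    row v with good v in eq
    ... | true  rewrite *-identityʳ (2 * q) =
          ≤-trans (*-monoʳ-≤ (2 * q) (count≤ (p v))) (m≤n+m _ (suc m))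
    ... | false = ≤-trans (<⇒≤ (≰⇒> λ le → subst T eq (≤⇒≤ᵇ le))) (m≤m+n (suc m) _)

-- Ramsey's theorem for sublists

take-length : ∀ {A : Set} m (xs : List A) → m ≤ length xs → length (take m xs) ≡ m
take-length m xs le = trans (length-take m xs) (m≤n⇒m⊓n≡m le)

shorten : ∀ {A : Set} m (xs : List A) → m ≤ length xs → ∃ λ ys → ys ⊆ xs × length ys ≡ m
shorten m xs le = take m xs , take-⊆ m xs , take-length m xs le

length-filter-¬ : ∀ {A : Set} {P : A → Set} (P? : Decidable P) xs →
  length xs ≡ length (filter P? xs) + length (filter (¬? ∘ P?) xs)
length-filter-¬ P? []       = refl
length-filter-¬ P? (x ∷ xs) with P? x
... | yes _ = cong suc (length-filter-¬ P? xs)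
... | no  _ = trans (cong suc (length-filter-¬ P? xs)) (sym (+-suc _ _))

-- One colour is removed at a time: either `c` has `m` elements, or the rest still exceeds the bound
-- for the remaining colours. The successor in the bound serves the empty list of colours: `xs` is
-- then nonempty and its head has no colour.
pigeonhole : ∀ {A C : Set} (_≟_ : (c d : C) → Dec (c ≡ d)) (cs : List C) m (f : A → C) xs →
  All (λ x → f x ∈ cs) xs → suc (length cs * m) ≤ length xs →
  ∃ λ ys → ys ⊆ xs × length ys ≡ m × ∃ λ c → All (λ y → f y ≡ c) ys
pigeonhole _≟_ [] m f (x ∷ xs) (() ∷ _) le
pigeonhole _≟_ (c ∷ cs) m f xs f∈ le = by-cases (m ≤? length here′)
  where
  here′ rest : List _
  here′ = filter (λ x → f x ≟ c) xs
  rest = filter (λ x → ¬? (f x ≟ c)) xs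
  rest∈ : All (λ x → f x ∈ cs) rest
  rest∈ = All.zipWith (λ { (¬p , here p) → contradiction p ¬p ; (_ , there q) → q })
    (all-filter (λ x → ¬? (f x ≟ c)) xs , All-resp-⊆ (filter-⊆ _ xs) f∈)
  by-cases : Dec (m ≤ length here′) → ∃ λ ys → ys ⊆ xs × length ys ≡ m × ∃ λ c → All (λ y → f y ≡ c) ys
  by-cases (yes m≤) with ys , sub , len ← shorten m here′ m≤ =
    ys , ⊆-trans sub (filter-⊆ _ xs) , len , c , All-resp-⊆ sub (all-filter _ xs)
  by-cases (no m≰) = let ys , sub , len , mono = pigeonhole _≟_ cs m f rest rest∈ enough in
    ys , ⊆-trans sub (filter-⊆ _ xs) , len , mono
    where
    enough : suc (length cs * m) ≤ length rest
    enough = +-cancelˡ-≤ m _ _ (begin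
      m + suc (length cs * m)  ≡⟨ +-suc m _ ⟩
      suc (m + length cs * m)  ≤⟨ le ⟩
      length xs  ≡⟨ length-filter-¬ (λ x → f x ≟ c) xs ⟩
      length here′ + length rest  ≤⟨ +-monoˡ-≤ _ (<⇒≤ (≰⇒> m≰)) ⟩
      m + length rest  ∎)
      where open ≤-Reasoning

Monochromatic : ∀ {A C : Set} → (List A → C) → ℕ → C → List A → Set
Monochromatic χ k c ys = ∀ {zs} → zs ⊆ ys → length zs ≡ k → χ zs ≡ c

-- The colour of a (k+1)-sublist is determined by its first element, recorded next to it.
data EndHomogeneous {A C : Set} (χ : List A → C) (k : ℕ) : List (A × C) → Set where
  []  : EndHomogeneous χ k []
  _∷_ : ∀ {x c xs} → Monochromatic (χ ∘ (x ∷_)) k c (map proj₁ xs) →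
        EndHomogeneous χ k xs → EndHomogeneous χ k ((x , c) ∷ xs)

endHomogeneous-⊆ : ∀ {A C : Set} {χ : List A → C} {k xs ys} →
  ys ⊆ xs → EndHomogeneous χ k xs → EndHomogeneous χ k ys
endHomogeneous-⊆ []          []       = []
endHomogeneous-⊆ (_ ∷ʳ sub)  (_ ∷ e) = endHomogeneous-⊆ sub e
endHomogeneous-⊆ (refl ∷ sub) (m ∷ e) = (λ s → m (⊆-trans s (map⁺ proj₁ sub))) ∷ endHomogeneous-⊆ sub e

endHomogeneous⇒mono : ∀ {A C : Set} {χ : List A → C} {k c xs} → EndHomogeneous χ k xs →
  All (λ x → proj₂ x ≡ c) xs → Monochromatic χ (suc k) c (map proj₁ xs)
endHomogeneous⇒mono []      []         []           ()
endHomogeneous⇒mono (m ∷ e) (eq ∷ eqs) (_ ∷ʳ sub)  len = endHomogeneous⇒mono e eqs sub len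
endHomogeneous⇒mono (m ∷ e) (refl ∷ _) (refl ∷ sub) len = m sub (suc-injective len)

-- Induction on `k`: among `suc (c * m)` elements of an end-homogeneous list, `m` record the same
-- colour. `N` precedes `A` and `χ`, because the number of indices must be known before the
-- hypergraph.
ramsey : ∀ c k m → ∃ λ N → ∀ {A : Set} (χ : List A → Fin c) (xs : List A) → N ≤ length xs →
  ∃ λ ys → ys ⊆ xs × length ys ≡ m × ∃ λ col → Monochromatic χ k col ys
ramsey c zero m = m , λ χ xs le → let ys , sub , len = shorten m xs le in
  ys , sub , len , χ [] , λ { {[]} _ _ → refl }
ramsey c (suc k) m = proj₁ (endHom (suc (c * m))) , λ {A} χ xs le →
  let zs , sub , len , e = proj₂ (endHom (suc (c * m))) χ xs le
      ws , sub′ , len′ , col , eqs = pigeonhole Fin._≟_ (allFin c) m proj₂ zs (All.universal (λ z → ∈-allFin _) zs)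
        (≤-reflexive (trans (cong (λ l → suc (l * m)) (length-allFin c)) (sym len)))
  in map proj₁ ws , ⊆-trans (map⁺ proj₁ sub′) sub , trans (length-map proj₁ ws) len′ , col ,
     endHomogeneous⇒mono (endHomogeneous-⊆ sub′ e) eqs
  where
  -- The head `x` turns `χ` into a colouring of the `k`-sublists of the tail. Ramsey's theorem for
  -- `k` makes it constant before the construction goes on inside.
  endHom : ∀ t → ∃ λ N → ∀ {A : Set} (χ : List A → Fin c) (xs : List A) → N ≤ length xs →
    ∃ λ (zs : List (A × Fin c)) → map proj₁ zs ⊆ xs × length zs ≡ t × EndHomogeneous χ k zs
  endHom zero    = 0 , λ χ xs _ → [] , minimum xs , refl , []
  endHom (suc t) = suc (proj₁ (ramsey c k (proj₁ (endHom t)))) , step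
    where
    step : ∀ {A : Set} (χ : List A → Fin c) (xs : List A) → _ → _
    step χ (x ∷ xs) (s≤s le)
      with ys , sub , len , col , mono ← proj₂ (ramsey c k (proj₁ (endHom t))) (χ ∘ (x ∷_)) xs le
      with zs , sub′ , len′ , e ← proj₂ (endHom t) χ ys (≤-reflexive (sym len))
      = (x , col) ∷ zs , refl ∷ ⊆-trans sub′ sub , cong suc len′ , (λ s → mono (⊆-trans s sub′)) ∷ e

ramsey₂ : ∀ k m → ∃ λ N → ∀ {A : Set} (χ : List A → Bool) (xs : List A) → N ≤ length xs →
  ∃ λ ys → ys ⊆ xs × length ys ≡ m ×
    ((∀ {zs} → zs ⊆ ys → length zs ≡ k → T (χ zs)) ⊎ (∀ {zs} → zs ⊆ ys → length zs ≡ k → ¬ T (χ zs)))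
ramsey₂ k m with N , ram ← ramsey 2 k m = N , go
  where
  code : Bool → Fin 2
  code b = if b then suc zero else zero
  code-1 : ∀ b → code b ≡ suc zero → T b
  code-1 true _ = _
  code-0 : ∀ b → code b ≡ zero → ¬ T b
  code-0 false _ ()
  go : ∀ {A : Set} (χ : List A → Bool) (xs : List A) → N ≤ length xs →
    ∃ λ ys → ys ⊆ xs × length ys ≡ m ×
      ((∀ {zs} → zs ⊆ ys → length zs ≡ k → T (χ zs)) ⊎ (∀ {zs} → zs ⊆ ys → length zs ≡ k → ¬ T (χ zs)))
  go χ xs le with ram (code ∘ χ) xs le
  ... | ys , sub , len , zero     , h = ys , sub , len , inj₂ λ s l → code-0 _ (h s l)
  ... | ys , sub , len , suc zero , h = ys , sub , len , inj₁ λ s l → code-1 _ (h s l)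

-- Increasing embeddings of index sets

infix 4 _↪_
record _↪_ (m N : ℕ) : Set where
  field
    to   : Fin m → Fin N
    mono : ∀ {a b} → a Fin.< b → to a Fin.< to b
open _↪_ public

id↪ : ∀ {m} → m ↪ m
id↪ = record { to = id ; mono = id }

infixr 9 _∘↪_
_∘↪_ : ∀ {l m n} → m ↪ n → l ↪ m → l ↪ n
f ∘↪ g = record { to = to f ∘ to g ; mono = mono f ∘ mono g }

Sorted : ∀ {n} → List (Fin n) → Set
Sorted = AllPairs Fin._<_

AllPairs-⊆ : ∀ {A : Set} {R : A → A → Set} {xs ys} → xs ⊆ ys → AllPairs R ys → AllPairs R xs
AllPairs-⊆ []           []       = []
AllPairs-⊆ (_ ∷ʳ sub)   (_ ∷ ps) = AllPairs-⊆ sub ps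
AllPairs-⊆ (refl ∷ sub) (p ∷ ps) = All-resp-⊆ sub p ∷ AllPairs-⊆ sub ps

sorted-allFin : ∀ n → Sorted (allFin n)
sorted-allFin n = AllPairsP.tabulate⁺-< id

AllPairs-lookup : ∀ {A : Set} {R : A → A → Set} {xs} → AllPairs R xs → ∀ {i j} → i Fin.< j → R (lookup xs i) (lookup xs j)
AllPairs-lookup (p ∷ ps) {zero}  {suc j} _         = All.lookup p (∈-lookup j)
AllPairs-lookup (p ∷ ps) {suc i} {suc j} (s≤s lt) = AllPairs-lookup ps lt
AllPairs-lookup (p ∷ ps) {zero}  {zero}  ()

enumerate : ∀ {N} (xs : List (Fin N)) → Sorted xs → length xs ↪ N
enumerate xs s = record { to = lookup xs ; mono = AllPairs-lookup s }

positive⇒suc : ∀ {n} {as : List (Fin (suc n))} → All (zero {n} Fin.<_) as → ∃ λ bs → as ≡ map suc bs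
positive⇒suc []                    = [] , refl
positive⇒suc (_∷_ {x = suc a} _ p) with bs , refl ← positive⇒suc p = a ∷ bs , refl

-- The bridge from lists to index sets: through it, a statement on the sublists of `ys` becomes one
-- on increasing tuples of positions.
lookup-⊆ : ∀ {A : Set} (ys : List A) {as} → Sorted as → map (lookup ys) as ⊆ ys
lookup-⊆ ys       {[]}         _        = minimum ys
lookup-⊆ (y ∷ ys) {zero ∷ as}  (p ∷ ps) with bs , refl ← positive⇒suc p =
  refl ∷ subst (_⊆ ys) (map-∘ bs) (lookup-⊆ ys (AllPairs.map s≤s⁻¹ (AllPairsP.map⁻ ps)))
lookup-⊆ (y ∷ ys) {suc a ∷ as} (p ∷ ps) with bs , refl ← positive⇒suc (All.map (<-trans z<s) p) =
  y ∷ʳ subst (_⊆ ys) (cong (_ ∷_) (map-∘ bs)) (lookup-⊆ ys {a ∷ bs} (AllPairs.map s≤s⁻¹ (AllPairsP.map⁻ {f = suc} (p ∷ ps))))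

abstract

  -- Abstract, like most later bounds, so that nested Ramsey numbers are never evaluated.
  ramsey-fin : ∀ c k m → ∃ λ N → (χ : List (Fin N) → Fin c) → Σ (m ↪ N) λ σ → ∃ λ col →
    ∀ as → Sorted as → length as ≡ k → χ (map (to σ) as) ≡ col
  ramsey-fin c k m with N , ram ← ramsey c k m = N , go
    where
    go : (χ : List (Fin N) → Fin c) → Σ (m ↪ N) λ σ → ∃ λ col →
      ∀ as → Sorted as → length as ≡ k → χ (map (to σ) as) ≡ col
    go χ with ys , sub , refl , col , mono ← ram χ (allFin N) (≤-reflexive (sym (length-allFin N))) =
      enumerate ys (AllPairs-⊆ sub (sorted-allFin N)) , col ,
      λ as srt len → mono (lookup-⊆ ys srt) (trans (length-map _ as) len)

Always Never : ∀ {N m} → ℕ → (List (Fin N) → Bool) → m ↪ N → Set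
Always k χ σ = ∀ as → Sorted as → length as ≡ k → T (χ (map (to σ) as))
Never  k χ σ = ∀ as → Sorted as → length as ≡ k → ¬ T (χ (map (to σ) as))

abstract

  ramsey-bool : ∀ k m → ∃ λ N → (χ : List (Fin N) → Bool) → Σ (m ↪ N) λ σ →
    Always k χ σ ⊎ Never k χ σ
  ramsey-bool k m with N , ram ← ramsey₂ k m = N , go
    where
    go : (χ : List (Fin N) → Bool) → Σ (m ↪ N) λ σ →
      Always k χ σ ⊎ Never k χ σ
    go χ with ram χ (allFin N) (≤-reflexive (sym (length-allFin N)))
    ... | ys , sub , refl , inj₁ h = enumerate ys (AllPairs-⊆ sub (sorted-allFin N)) ,
          inj₁ λ as srt len → h (lookup-⊆ ys srt) (trans (length-map _ as) len)
    ... | ys , sub , refl , inj₂ h = enumerate ys (AllPairs-⊆ sub (sorted-allFin N)) ,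
          inj₂ λ as srt len → h (lookup-⊆ ys srt) (trans (length-map _ as) len)

sorted-map : ∀ {m n} (σ : m ↪ n) {as} → Sorted as → Sorted (map (to σ) as)
sorted-map σ s = AllPairsP.map⁺ (AllPairs.map (λ {a} {b} → mono σ {a} {b}) s)

-- Restriction to fewer indices and choices of vertices

infixl 8 _↾_
_↾_ : ∀ {m N} → PHG N → m ↪ N → PHG m
psize (H ↾ σ) i j = psize H (to σ i) (to σ j)
edge (H ↾ σ) i j k = edge H (to σ i) (to σ j) (to σ k)

Choice : ∀ {N} → PHG N → Set
Choice {N} H = (i j : Fin N) → V H i j

infixl 8 _⇂_
_⇂_ : ∀ {m N} {W : Fin N → Fin N → Set} → (∀ i j → W i j) → (σ : m ↪ N) → ∀ i j → W (to σ i) (to σ j)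
(γ ⇂ σ) i j = γ (to σ i) (to σ j)

-- Conditions on a vertex of V_ij depending on a third index before, between or after i and j.
Before Between After : ∀ {N} → PHG N → Set
Before  {N} H = (h i j : Fin N) → V H i j → Bool
Between {N} H = (i x j : Fin N) → V H i j → Bool
After   {N} H = (i j k : Fin N) → V H i j → Bool

T∧ˡ : ∀ {a b} → T (a ∧ b) → T a
T∧ˡ {a} t = proj₁ (Equivalence.to (T-∧ {a}) t)

T∧ʳ : ∀ {a b} → T (a ∧ b) → T b
T∧ʳ {a} t = proj₂ (Equivalence.to (T-∧ {a}) t)

T∧ : ∀ {a b} → T a → T b → T (a ∧ b)
T∧ ta tb = Equivalence.from T-∧ (ta , tb)

-- One vertex for each pair of indices, good for every third index

∑-mono∈ : ∀ {A : Set} (xs : List A) {f g : A → ℕ} → (∀ {x} → x ∈ xs → f x ≤ g x) → ∑ xs f ≤ ∑ xs g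
∑-mono∈ []       le = z≤n
∑-mono∈ (x ∷ xs) le = +-mono-≤ (le (here refl)) (∑-mono∈ xs (le ∘ there))

∑⟦⟧≤ : ∀ {A : Set} (xs : List A) (P : A → Bool) → ∑ xs (λ x → ⟦ P x ⟧) ≤ length xs
∑⟦⟧≤ []       P = z≤n
∑⟦⟧≤ (x ∷ xs) P = +-mono-≤ (⟦⟧≤1 (P x)) (∑⟦⟧≤ xs P)

select : ∀ {A : Set} p (xs : List A) (P : A → Bool) → p ≤ ∑ xs (λ x → ⟦ P x ⟧) →
  ∃ λ ys → ys ⊆ xs × length ys ≡ p × All (T ∘ P) ys
select zero    xs       P le = [] , minimum xs , refl , []
select (suc p) (x ∷ xs) P le with P x in eq
... | true  = let ys , sub , len , all = select p xs P (s≤s⁻¹ le) in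
              x ∷ ys , refl ∷ sub , cong suc len , subst T (sym eq) _ ∷ all
... | false = let ys , sub , len , all = select (suc p) xs P le in ys , x ∷ʳ sub , len , all

split-at : ∀ {A : Set} M n (xs : List A) → length xs ≡ M + suc n →
  ∃ λ hs → ∃ λ i → ∃ λ zs → xs ≡ hs ++ i ∷ zs × length hs ≡ M × length zs ≡ n
split-at zero    n (x ∷ xs) len = [] , x , xs , refl , refl , suc-injective len
split-at (suc M) n (x ∷ xs) len with hs , i , zs , eq , l₁ , l₂ ← split-at M n xs (suc-injective len) =
  x ∷ hs , i , zs , cong (x ∷_) eq , cong suc l₁ , l₂

take-++ : ∀ {A : Set} (xs ys : List A) → take (length xs) (xs ++ ys) ≡ xs
take-++ []       ys = refl
take-++ (x ∷ xs) ys = cong (x ∷_) (take-++ xs ys)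

drop-++ : ∀ {A : Set} (xs ys : List A) → drop (length xs) (xs ++ ys) ≡ ys
drop-++ []       ys = refl
drop-++ (x ∷ xs) ys = drop-++ xs ys

-- A vertex meeting the conditions on average meets each of them with positive frequency.
frequent : ∀ {A : Set} q M {n} (hs xs ks : List A) (P₁ P₂ P₃ : A → Fin (suc n) → Bool) →
  length hs ≡ suc M → length xs ≡ suc M → length ks ≡ suc M →
  (∀ {h x k} → h ∈ hs → x ∈ xs → k ∈ ks → Dense q (λ v → P₁ h v ∧ P₂ x v ∧ P₃ k v)) →
  ∃ λ v → suc M ≤ q * ∑ hs (λ h → ⟦ P₁ h v ⟧) × suc M ≤ q * ∑ xs (λ x → ⟦ P₂ x v ⟧) ×
          suc M ≤ q * ∑ ks (λ k → ⟦ P₃ k v ⟧)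
frequent q M {n} hs xs ks P₁ P₂ P₃ lh lx lk dense =
  v , cancel (c₁ v) (c₂ v) (c₃ v) refl (≤c₂ v) (≤c₃ v) ,
      cancel (c₂ v) (c₁ v) (c₃ v) (swap₁₂ (c₁ v) (c₂ v) (c₃ v)) (≤c₁ v) (≤c₃ v) ,
      cancel (c₃ v) (c₁ v) (c₂ v) (swap₁₃ (c₁ v) (c₂ v) (c₃ v)) (≤c₁ v) (≤c₂ v)
  where
  open ≤-Reasoning
  L : ℕ
  L = suc M
  c₁ c₂ c₃ F : Fin (suc n) → ℕ
  c₁ v = ∑ hs (λ h → ⟦ P₁ h v ⟧)
  c₂ v = ∑ xs (λ x → ⟦ P₂ x v ⟧)
  c₃ v = ∑ ks (λ k → ⟦ P₃ k v ⟧)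
  F v = c₁ v * (c₂ v * c₃ v)
  ≤c₁ : ∀ v → c₁ v ≤ L
  ≤c₁ v = subst (c₁ v ≤_) lh (∑⟦⟧≤ hs _)
  ≤c₂ : ∀ v → c₂ v ≤ L
  ≤c₂ v = subst (c₂ v ≤_) lx (∑⟦⟧≤ xs _)
  ≤c₃ : ∀ v → c₃ v ≤ L
  ≤c₃ v = subst (c₃ v ≤_) lk (∑⟦⟧≤ ks _)
  f : Fin (suc n) → _ → _ → _ → ℕ
  f v h x k = ⟦ P₁ h v ∧ P₂ x v ∧ P₃ k v ⟧
  swap₁₂ : ∀ a b c → a * (b * c) ≡ b * (a * c)
  swap₁₂ = solve-∀
  swap₁₃ : ∀ a b c → a * (b * c) ≡ c * (a * b)
  swap₁₃ = solve-∀
  assoc₃ : ∀ a b → a * (a * (a * b)) ≡ b * (a * (a * a))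
  assoc₃ = solve-∀
  -- The three conditions concern different indices, so the number of good triples at `v` factors.
  product : ∀ v → ∑ hs (λ h → ∑ xs (λ x → ∑ ks (f v h x))) ≡ F v
  product v = trans
    (∑-cong hs λ h → trans (∑-cong xs λ x → trans (∑-cong ks λ k →
        trans (⟦⟧-∧ (P₁ h v) _) (cong (⟦ P₁ h v ⟧ *_) (⟦⟧-∧ (P₂ x v) (P₃ k v))))
      (∑-*ˡ ks ⟦ P₁ h v ⟧ _)) (trans (∑-*ˡ xs ⟦ P₁ h v ⟧ _) (cong (⟦ P₁ h v ⟧ *_) (∑∑-* xs ks _ _))))
    (∑-*ʳ hs (c₂ v * c₃ v) _)
  total : suc n * (L * (L * L)) ≤ q * ∑ (allFin (suc n)) F
  total = begin
    suc n * (L * (L * L))  ≡⟨ assoc₃ L (suc n) ⟨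
    L * (L * (L * suc n))  ≡⟨ trans (∑-const hs _) (cong₂ _*_ lh (trans (∑-const xs _) (cong₂ _*_ lx (trans (∑-const ks _) (cong (_* suc n) lk))))) ⟨
    ∑ hs (λ h → ∑ xs λ x → ∑ ks λ k → suc n)
      ≤⟨ ∑-mono∈ hs (λ h∈ → ∑-mono∈ xs λ x∈ → ∑-mono∈ ks λ k∈ → ≤-trans (dense h∈ x∈ k∈) (≤-reflexive (cong (q *_) (count-∑ _)))) ⟩
    ∑ hs (λ h → ∑ xs λ x → ∑ ks λ k → q * ∑ vs (λ v → f v h x k))
      ≡⟨ trans (∑-cong hs λ h → trans (∑-cong xs λ x → ∑-*ˡ ks q _) (∑-*ˡ xs q _)) (∑-*ˡ hs q _) ⟩
    q * ∑ hs (λ h → ∑ xs λ x → ∑ ks λ k → ∑ vs (λ v → f v h x k))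
      ≡⟨ cong (q *_) (∑-cong hs λ h → ∑-cong xs λ x → ∑-swap ks vs _) ⟩
    q * ∑ hs (λ h → ∑ xs λ x → ∑ vs λ v → ∑ ks (f v h x))
      ≡⟨ cong (q *_) (∑-cong hs λ h → ∑-swap xs vs _) ⟩
    q * ∑ hs (λ h → ∑ vs λ v → ∑ xs λ x → ∑ ks (f v h x))
      ≡⟨ cong (q *_) (∑-swap hs vs _) ⟩
    q * ∑ vs (λ v → ∑ hs λ h → ∑ xs λ x → ∑ ks (f v h x))
      ≡⟨ cong (q *_) (∑-cong vs product) ⟩
    q * ∑ vs F ∎
    where vs = allFin (suc n)
  best : ∃ λ v → ∑ (allFin (suc n)) F ≤ suc n * F v
  best with v , le ← ∑-max zero (tabulate suc) F = v , subst (λ l → ∑ (allFin (suc n)) F ≤ l * F v) (length-allFin (suc n)) le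
  v : Fin (suc n)
  v = proj₁ best
  cube : L * (L * L) ≤ q * F v
  cube = *-cancelˡ-≤ (suc n) (begin
    suc n * (L * (L * L))  ≤⟨ total ⟩
    q * ∑ (allFin (suc n)) F  ≤⟨ *-monoʳ-≤ q (proj₂ best) ⟩
    q * (suc n * F v)  ≡⟨ swap₁₂ q (suc n) (F v) ⟩
    suc n * (q * F v)  ∎)
  -- Every factor of `F v` is at most `L`, so a product of at least L³/q forces each factor to be at
  -- least L/q.
  cancel : ∀ a b c → F v ≡ a * (b * c) → b ≤ L → c ≤ L → L ≤ q * a
  cancel a b c eq b≤ c≤ = *-cancelʳ-≤ L (q * a) (L * L) (begin
    L * (L * L)  ≤⟨ cube ⟩
    q * F v  ≡⟨ trans (cong (q *_) eq) (sym (*-assoc q a _)) ⟩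
    q * a * (b * c)  ≤⟨ *-monoʳ-≤ (q * a) (*-mono-≤ b≤ c≤) ⟩
    q * a * (L * L)  ∎)

module _ {N} (H : PHG N)
         (S₁ : Before H) (S₂ : Between H) (S₃ : After H) where

  Common : (hs : List (Fin N)) (i : Fin N) (xs : List (Fin N)) (j : Fin N) (ks : List (Fin N)) → Set
  Common hs i xs j ks = ∃ λ (v : V H i j) →
    All (λ h → T (S₁ h i j v)) hs × All (λ x → T (S₂ i x j v)) xs × All (λ k → T (S₃ i j k v)) ks

  common? : ∀ hs i xs j ks → Dec (Common hs i xs j ks)
  common? hs i xs j ks = Fin.any? λ v →
    all? (λ h → T? (S₁ h i j v)) hs ×-dec all? (λ x → T? (S₂ i x j v)) xs ×-dec all? (λ k → T? (S₃ i j k v)) ks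

  -- A shape counts the indices before `i`, between `i` and `j`, and after `j`. Once it is fixed, a
  -- list determines `i` and `j`, and having a common vertex becomes a colouring of lists of one
  -- length.
  CommonShape : ℕ × ℕ × ℕ → List (Fin N) → Set
  CommonShape (p , q , r) ys = ∀ hs i xs j ks → hs ++ i ∷ xs ++ j ∷ ks ⊆ ys →
    length hs ≡ p → length xs ≡ q → length ks ≡ r → Common hs i xs j ks

  colour₂ : ℕ → List (Fin N) → Fin N → List (Fin N) → List (Fin N) → Bool
  colour₂ q hs i xs (j ∷ ks) = isYes (common? hs i xs j ks)
  colour₂ q hs i xs []       = false

  colour₁ : ℕ → List (Fin N) → List (Fin N) → Bool
  colour₁ q hs (i ∷ zs) = colour₂ q hs i (take q zs) (drop q zs)
  colour₁ q hs []       = false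

  colour : ℕ → ℕ → List (Fin N) → Bool
  colour p q zs = colour₁ q (take p zs) (drop p zs)

  colour-correct : ∀ hs i xs j ks →
    colour (length hs) (length xs) (hs ++ i ∷ xs ++ j ∷ ks) ≡ isYes (common? hs i xs j ks)
  colour-correct hs i xs j ks
    rewrite take-++ hs (i ∷ xs ++ j ∷ ks) | drop-++ hs (i ∷ xs ++ j ∷ ks) | take-++ xs (j ∷ ks) | drop-++ xs (j ∷ ks) = refl

  commonShape-⊆ : ∀ pqr {xs ys} → xs ⊆ ys → CommonShape pqr ys → CommonShape pqr xs
  commonShape-⊆ _ sub c hs i xs j ks s = c hs i xs j ks (⊆-trans s sub)

DenseAround : ∀ {N} → ℕ → (H : PHG N) →
  Before H → Between H → After H → Set
DenseAround q H S₁ S₂ S₃ = ∀ {h i x j k} → h Fin.< i → i Fin.< x → x Fin.< j → j Fin.< k →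
  Dense q (λ v → S₁ h i j v ∧ S₂ i x j v ∧ S₃ i j k v)

-- Suppose that a homogeneous set never has a common vertex. By `frequent`, applied to three long
-- runs of its indices separated by `i` and `j`, some vertex is good for a 1/q proportion of each
-- run. Selecting `p₁`, `p₂` and `p₃` good indices gives a list of the right shape with a common
-- vertex, a contradiction.
common-shape : ∀ q pqr m → ∃ λ N₀ → ∀ {N} (H : PHG N) (S₁ : Before H) (S₂ : Between H) (S₃ : After H) → DenseAround q H S₁ S₂ S₃ →
  ∀ ys → Sorted ys → N₀ ≤ length ys →
  ∃ λ ts → ts ⊆ ys × length ts ≡ m × CommonShape H S₁ S₂ S₃ pqr ts
common-shape q pqr@(p₁ , p₂ , p₃) m = proj₁ ram , go
  where
  M block : ℕ
  -- A run of length `suc M` exceeds `q` times the size of the shape, so that a 1/q proportion of it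
  -- suffices for the selection.
  M = q * (p₁ + p₂ + p₃)
  block = suc M + suc (suc M + suc (suc M))
  k : ℕ
  k = p₁ + suc (p₂ + suc p₃)
  ram = ramsey₂ k (m + block)
  size : ∀ {A : Set} (hs : List A) i xs j ks → length hs ≡ p₁ → length xs ≡ p₂ → length ks ≡ p₃ →
    length (hs ++ i ∷ xs ++ j ∷ ks) ≡ p₁ + suc (p₂ + suc p₃)
  size hs i xs j ks refl refl refl =
    trans (length-++ hs) (cong (λ l → length hs + suc l) (length-++ xs))
  refute : ∀ {N} (H : PHG N) (S₁ : Before H) (S₂ : Between H) (S₃ : After H) → DenseAround q H S₁ S₂ S₃ → ∀ hs i xs j ks →
    Sorted (hs ++ i ∷ xs ++ j ∷ ks) → length hs ≡ suc M → length xs ≡ suc M → length ks ≡ suc M →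
    ¬ (∀ {zs} → zs ⊆ hs ++ i ∷ xs ++ j ∷ ks → length zs ≡ p₁ + suc (p₂ + suc p₃) → ¬ T (colour H S₁ S₂ S₃ p₁ p₂ zs))
  refute H S₁ S₂ S₃ dense hs i xs j ks srt lh lx lk h =
    let v , f₁ , f₂ , f₃ = frequent q M hs xs ks (λ h → S₁ h i j) (λ x → S₂ i x j) (λ k → S₃ i j k) lh lx lk dense′
    in finish v (select p₁ hs (λ h → S₁ h i j v) (enough (≤-trans (m≤m+n p₁ p₂) (m≤m+n _ p₃)) f₁))
                (select p₂ xs (λ x → S₂ i x j v) (enough (≤-trans (m≤n+m p₂ p₁) (m≤m+n _ p₃)) f₂))
                (select p₃ ks (λ k → S₃ i j k v) (enough (m≤n+m p₃ _) f₃))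
    where
    dense′ : ∀ {h x k} → h ∈ hs → x ∈ xs → k ∈ ks → Dense q (λ v → S₁ h i j v ∧ S₂ i x j v ∧ S₃ i j k v)
    dense′ h∈ x∈ k∈ with ((h<i ∷ _) ∷ (i<x ∷ _) ∷ (x<j ∷ _) ∷ (j<k ∷ _) ∷ _) ←
      AllPairs-⊆ (++⁺ (from∈ h∈) (refl ∷ ++⁺ (from∈ x∈) (refl ∷ from∈ k∈))) srt =
      dense h<i i<x x<j j<k
    enough : ∀ {p c} → p ≤ p₁ + p₂ + p₃ → suc M ≤ q * c → p ≤ c
    enough {p} {c} p≤ f with p ≤? c
    ... | yes le = le
    ... | no  ¬le = contradiction (≤-trans f (*-monoʳ-≤ q (≤-trans (<⇒≤ (≰⇒> ¬le)) p≤))) 1+n≰n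
    finish : ∀ v →
      (∃ λ hs′ → hs′ ⊆ hs × length hs′ ≡ p₁ × All (λ h → T (S₁ h i j v)) hs′) →
      (∃ λ xs′ → xs′ ⊆ xs × length xs′ ≡ p₂ × All (λ x → T (S₂ i x j v)) xs′) →
      (∃ λ ks′ → ks′ ⊆ ks × length ks′ ≡ p₃ × All (λ k → T (S₃ i j k v)) ks′) → ⊥
    finish v (hs′ , subʰ , lh′ , a₁) (xs′ , subˣ , lx′ , a₂) (ks′ , subᵏ , lk′ , a₃) =
      h (++⁺ subʰ (refl ∷ ++⁺ subˣ (refl ∷ subᵏ))) (size hs′ i xs′ j ks′ lh′ lx′ lk′)
        (subst T (sym (trans (cong₂ (λ p q → colour H S₁ S₂ S₃ p q _) (sym lh′) (sym lx′))
          (colour-correct H S₁ S₂ S₃ hs′ i xs′ j ks′))) (fromWitness (v , a₁ , a₂ , a₃)))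
  decide : ∀ {N} (H : PHG N) (S₁ : Before H) (S₂ : Between H) (S₃ : After H) → DenseAround q H S₁ S₂ S₃ → ∀ ys → Sorted ys →
    ∀ zs → zs ⊆ ys → length zs ≡ m + block →
    (∀ {ws} → ws ⊆ zs → length ws ≡ k → T (colour H S₁ S₂ S₃ p₁ p₂ ws)) ⊎
    (∀ {ws} → ws ⊆ zs → length ws ≡ k → ¬ T (colour H S₁ S₂ S₃ p₁ p₂ ws)) →
    ∃ λ ts → ts ⊆ ys × length ts ≡ m × CommonShape H S₁ S₂ S₃ pqr ts
  decide H S₁ S₂ S₃ dense ys srt zs sub len (inj₁ h) =
    let ts , sub′ , len′ = shorten m zs (≤-trans (m≤m+n m block) (≤-reflexive (sym len))) in
    ts , ⊆-trans sub′ sub , len′ , λ hs i xs j ks s lh lx lk → toWitness (subst T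
      (trans (cong₂ (λ p q → colour H S₁ S₂ S₃ p q _) (sym lh) (sym lx)) (colour-correct H S₁ S₂ S₃ hs i xs j ks))
      (h (⊆-trans s sub′) (size hs i xs j ks lh lx lk)))
  decide H S₁ S₂ S₃ dense ys srt zs sub len (inj₂ h) = ⊥-elim (
    let bs , sub′ , len′ = shorten block zs (≤-trans (m≤n+m block m) (≤-reflexive (sym len)))
        hs , i , bs′ , eq , lh , l′ = split-at (suc M) _ bs len′
        xs , j , ks , eq′ , lx , lk = split-at (suc M) _ bs′ l′
        sub″ = subst (_⊆ zs) (trans eq (cong (λ l → hs ++ i ∷ l) eq′)) sub′
    in refute H S₁ S₂ S₃ dense hs i xs j ks (AllPairs-⊆ (⊆-trans sub″ sub) srt) lh lx lk λ s → h (⊆-trans s sub″))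
  go : ∀ {N} (H : PHG N) (S₁ : Before H) (S₂ : Between H) (S₃ : After H) → DenseAround q H S₁ S₂ S₃ →
    ∀ ys → Sorted ys → proj₁ ram ≤ length ys →
    ∃ λ ts → ts ⊆ ys × length ts ≡ m × CommonShape H S₁ S₂ S₃ pqr ts
  go H S₁ S₂ S₃ dense ys srt le = let zs , sub , len , h = proj₂ ram (colour H S₁ S₂ S₃ p₁ p₂) ys le in
    decide H S₁ S₂ S₃ dense ys srt zs sub len h

common-shapes : ∀ q shapes m → ∃ λ N₀ → ∀ {N} (H : PHG N) (S₁ : Before H) (S₂ : Between H) (S₃ : After H) → DenseAround q H S₁ S₂ S₃ →
  ∀ ys → Sorted ys → N₀ ≤ length ys →
  ∃ λ ts → ts ⊆ ys × length ts ≡ m × All (λ pqr → CommonShape H S₁ S₂ S₃ pqr ts) shapes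
common-shapes q [] m = m , λ H S₁ S₂ S₃ dense ys srt le →
  let ts , sub , len = shorten m ys le in ts , sub , len , []
common-shapes q (pqr ∷ shapes) m = proj₁ one , λ H S₁ S₂ S₃ dense ys srt le →
    let ts , sub , len , c = proj₂ one H S₁ S₂ S₃ dense ys srt le
        us , sub′ , len′ , cs = proj₂ rest H S₁ S₂ S₃ dense ts (AllPairs-⊆ sub srt) (≤-reflexive (sym len))
    in us , ⊆-trans sub′ sub , len′ , commonShape-⊆ H S₁ S₂ S₃ pqr sub′ c ∷ cs
  where
  rest = common-shapes q shapes m
  one = common-shape q pqr (proj₁ rest)

CommonChoice : ∀ {m N} (H : PHG N) (σ : m ↪ N) →
  Before H → Between H → After H → Choice (H ↾ σ) → Set
CommonChoice H σ S₁ S₂ S₃ v =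
  (∀ {h i j} → h Fin.< i → i Fin.< j → T (S₁ (to σ h) (to σ i) (to σ j) (v i j))) ×
  (∀ {i x j} → i Fin.< x → x Fin.< j → T (S₂ (to σ i) (to σ x) (to σ j) (v i j))) ×
  (∀ {i j k} → i Fin.< j → j Fin.< k → T (S₃ (to σ i) (to σ j) (to σ k) (v i j)))

shapesUpTo : ℕ → List (ℕ × ℕ × ℕ)
shapesUpTo m = cartesianProduct (upTo (suc m)) (cartesianProduct (upTo (suc m)) (upTo (suc m)))

-- For each pair `i < j` the lists of all indices before, between and after have some shape in
-- `shapesUpTo`. A common vertex for these three lists serves every third index at once.
common-shapes⇒choice : ∀ {N} (H : PHG N) (S₁ : Before H) (S₂ : Between H) (S₃ : After H) ts → Sorted ts →
  All (λ pqr → CommonShape H S₁ S₂ S₃ pqr ts) (shapesUpTo (length ts)) →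
  Σ (length ts ↪ N) λ σ → Σ (Choice (H ↾ σ)) (CommonChoice H σ S₁ S₂ S₃)
common-shapes⇒choice {N} H S₁ S₂ S₃ ts srt shapes =
  σ , v , (λ h<i i<j → spec₁ i<j h<i) , (λ i<x x<j → spec₂ (<-trans i<x x<j) i<x x<j) , (λ i<j j<k → spec₃ i<j j<k)
  where
  I : Set
  I = Fin (length ts)
  σ : length ts ↪ N
  σ = enumerate ts srt
  at : List I → List (Fin N)
  at = map (to σ)
  before after : I → List I
  before i = filter (Fin._<? i) (allFin _)
  after j = filter (j Fin.<?_) (allFin _)
  between : I → I → List I
  between i j = filter (λ x → (i Fin.<? x) ×-dec (x Fin.<? j)) (allFin _)
  short : ∀ {P : I → Set} (P? : ∀ x → Dec (P x)) → length (at (filter P? (allFin _))) ∈ upTo (suc (length ts))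
  short P? = ∈-upTo⁺ (s≤s (subst₂ _≤_ (sym (length-map (to σ) (filter P? (allFin _)))) (length-allFin _) (length-filter P? (allFin _))))
  sorted-filter : ∀ {P : I → Set} (P? : ∀ x → Dec (P x)) → Sorted (filter P? (allFin _))
  sorted-filter P? = AllPairsP.filter⁺ P? (sorted-allFin _)
  pick : ∀ i j → i Fin.< j → Common H S₁ S₂ S₃ (at (before i)) (to σ i) (at (between i j)) (to σ j) (at (after j))
  pick i j i<j = All.lookup shapes
      (∈-cartesianProduct⁺ (short (Fin._<? i)) (∈-cartesianProduct⁺ (short (λ x → (i Fin.<? x) ×-dec (x Fin.<? j))) (short (j Fin.<?_))))
      (at (before i)) (to σ i) (at (between i j)) (to σ j) (at (after j)) (subst (_⊆ ts) at-++ (lookup-⊆ ts sorted)) refl refl refl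
    where
    at-++ : at (before i ++ i ∷ between i j ++ j ∷ after j) ≡ at (before i) ++ to σ i ∷ at (between i j) ++ to σ j ∷ at (after j)
    at-++ = trans (map-++ _ (before i) _) (cong (λ l → at (before i) ++ to σ i ∷ l) (map-++ _ (between i j) _))
    j<after : All (j Fin.<_) (after j)
    j<after = all-filter (j Fin.<?_) (allFin _)
    i<x<j : All (λ x → i Fin.< x × x Fin.< j) (between i j)
    i<x<j = all-filter (λ x → (i Fin.<? x) ×-dec (x Fin.<? j)) (allFin _)
    i<rest : All (i Fin.<_) (between i j ++ j ∷ after j)
    i<rest = AllP.++⁺ (All.map proj₁ i<x<j) (i<j ∷ All.map (<-trans i<j) j<after)
    sorted : Sorted (before i ++ i ∷ between i j ++ j ∷ after j)
    sorted = AllPairsP.++⁺ (sorted-filter (Fin._<? i))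
      (i<rest ∷ AllPairsP.++⁺ (sorted-filter (λ x → (i Fin.<? x) ×-dec (x Fin.<? j))) (j<after ∷ sorted-filter (j Fin.<?_))
        (All.map (λ { (_ , x<j) → x<j ∷ All.map (<-trans x<j) j<after }) i<x<j))
      (All.map (λ h<i → h<i ∷ All.map (<-trans h<i) i<rest) (all-filter (Fin._<? i) (allFin _)))
  -- Pairs that are not increasing get a junk vertex.
  v : Choice (H ↾ σ)
  v i j with i Fin.<? j
  ... | yes i<j = proj₁ (pick i j i<j)
  ... | no  _   = zero
  spec₁ : ∀ {i j} → i Fin.< j → ∀ {h} → h Fin.< i → T (S₁ (to σ h) (to σ i) (to σ j) (v i j))
  spec₁ {i} {j} i<j h<i with i Fin.<? j
  ... | yes i<j′ = All.lookup (proj₁ (proj₂ (pick i j i<j′))) (∈-map⁺ (to σ) (∈-filter⁺ (Fin._<? i) (∈-allFin _) h<i))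
  ... | no  i≮j  = contradiction i<j i≮j
  spec₂ : ∀ {i j} → i Fin.< j → ∀ {x} → i Fin.< x → x Fin.< j → T (S₂ (to σ i) (to σ x) (to σ j) (v i j))
  spec₂ {i} {j} i<j i<x x<j with i Fin.<? j
  ... | yes i<j′ = All.lookup (proj₁ (proj₂ (proj₂ (pick i j i<j′))))
        (∈-map⁺ (to σ) (∈-filter⁺ (λ x → (i Fin.<? x) ×-dec (x Fin.<? j)) (∈-allFin _) (i<x , x<j)))
  ... | no  i≮j  = contradiction i<j i≮j
  spec₃ : ∀ {i j} → i Fin.< j → ∀ {k} → j Fin.< k → T (S₃ (to σ i) (to σ j) (to σ k) (v i j))
  spec₃ {i} {j} i<j j<k with i Fin.<? j
  ... | yes i<j′ = All.lookup (proj₂ (proj₂ (proj₂ (pick i j i<j′)))) (∈-map⁺ (to σ) (∈-filter⁺ (j Fin.<?_) (∈-allFin _) j<k))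
  ... | no  i≮j  = contradiction i<j i≮j

abstract

  common-choice : ∀ q m → ∃ λ N → (H : PHG N) (S₁ : Before H) (S₂ : Between H) (S₃ : After H) → DenseAround q H S₁ S₂ S₃ →
    Σ (m ↪ N) λ σ → Σ (Choice (H ↾ σ)) (CommonChoice H σ S₁ S₂ S₃)
  common-choice q m = let N , cs = common-shapes q (shapesUpTo m) m in N , λ H S₁ S₂ S₃ dense →
    let ts , sub , len , shapes = cs H S₁ S₂ S₃ dense (allFin N) (sorted-allFin N) (≤-reflexive (sym (length-allFin N)))
    in subst (λ m → All (λ pqr → CommonShape H S₁ S₂ S₃ pqr ts) (shapesUpTo m) →
         Σ (m ↪ N) λ σ → Σ (Choice (H ↾ σ)) (CommonChoice H σ S₁ S₂ S₃))
       len (common-shapes⇒choice H S₁ S₂ S₃ ts (AllPairs-⊆ sub (sorted-allFin N))) shapes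

ChoiceAfter : ℕ → ℕ → ℕ → Set
ChoiceAfter q m N = (H : PHG N) (S : After H) →
  (∀ {i j k} → i Fin.< j → j Fin.< k → Dense q (S i j k)) →
  Σ (m ↪ N) λ σ → Σ (Choice (H ↾ σ)) λ v →
    ∀ {i j k} → i Fin.< j → j Fin.< k → T (S (to σ i) (to σ j) (to σ k) (v i j))

choice-after-proof : ∀ q m → ∃ (ChoiceAfter q m)
choice-after-proof q m = proj₁ cc , λ H S dense →
  let σ , v , _ , _ , p = proj₂ cc H (λ _ _ _ _ → true) (λ _ _ _ _ → true) S
        (λ h<i i<x x<j j<k → dense (<-trans i<x x<j) j<k)
  in σ , v , p
  where cc = common-choice q m

abstract

  choice-after : ∀ q m → ∃ (ChoiceAfter q m)
  choice-after = choice-after-proof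

ChoiceBefore : ℕ → ℕ → ℕ → Set
ChoiceBefore q m N = (H : PHG N) (S : Before H) →
  (∀ {h i j} → h Fin.< i → i Fin.< j → Dense q (S h i j)) →
  Σ (m ↪ N) λ σ → Σ (Choice (H ↾ σ)) λ v →
    ∀ {h i j} → h Fin.< i → i Fin.< j → T (S (to σ h) (to σ i) (to σ j) (v i j))

choice-before-proof : ∀ q m → ∃ (ChoiceBefore q m)
choice-before-proof q m = proj₁ cc , λ H S dense →
  let σ , v , p , _ = proj₂ cc H S (λ _ _ _ _ → true) (λ _ _ _ _ → true)
        (λ h<i i<x x<j j<k → dense-mono {q} (λ v t → T∧ t _) (dense h<i (<-trans i<x x<j)))
  in σ , v , p
  where cc = common-choice q m

abstract

  choice-before : ∀ q m → ∃ (ChoiceBefore q m)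
  choice-before = choice-before-proof

ChoiceBeforeAfter : ℕ → ℕ → ℕ → Set
ChoiceBeforeAfter q m N = (H : PHG N) (S₁ : Before H) (S₃ : After H) →
  (∀ {h i j k} → h Fin.< i → i Fin.< j → j Fin.< k → Dense q (λ v → S₁ h i j v ∧ S₃ i j k v)) →
  Σ (m ↪ N) λ σ → Σ (Choice (H ↾ σ)) λ v →
    (∀ {h i j} → h Fin.< i → i Fin.< j → T (S₁ (to σ h) (to σ i) (to σ j) (v i j))) ×
    (∀ {i j k} → i Fin.< j → j Fin.< k → T (S₃ (to σ i) (to σ j) (to σ k) (v i j)))

choice-before-after-proof : ∀ q m → ∃ (ChoiceBeforeAfter q m)
choice-before-after-proof q m = proj₁ cc , λ H S₁ S₃ dense →
  let σ , v , p₁ , _ , p₃ = proj₂ cc H S₁ (λ _ _ _ _ → true) S₃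
        (λ h<i i<x x<j j<k → dense h<i (<-trans i<x x<j) j<k)
  in σ , v , p₁ , p₃
  where cc = common-choice q m

abstract

  choice-before-after : ∀ q m → ∃ (ChoiceBeforeAfter q m)
  choice-before-after = choice-before-after-proof

-- Neighbourhoods, and outcomes (1) and (2)

module _ {N} (q : ℕ) (H : PHG N) (γ : Choice H) where

  inL : After H
  inL i j k x = card H j k ≤ᵇ q * count (λ y → edge H i j k x y (γ i k))

  inR : Before H
  inR h i j y = card H h i ≤ᵇ q * count (λ x → edge H h i j x y (γ h j))

inL-dense : ∀ {N} q (H : PHG N) γ {i j k x} → T (inL q H γ i j k x) → Dense q (λ y → edge H i j k x y (γ i k))
inL-dense q H γ {j = j} {k} t = ≤ᵇ⇒≤ (card H j k) _ t

inR-dense : ∀ {N} q (H : PHG N) γ {h i j y} → T (inR q H γ h i j y) → Dense q (λ x → edge H h i j x y (γ h j))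
inR-dense q H γ {h} {i} t = ≤ᵇ⇒≤ (card H h i) _ t

whole : ∀ {m} (H : PHG m) → Sub H m
whole H = record { ι = id ; ι-mono = λ _ _ → id ; E = λ a b c l r t → T (edge H a b c l r t) ; E⊆ = λ _ _ _ _ _ _ → id }

Outcome : ∀ {N} → ℕ → PHG N → Set₁
Outcome n H = Σ (Sub H (4 * n)) λ H₀ → Case1 H₀ ⊎ Case2 H₀ ⊎ Case3 H₀ ⊎ Case4 H₀ n

outcome-↾ : ∀ {m N n} {H : PHG N} (σ : m ↪ N) → Outcome n (H ↾ σ) → Outcome n H
outcome-↾ σ (H₀ , c) = record
  { ι = to σ ∘ ι H₀ ; ι-mono = λ a b → mono σ ∘ ι-mono H₀ a b ; E = E H₀ ; E⊆ = E⊆ H₀ } , c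

-- A row on which `P` fails is empty, so the rows found by `dense-rows` satisfy `P` and are dense in
-- `B`.
row-split : ∀ q {n m} {P : Fin n → Bool} {B : Fin n → Fin (suc m) → Bool} →
  Dense₂ q (λ x y → P x ∧ B x y) → Dense (2 * q) (λ x → P x ∧ (suc m ≤ᵇ 2 * q * count (B x)))
row-split q {m = m} {P} {B} d = dense-mono {2 * q} split (dense-rows q d)
  where
  split : ∀ x → T (suc m ≤ᵇ 2 * q * count (λ y → P x ∧ B x y)) → T (P x ∧ (suc m ≤ᵇ 2 * q * count (B x)))
  split x t with P x
  ... | true  = t
  ... | false rewrite count-false (suc m) | *-zeroʳ (2 * q) = t

Case1From : ℕ → ℕ → ℕ → Set
Case1From q m N = (H : PHG N) (γ γ′ : Choice H) →
  (∀ {h i j k} → h Fin.< i → i Fin.< j → j Fin.< k →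
    Dense₂ q (λ x y → inR q H γ h i j x ∧ inR q H γ i j k y ∧ edge H i j k x y (γ′ i k))) →
  Σ (m ↪ N) λ σ → Case1 (whole (H ↾ σ))

-- Here `γ` becomes γ⁰ and `γ′` becomes γω. The vertex `ω` lies in R and has many neighbours in R
-- through `γ′`; `β` is one of these. Since `ω` and `β` both lie in R, vertices `αω` and `α`
-- complete them to edges with top `γ`.
case1-proof : ∀ q m → ∃ (Case1From q m)
case1-proof q m = proj₁ s₁ , go
  where
  -- The bounds are found from the last choice back to the first, since each choice must leave
  -- enough indices for the later ones.
  s₄ = choice-after q m
  s₃ = choice-before (2 * q) (proj₁ s₄)
  s₂ = choice-after q (proj₁ s₃)
  s₁ = choice-before-after (2 * q) (proj₁ s₂)
  go : Case1From q m (proj₁ s₁)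
  go H γ γ′ dense
    with σ₁ , ω , ωR , ωD ← proj₂ s₁ H (inR q H γ)
        (λ i j k x → card H j k ≤ᵇ 2 * q * count (λ y → inR q H γ i j k y ∧ edge H i j k x y (γ′ i k)))
        (λ h<i i<j j<k → row-split q (dense h<i i<j j<k))
    with σ₂ , αω , αωE ← proj₂ s₂ (H ↾ σ₁) (λ i j k x → edge (H ↾ σ₁) i j k x (ω j k) ((γ ⇂ σ₁) i k))
        (λ i<j j<k → inR-dense q (H ↾ σ₁) (γ ⇂ σ₁) (ωR i<j j<k))
    with σ₃ , β , βP ← proj₂ s₃ (H ↾ σ₁ ↾ σ₂) (λ i j k y → inR q (H ↾ σ₁ ↾ σ₂) (γ ⇂ σ₁ ⇂ σ₂) i j k y ∧
          edge (H ↾ σ₁ ↾ σ₂) i j k ((ω ⇂ σ₂) i j) y ((γ′ ⇂ σ₁ ⇂ σ₂) i k))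
        (λ {i} {j} {k} i<j j<k → ≤ᵇ⇒≤ (card (H ↾ σ₁ ↾ σ₂) j k) _ (ωD (mono σ₂ i<j) (mono σ₂ j<k)))
    with σ₄ , α , αE ← proj₂ s₄ (H ↾ σ₁ ↾ σ₂ ↾ σ₃)
        (λ i j k x → edge (H ↾ σ₁ ↾ σ₂ ↾ σ₃) i j k x (β j k) ((γ ⇂ σ₁ ⇂ σ₂ ⇂ σ₃) i k))
        (λ {i} {j} {k} i<j j<k → inR-dense q (H ↾ σ₁ ↾ σ₂ ↾ σ₃) (γ ⇂ σ₁ ⇂ σ₂ ⇂ σ₃) (T∧ˡ (βP i<j j<k)))
    = σ₁ ∘↪ σ₂ ∘↪ σ₃ ∘↪ σ₄ ,
     α , (β ⇂ σ₄) , (γ ⇂ σ₁ ⇂ σ₂ ⇂ σ₃ ⇂ σ₄) , (ω ⇂ σ₂ ⇂ σ₃ ⇂ σ₄) , (αω ⇂ σ₃ ⇂ σ₄) , (γ′ ⇂ σ₁ ⇂ σ₂ ⇂ σ₃ ⇂ σ₄) ,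
     λ a b c a<b b<c → αE a<b b<c ,
       T∧ʳ (βP (mono σ₄ a<b) (mono σ₄ b<c)) ,
       αωE (mono σ₃ (mono σ₄ a<b)) (mono σ₃ (mono σ₄ b<c))

abstract

  case1 : ∀ q m → ∃ (Case1From q m)
  case1 = case1-proof

Case2From : ℕ → ℕ → ℕ → Set
Case2From q m N = (H : PHG N) (γ γ′ : Choice H) →
  (∀ {i j k s} → i Fin.< j → j Fin.< k → k Fin.< s →
    Dense₂ q (λ x y → inL q H γ j k s y ∧ inL q H γ i j k x ∧ edge H i j k x y (γ′ i k))) →
  Σ (m ↪ N) λ σ → Case2 (whole (H ↾ σ))

-- The mirror image of `case1-proof`: `ω` is now the right end of a dense set of pairs in L × L and
-- `α` a left end, which explains the transposition by `dense₂-swap`. Both lie in L, which yields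
-- `βω` and `β`.
case2-proof : ∀ q m → ∃ (Case2From q m)
case2-proof q m = proj₁ s₁ , go
  where
  s₄ = choice-before q m
  s₃ = choice-after (2 * q) (proj₁ s₄)
  s₂ = choice-before q (proj₁ s₃)
  s₁ = choice-before-after (2 * q) (proj₁ s₂)
  go : Case2From q m (proj₁ s₁)
  go H γ γ′ dense
    with σ₁ , ω , ωD , ωL ← proj₂ s₁ H
        (λ h i j y → card H h i ≤ᵇ 2 * q * count (λ x → inL q H γ h i j x ∧ edge H h i j x y (γ′ h j)))
        (inL q H γ)
        (λ {h} {i} {j} {k} h<i i<j j<k → dense-mono {2 * q} (λ y t → T∧ (T∧ʳ {inL q H γ i j k y} t) (T∧ˡ {inL q H γ i j k y} t))
          (row-split q {P = inL q H γ i j k} {B = λ y x → inL q H γ h i j x ∧ edge H h i j x y (γ′ h j)} (dense₂-swap q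
            (λ x y → inL q H γ i j k y ∧ inL q H γ h i j x ∧ edge H h i j x y (γ′ h j)) (dense h<i i<j j<k))))
    with σ₂ , βω , βωE ← proj₂ s₂ (H ↾ σ₁) (λ h i j y → edge (H ↾ σ₁) h i j (ω h i) y ((γ ⇂ σ₁) h j))
        (λ h<i i<j → inL-dense q (H ↾ σ₁) (γ ⇂ σ₁) (ωL h<i i<j))
    with σ₃ , α , αP ← proj₂ s₃ (H ↾ σ₁ ↾ σ₂) (λ i j k x → inL q (H ↾ σ₁ ↾ σ₂) (γ ⇂ σ₁ ⇂ σ₂) i j k x ∧
          edge (H ↾ σ₁ ↾ σ₂) i j k x ((ω ⇂ σ₂) j k) ((γ′ ⇂ σ₁ ⇂ σ₂) i k))
        (λ {i} {j} {k} i<j j<k → ≤ᵇ⇒≤ (card (H ↾ σ₁ ↾ σ₂) i j) _ (ωD (mono σ₂ i<j) (mono σ₂ j<k)))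
    with σ₄ , β , βE ← proj₂ s₄ (H ↾ σ₁ ↾ σ₂ ↾ σ₃)
        (λ h i j y → edge (H ↾ σ₁ ↾ σ₂ ↾ σ₃) h i j (α h i) y ((γ ⇂ σ₁ ⇂ σ₂ ⇂ σ₃) h j))
        (λ h<i i<j → inL-dense q (H ↾ σ₁ ↾ σ₂ ↾ σ₃) (γ ⇂ σ₁ ⇂ σ₂ ⇂ σ₃) (T∧ˡ (αP h<i i<j)))
    = σ₁ ∘↪ σ₂ ∘↪ σ₃ ∘↪ σ₄ ,
     (α ⇂ σ₄) , β , (γ ⇂ σ₁ ⇂ σ₂ ⇂ σ₃ ⇂ σ₄) , (ω ⇂ σ₂ ⇂ σ₃ ⇂ σ₄) , (βω ⇂ σ₃ ⇂ σ₄) , (γ′ ⇂ σ₁ ⇂ σ₂ ⇂ σ₃ ⇂ σ₄) ,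
     λ a b c a<b b<c → βE a<b b<c ,
       T∧ʳ (αP (mono σ₄ a<b) (mono σ₄ b<c)) ,
       βωE (mono σ₃ (mono σ₄ a<b)) (mono σ₃ (mono σ₄ b<c))

abstract

  case2 : ∀ q m → ∃ (Case2From q m)
  case2 = case2-proof

DenseLinks : ∀ {N} → ℕ → (H : PHG N) → Choice H → Set
DenseLinks q H γ = ∀ {i j k} → i Fin.< j → j Fin.< k → Dense₂ q (λ x y → edge H i j k x y (γ i k))

BaseEdges : ℕ → ℕ → ℕ → Set
BaseEdges q m N = (H : PHG N) (γ : Choice H) → DenseLinks q H γ →
  Σ (m ↪ N) λ σ → Σ (Choice (H ↾ σ)) λ α → Σ (Choice (H ↾ σ)) λ β →
    ∀ {i j k} → i Fin.< j → j Fin.< k → T (edge (H ↾ σ) i j k (α i j) (β j k) ((γ ⇂ σ) i k))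

base-edges-proof : ∀ q m → ∃ (BaseEdges q m)
base-edges-proof q m = proj₁ s₁ , go
  where
  s₂ = choice-before (2 * q) m
  s₁ = choice-after (2 * q) (proj₁ s₂)
  go : BaseEdges q m (proj₁ s₁)
  go H γ dense
    with σ₁ , α , αD ← proj₂ s₁ H (λ i j k x → card H j k ≤ᵇ 2 * q * count (λ y → edge H i j k x y (γ i k)))
        (λ i<j j<k → dense-rows q (dense i<j j<k))
    with σ₂ , β , βE ← proj₂ s₂ (H ↾ σ₁) (λ h i j y → edge (H ↾ σ₁) h i j (α h i) y ((γ ⇂ σ₁) h j))
        (λ {h} {i} {j} h<i i<j → ≤ᵇ⇒≤ (card (H ↾ σ₁) i j) _ (αD h<i i<j))
    = σ₁ ∘↪ σ₂ , (α ⇂ σ₂) , β , βE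

abstract

  base-edges : ∀ q m → ∃ (BaseEdges q m)
  base-edges = base-edges-proof

-- Absorption and outcome (3)

left↪ : ∀ m n → m ↪ m + n
left↪ m n = record { to = Fin._↑ˡ n ; mono = λ {a} {b} lt → subst₂ _<_ (sym (Fin.toℕ-↑ˡ a n)) (sym (Fin.toℕ-↑ˡ b n)) lt }

right↪ : ∀ m n → n ↪ m + n
right↪ m n = record { to = m Fin.↑ʳ_ ; mono = λ {a} {b} lt → subst₂ _<_ (sym (Fin.toℕ-↑ʳ m a)) (sym (Fin.toℕ-↑ʳ m b)) (+-monoʳ-< m lt) }

left<right : ∀ m n (i : Fin m) (j : Fin n) → to (left↪ m n) i Fin.< to (right↪ m n) j
left<right m n i j = subst₂ _<_ (sym (Fin.toℕ-↑ˡ i n)) (sym (Fin.toℕ-↑ʳ m j)) (≤-trans (Fin.toℕ<n i) (m≤m+n m _))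

sorted₃ : ∀ {n} {a b c : Fin n} → a Fin.< b → b Fin.< c → Sorted (a ∷ b ∷ c ∷ [])
sorted₃ ab bc = (ab ∷ <-trans ab bc ∷ []) ∷ (bc ∷ []) ∷ [] ∷ []

sorted₄ : ∀ {n} {a b c d : Fin n} → a Fin.< b → b Fin.< c → c Fin.< d → Sorted (a ∷ b ∷ c ∷ d ∷ [])
sorted₄ ab bc cd = (ab ∷ <-trans ab bc ∷ <-trans ab (<-trans bc cd) ∷ []) ∷ sorted₃ bc cd

sorted₅ : ∀ {n} {a b c d e : Fin n} → a Fin.< b → b Fin.< c → c Fin.< d → d Fin.< e → Sorted (a ∷ b ∷ c ∷ d ∷ e ∷ [])
sorted₅ ab bc cd de =
  (ab ∷ <-trans ab bc ∷ <-trans ab (<-trans bc cd) ∷ <-trans ab (<-trans bc (<-trans cd de)) ∷ []) ∷ sorted₄ bc cd de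

count-split : ∀ {n} (p r : Fin n → Bool) → count p ≡ count (λ v → p v ∧ r v) + count (λ v → p v ∧ not (r v))
count-split p r = trans (count-∑ p) (trans (∑-cong (allFin _) (λ v → split (p v) (r v)))
  (trans (∑-+ (allFin _) (λ v → ⟦ p v ∧ r v ⟧) (λ v → ⟦ p v ∧ not (r v) ⟧))
    (sym (cong₂ _+_ (count-∑ _) (count-∑ _)))))
  where
  split : ∀ a b → ⟦ a ⟧ ≡ ⟦ a ∧ b ⟧ + ⟦ a ∧ not b ⟧
  split true  true  = refl
  split true  false = refl
  split false _     = refl

-- A 1/q proportion of the `y` lies in `U`, and each of these has a 1/q proportion of the `x`. This
-- gives a 1/q² proportion of all pairs, and Markov's inequality costs the factor 2.
dense-neighbours : ∀ q {n m} (U : Fin (suc m) → Bool) (B : Fin n → Fin (suc m) → Bool) →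
  Dense q U → (∀ y → T (U y) → Dense q (λ x → B x y)) →
  Dense (2 * (q * q)) (λ x → suc m ≤ᵇ 2 * (q * q) * count (λ y → U y ∧ B x y))
dense-neighbours q {n} {m} U B dU dB = dense-rows (q * q) (begin
  n * suc m  ≤⟨ *-monoʳ-≤ n dU ⟩
  n * (q * count U)  ≡⟨ ring₁ n q (count U) ⟩
  q * (count U * n)  ≡⟨ cong (q *_) (trans (∑-*ʳ (allFin (suc m)) n (λ y → ⟦ U y ⟧)) (cong (_* n) (sym (count-∑ U)))) ⟨
  q * ∑ (allFin (suc m)) (λ y → ⟦ U y ⟧ * n)  ≤⟨ *-monoʳ-≤ q (∑-mono (allFin (suc m)) each) ⟩
  q * ∑ (allFin (suc m)) (λ y → q * count (λ x → U y ∧ B x y)) ≡⟨ cong (q *_) (∑-*ˡ (allFin (suc m)) q (λ y → count (λ x → U y ∧ B x y))) ⟩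
  q * (q * ∑ (allFin (suc m)) (λ y → count (λ x → U y ∧ B x y))) ≡⟨ trans (cong (q * q *_) (count₂-∑ _)) (*-assoc q q _) ⟨
  q * q * count₂ (λ y x → U y ∧ B x y)  ≡⟨ cong (q * q *_) (count₂-swap (λ y x → U y ∧ B x y)) ⟩
  q * q * count₂ (λ x y → U y ∧ B x y)  ∎)
  where
  open ≤-Reasoning
  ring₁ : ∀ a b c → a * (b * c) ≡ b * (c * a)
  ring₁ = solve-∀
  each : ∀ y → ⟦ U y ⟧ * n ≤ q * count (λ x → U y ∧ B x y)
  each y with U y in eq
  ... | true  = subst (_≤ q * count (λ x → B x y)) (sym (*-identityˡ n)) (dB y (subst T (sym eq) _))
  ... | false = z≤n

0<ᵇ-witness : ∀ {n} (p : Fin n → Bool) → T (0 <ᵇ count p) → ∃ λ v → T (p v)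
0<ᵇ-witness p t = count-witness p (<ᵇ⇒< 0 _ t)

0<ᵇ-intro : ∀ {n} (p : Fin n → Bool) v → T (p v) → T (0 <ᵇ count p)
0<ᵇ-intro {n} p v t = <⇒<ᵇ (subst (0 <_) (sym (count-∑ p)) (≤-trans (one (p v) t) (∑-∈ (λ v → ⟦ p v ⟧) (∈-allFin v))))
  where
  one : ∀ b → T b → 1 ≤ ⟦ b ⟧
  one true _ = ≤-refl

exhausted : ∀ q n {c} → 2 * (q * q) * c ≤ 0 → ¬ (suc n ≤ q * c)
exhausted zero    n     _  ()
exhausted (suc q) n {c} le d with () ← ≤-trans d (≤-trans (*-monoˡ-≤ c (≤-trans (m≤m*n (suc q) (suc q)) (m≤m+n _ _))) le)

-- `f` is a potential, the size of `U` in units of a 1/K proportion of the part. Deleting one such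
-- unit lowers it by one.
shrink : ∀ {n} K f (U B : Fin n → Bool) → K * count U ≤ suc f * n → n ≤ K * count (λ y → U y ∧ B y) →
  K * count (λ y → U y ∧ not (B y)) ≤ f * n
shrink {n} K f U B le many = +-cancelˡ-≤ n _ _ (begin
  n + K * count (λ y → U y ∧ not (B y))  ≤⟨ +-monoˡ-≤ _ many ⟩
  K * count (λ y → U y ∧ B y) + K * count (λ y → U y ∧ not (B y))  ≡⟨ *-distribˡ-+ K _ _ ⟨
  K * (count (λ y → U y ∧ B y) + count (λ y → U y ∧ not (B y)))  ≡⟨ cong (K *_) (count-split U B) ⟨
  K * count U  ≤⟨ le ⟩
  n + f * n  ∎)
  where open ≤-Reasoning

avoid : ∀ {u b w} → ¬ T (b ∧ w) → T (u ∧ w) → T ((u ∧ not b) ∧ w)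
avoid {true} {true}  ¬bw t = contradiction t ¬bw
avoid {true} {false} ¬bw t = t

Incr₅ : ∀ {N} (a b c d e : Fin N) → Set
Incr₅ a b c d e = a Fin.< b × b Fin.< c × c Fin.< d × d Fin.< e

module _ {N} (H : PHG N) where

  Relˡ Relʳ Goalˡ Goalʳ : Set
  Relˡ  = ∀ a b c → V H a b → V H b c → Bool
  Relʳ  = ∀ c d e → V H d e → V H c d → Bool
  Goalˡ = (b c d e : Fin N) → V H b c → Bool
  Goalʳ = (a b c d : Fin N) → V H c d → Bool

  -- In order: each vertex of `U` has many `B`-partners; the vertices of `U` that meet the goal `W`
  -- are dense, which must survive the shrinking of `U`; and `f` bounds `U` in units of 1/(2q²), the
  -- proportion that `dense-neighbours` provides.
  Absorbableˡ : ℕ → ℕ → Before H → Relˡ → Goalˡ → Set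
  Absorbableˡ q f U B W =
    (∀ {a b c} → a Fin.< b → b Fin.< c → ∀ y → T (U a b c y) → Dense q (λ w → B a b c w y)) ×
    (∀ {a b c d e} → Incr₅ a b c d e → Dense q (λ y → U a b c y ∧ W b c d e y)) ×
    (∀ {a b c} → a Fin.< b → b Fin.< c → 2 * (q * q) * count (U a b c) ≤ f * card H b c)

  Absorbableʳ : ℕ → ℕ → After H → Relʳ → Goalʳ → Set
  Absorbableʳ q f U B W =
    (∀ {c d e} → c Fin.< d → d Fin.< e → ∀ y → T (U c d e y) → Dense q (λ z → B c d e z y)) ×
    (∀ {a b c d e} → Incr₅ a b c d e → Dense q (λ y → U c d e y ∧ W a b c d y)) ×
    (∀ {c d e} → c Fin.< d → d Fin.< e → 2 * (q * q) * count (U c d e) ≤ f * card H c d)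

Absorbedˡ : ∀ {N} m (H : PHG N) → Relˡ H → Goalˡ H → Set
Absorbedˡ {N} m H B W = Σ (m ↪ N) λ σ → Σ (Choice (H ↾ σ)) λ w → ∀ {a b c d e} → Incr₅ a b c d e →
  ∃ λ y → T (B (to σ a) (to σ b) (to σ c) (w a b) y ∧ W (to σ b) (to σ c) (to σ d) (to σ e) y)

Absorbedʳ : ∀ {N} m (H : PHG N) → Relʳ H → Goalʳ H → Set
Absorbedʳ {N} m H B W = Σ (m ↪ N) λ σ → Σ (Choice (H ↾ σ)) λ z → ∀ {a b c d e} → Incr₅ a b c d e →
  ∃ λ y → T (B (to σ c) (to σ d) (to σ e) (z d e) y ∧ W (to σ a) (to σ b) (to σ c) (to σ d) y)

-- If no suitable choice of w exists, then by Ramsey's theorem some choice of vertices with many B-neighbours in U has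
-- none of them in W. These neighbours are removed from U, which can happen at most f times.
Absorbsˡ : ℕ → ℕ → ℕ → ℕ → Set
Absorbsˡ q f m N = (H : PHG N) (U : Before H) (B : Relˡ H) (W : Goalˡ H) →
  Absorbableˡ H q f U B W → Absorbedˡ m H B W

absorbˡ-proof : ∀ q f m → ∃ (Absorbsˡ q f m)
-- With no potential left `U` is empty, against its density on any five indices. Hence an arbitrary
-- `w` will do.
absorbˡ-proof q zero m = m , λ H U B W (dB , dW , fU) → id↪ , (λ _ _ → zero) , λ {a} {b} {c} {d} {e} inc@(ab , bc , _) →
  ⊥-elim (exhausted q (psize H b c) {count (U a b c)} (fU ab bc) (dense-mono {q} (λ y t → T∧ˡ t) (dW inc)))
absorbˡ-proof q (suc f) m = N , go
  where
  K = 2 * (q * q)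
  rec = absorbˡ-proof q f m
  -- Room for both outcomes: the first `m` indices serve a success, the others the recursive call.
  s₁ = ramsey-bool 5 (m + proj₁ rec)
  s₀ = choice-after K (proj₁ s₁)
  -- The two extra indices at the end play `d` and `e`: the density of `U` is known only through
  -- that of `U ∧ W`, which involves five indices.
  N = proj₁ s₀ + 2
  τ : proj₁ s₀ ↪ N
  τ = left↪ (proj₁ s₀) 2
  ManyNeighbours : (H : PHG N) (U : Before H) (B : Relˡ H) (σ : proj₁ s₁ ↪ N) (w : Choice (H ↾ σ)) → Set
  ManyNeighbours H U B σ w = ∀ {a b c} → a Fin.< b → b Fin.< c → let s = to σ in
    T (card H (s b) (s c) ≤ᵇ K * count (λ y → U (s a) (s b) (s c) y ∧ B (s a) (s b) (s c) (w a b) y))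
  χ : (H : PHG N) (B : Relˡ H) (W : Goalˡ H) (σ : proj₁ s₁ ↪ N) → Choice (H ↾ σ) → List (Fin (proj₁ s₁)) → Bool
  χ H B W σ w (a ∷ b ∷ c ∷ d ∷ e ∷ []) =
    0 <ᵇ count (λ y → B (s a) (s b) (s c) (w a b) y ∧ W (s b) (s c) (s d) (s e) y)
    where s = to σ
  χ H B W σ w _ = false
  decide : (H : PHG N) (U : Before H) (B : Relˡ H) (W : Goalˡ H) → Absorbableˡ H q (suc f) U B W →
    (σ : proj₁ s₁ ↪ N) (w : Choice (H ↾ σ)) → ManyNeighbours H U B σ w →
    (Σ (m + proj₁ rec ↪ proj₁ s₁) λ σ₂ →
      Always 5 (χ H B W σ w) σ₂ ⊎ Never 5 (χ H B W σ w) σ₂) →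
    Absorbedˡ m H B W
  decide H U B W _ σ w _ (σ₂ , inj₁ h) = σ ∘↪ ρ , (w ⇂ ρ) ,
    λ {a} {b} {c} {d} {e} (ab , bc , cd , de) → 0<ᵇ-witness _ (h (map (to l) (a ∷ b ∷ c ∷ d ∷ e ∷ []))
      (sorted₅ (mono l {a} {b} ab) (mono l {b} {c} bc) (mono l {c} {d} cd) (mono l {d} {e} de)) refl)
    where
    l = left↪ m (proj₁ rec)
    ρ = σ₂ ∘↪ l
  -- On these indices no `B`-partner of `w` meets `W`, so deleting the partners from `U` leaves
  -- `U ∧ W` as dense as before.
  decide H U B W (dB , dW , fU) σ w wD (σ₂ , inj₂ h) = extend (proj₂ rec (H ↾ ss)
      (λ a b c y → U (s a) (s b) (s c) y ∧ not (B (s a) (s b) (s c) ((w ⇂ ρ) a b) y))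
      (λ a b c → B (s a) (s b) (s c)) (λ b c d e → W (s b) (s c) (s d) (s e))
      ((λ {a} {b} {c} ab bc y t → dB (mono ss {a} {b} ab) (mono ss {b} {c} bc) y (T∧ˡ t)) ,
       (λ {a} {b} {c} {d} {e} (ab , bc , cd , de) → dense-mono {q}
         (λ y → avoid {U (s a) (s b) (s c) y} (λ bw → h (map (to r) (a ∷ b ∷ c ∷ d ∷ e ∷ []))
           (sorted₅ (mono r {a} {b} ab) (mono r {b} {c} bc) (mono r {c} {d} cd) (mono r {d} {e} de)) refl (0<ᵇ-intro _ y bw)))
         (dW (mono ss {a} {b} ab , mono ss {b} {c} bc , mono ss {c} {d} cd , mono ss {d} {e} de))) ,
       (λ {a} {b} {c} ab bc → shrink K f (U (s a) (s b) (s c)) (B (s a) (s b) (s c) ((w ⇂ ρ) a b))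
         (fU (mono ss {a} {b} ab) (mono ss {b} {c} bc))
         (≤ᵇ⇒≤ (card H (s b) (s c)) _ (wD (mono ρ {a} {b} ab) (mono ρ {b} {c} bc))))))
    where
    r = right↪ m (proj₁ rec)
    ρ = σ₂ ∘↪ r
    ss = σ ∘↪ ρ
    s = to ss
    extend : Absorbedˡ m (H ↾ ss) (λ a b c → B (s a) (s b) (s c)) (λ b c d e → W (s b) (s c) (s d) (s e)) → Absorbedˡ m H B W
    extend (σ₃ , w′ , p) = ss ∘↪ σ₃ , w′ , p
  go : Absorbsˡ q (suc f) m N
  go H U B W A@(dB , dW , _)
    with σ₁ , w , wD ← proj₂ s₀ (H ↾ τ)
      (λ a b c x → card (H ↾ τ) b c ≤ᵇ K * count (λ y → U (to τ a) (to τ b) (to τ c) y ∧ B (to τ a) (to τ b) (to τ c) x y))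
      (λ {a} {b} {c} ab bc → dense-neighbours q (U (to τ a) (to τ b) (to τ c)) (B (to τ a) (to τ b) (to τ c))
        (dense-mono {q} (λ y t → T∧ˡ t) (dW (mono τ {a} {b} ab , mono τ {b} {c} bc , left<right (proj₁ s₀) 2 c zero ,
          mono (right↪ (proj₁ s₀) 2) {zero} {suc zero} (s≤s z≤n))))
        (dB (mono τ {a} {b} ab) (mono τ {b} {c} bc)))
    = decide H U B W A (τ ∘↪ σ₁) w wD (proj₂ s₁ (χ H B W (τ ∘↪ σ₁) w))

abstract

  absorbˡ : ∀ q f m → ∃ (Absorbsˡ q f m)
  absorbˡ = absorbˡ-proof

-- The mirror image of `Absorbsˡ`: the chosen vertex is to the right of `y`, and the two extra
-- indices stand in front.
Absorbsʳ : ℕ → ℕ → ℕ → ℕ → Set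
Absorbsʳ q f m N = (H : PHG N) (U : After H) (B : Relʳ H) (W : Goalʳ H) →
  Absorbableʳ H q f U B W → Absorbedʳ m H B W

absorbʳ-proof : ∀ q f m → ∃ (Absorbsʳ q f m)
absorbʳ-proof q zero m = m , λ H U B W (dB , dW , fU) → id↪ , (λ _ _ → zero) , λ {a} {b} {c} {d} {e} inc@(_ , _ , cd , de) →
  ⊥-elim (exhausted q (psize H c d) {count (U c d e)} (fU cd de) (dense-mono {q} (λ y t → T∧ˡ t) (dW inc)))
absorbʳ-proof q (suc f) m = N , go
  where
  K = 2 * (q * q)
  rec = absorbʳ-proof q f m
  s₁ = ramsey-bool 5 (m + proj₁ rec)
  s₀ = choice-before K (proj₁ s₁)
  N = 2 + proj₁ s₀
  τ : proj₁ s₀ ↪ N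
  τ = right↪ 2 (proj₁ s₀)
  ManyNeighbours : (H : PHG N) (U : After H) (B : Relʳ H) (σ : proj₁ s₁ ↪ N) (w : Choice (H ↾ σ)) → Set
  ManyNeighbours H U B σ w = ∀ {c d e} → c Fin.< d → d Fin.< e → let s = to σ in
    T (card H (s c) (s d) ≤ᵇ K * count (λ y → U (s c) (s d) (s e) y ∧ B (s c) (s d) (s e) (w d e) y))
  χ : (H : PHG N) (B : Relʳ H) (W : Goalʳ H) (σ : proj₁ s₁ ↪ N) → Choice (H ↾ σ) → List (Fin (proj₁ s₁)) → Bool
  χ H B W σ w (a ∷ b ∷ c ∷ d ∷ e ∷ []) =
    0 <ᵇ count (λ y → B (s c) (s d) (s e) (w d e) y ∧ W (s a) (s b) (s c) (s d) y)
    where s = to σ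
  χ H B W σ w _ = false
  decide : (H : PHG N) (U : After H) (B : Relʳ H) (W : Goalʳ H) → Absorbableʳ H q (suc f) U B W →
    (σ : proj₁ s₁ ↪ N) (w : Choice (H ↾ σ)) → ManyNeighbours H U B σ w →
    (Σ (m + proj₁ rec ↪ proj₁ s₁) λ σ₂ →
      Always 5 (χ H B W σ w) σ₂ ⊎ Never 5 (χ H B W σ w) σ₂) →
    Absorbedʳ m H B W
  decide H U B W _ σ w _ (σ₂ , inj₁ h) = σ ∘↪ ρ , (w ⇂ ρ) ,
    λ {a} {b} {c} {d} {e} (ab , bc , cd , de) → 0<ᵇ-witness _ (h (map (to l) (a ∷ b ∷ c ∷ d ∷ e ∷ []))
      (sorted₅ (mono l {a} {b} ab) (mono l {b} {c} bc) (mono l {c} {d} cd) (mono l {d} {e} de)) refl)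
    where
    l = left↪ m (proj₁ rec)
    ρ = σ₂ ∘↪ l
  decide H U B W (dB , dW , fU) σ w wD (σ₂ , inj₂ h) = extend (proj₂ rec (H ↾ ss)
      (λ c d e y → U (s c) (s d) (s e) y ∧ not (B (s c) (s d) (s e) ((w ⇂ ρ) d e) y))
      (λ c d e → B (s c) (s d) (s e)) (λ a b c d → W (s a) (s b) (s c) (s d))
      ((λ {c} {d} {e} cd de y t → dB (mono ss {c} {d} cd) (mono ss {d} {e} de) y (T∧ˡ t)) ,
       (λ {a} {b} {c} {d} {e} (ab , bc , cd , de) → dense-mono {q}
         (λ y → avoid {U (s c) (s d) (s e) y} (λ bw → h (map (to r) (a ∷ b ∷ c ∷ d ∷ e ∷ []))
           (sorted₅ (mono r {a} {b} ab) (mono r {b} {c} bc) (mono r {c} {d} cd) (mono r {d} {e} de)) refl (0<ᵇ-intro _ y bw)))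
         (dW (mono ss {a} {b} ab , mono ss {b} {c} bc , mono ss {c} {d} cd , mono ss {d} {e} de))) ,
       (λ {c} {d} {e} cd de → shrink K f (U (s c) (s d) (s e)) (B (s c) (s d) (s e) ((w ⇂ ρ) d e))
         (fU (mono ss {c} {d} cd) (mono ss {d} {e} de))
         (≤ᵇ⇒≤ (card H (s c) (s d)) _ (wD (mono ρ {c} {d} cd) (mono ρ {d} {e} de))))))
    where
    r = right↪ m (proj₁ rec)
    ρ = σ₂ ∘↪ r
    ss = σ ∘↪ ρ
    s = to ss
    extend : Absorbedʳ m (H ↾ ss) (λ c d e → B (s c) (s d) (s e)) (λ a b c d → W (s a) (s b) (s c) (s d)) → Absorbedʳ m H B W
    extend (σ₃ , w′ , p) = ss ∘↪ σ₃ , w′ , p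
  go : Absorbsʳ q (suc f) m N
  go H U B W A@(dB , dW , _)
    with σ₁ , w , wD ← proj₂ s₀ (H ↾ τ)
      (λ c d e x → card (H ↾ τ) c d ≤ᵇ K * count (λ y → U (to τ c) (to τ d) (to τ e) y ∧ B (to τ c) (to τ d) (to τ e) x y))
      (λ {c} {d} {e} cd de → dense-neighbours q (U (to τ c) (to τ d) (to τ e)) (B (to τ c) (to τ d) (to τ e))
        (dense-mono {q} (λ y t → T∧ˡ t) (dW (mono (left↪ 2 (proj₁ s₀)) {zero} {suc zero} (s≤s z≤n) ,
          left<right 2 (proj₁ s₀) (suc zero) c , mono τ {c} {d} cd , mono τ {d} {e} de)))
        (dB (mono τ {c} {d} cd) (mono τ {d} {e} de)))
    = decide H U B W A (τ ∘↪ σ₁) w wD (proj₂ s₁ (χ H B W (τ ∘↪ σ₁) w))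

abstract

  absorbʳ : ∀ q f m → ∃ (Absorbsʳ q f m)
  absorbʳ = absorbʳ-proof

dense-double : ∀ q {n} {p : Fin n → Bool} → Dense q p → Dense (2 * q) p
dense-double q d = ≤-trans d (*-monoˡ-≤ _ (m≤m+n q _))

Case3From : ℕ → ℕ → ℕ → Set
Case3From q m N = (H : PHG N) (γ γ′ : Choice H) → DenseLinks q H γ →
  (∀ {a b c d e} → Incr₅ a b c d e →
    Dense₂ q (λ x y → inR q H γ a b c x ∧ inL q H γ c d e y ∧ edge H b c d x y (γ′ b d))) →
  Σ (m ↪ N) λ σ → Case3 (whole (H ↾ σ))

-- The pairs (x, y) in R × L are to become (β•, α•). The first absorption fixes the vertex `w`, to
-- become α′, so that on any five indices some `x` next to it has many partners `y`. The second
-- fixes `z`, to become β′, so that some such `y` is next to `z`. The remaining edges α, β, γ⁰ come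
-- from the links of `γ`.
case3-proof : ∀ q m → ∃ (Case3From q m)
case3-proof q m = proj₁ s₁ , go
  where
  -- Also the starting potential: the whole part is `K` units of a 1/K proportion.
  K = 2 * (2 * q * (2 * q))
  s₃ = base-edges q m
  s₂ = absorbʳ (2 * q) K (proj₁ s₃)
  s₁ = absorbˡ (2 * q) K (proj₁ s₂)
  go : Case3From q m (proj₁ s₁)
  go H γ γ′ links dense
    with σ₁ , w , wP ← proj₂ s₁ H (inR q H γ) (λ a b c w x → edge H a b c w x (γ a c))
        -- This goal keeps a dense set of partners `y`, as the second absorption requires.
        (λ b c d e x → card H c d ≤ᵇ 2 * q * count (λ y → inL q H γ c d e y ∧ edge H b c d x y (γ′ b d)))
        ((λ ab bc y t → dense-double q (inR-dense q H γ t)) , (λ inc → row-split q (dense inc)) ,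
         (λ {a} {b} {c} ab bc → *-monoʳ-≤ K (count≤ (inR q H γ a b c))))
    with σ₂ , z , zP ← proj₂ s₂ (H ↾ σ₁) (inL q (H ↾ σ₁) (γ ⇂ σ₁)) (λ c d e z y → edge (H ↾ σ₁) c d e y z ((γ ⇂ σ₁) c e))
        -- The second goal asks for an `x` joined both to `w` and to `y`; `bridge` recovers it.
        (λ a b c d y → 0 <ᵇ count (λ x → edge (H ↾ σ₁) a b c (w a b) x ((γ ⇂ σ₁) a c) ∧ edge (H ↾ σ₁) b c d x y ((γ′ ⇂ σ₁) b d)))
        ((λ cd de y t → dense-double q (inL-dense q (H ↾ σ₁) (γ ⇂ σ₁) t)) ,
         (λ {a} {b} {c} {d} {e} inc → let x , t = wP inc in dense-mono {2 * q}
           (λ y t′ → T∧ (T∧ˡ t′) (0<ᵇ-intro _ x (T∧ (T∧ˡ {edge (H ↾ σ₁) a b c (w a b) x ((γ ⇂ σ₁) a c)} t) (T∧ʳ {inL q (H ↾ σ₁) (γ ⇂ σ₁) c d e y} t′))))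
           (≤ᵇ⇒≤ (card (H ↾ σ₁) c d) _ (T∧ʳ {edge (H ↾ σ₁) a b c (w a b) x ((γ ⇂ σ₁) a c)} t))) ,
         (λ {c} {d} {e} cd de → *-monoʳ-≤ K (count≤ (inL q (H ↾ σ₁) (γ ⇂ σ₁) c d e))))
    with σ₃ , α , β , αβ ← proj₂ s₃ (H ↾ σ₁ ↾ σ₂) (γ ⇂ σ₁ ⇂ σ₂) (λ i<j j<k → links (mono σ₁ (mono σ₂ i<j)) (mono σ₁ (mono σ₂ j<k)))
    = σ , α , β , (w ⇂ σ₂ ⇂ σ₃) , (z ⇂ σ₃) , (γ ⇂ σ₁ ⇂ σ₂ ⇂ σ₃) , (γ′ ⇂ σ₁ ⇂ σ₂ ⇂ σ₃) ,
      (λ i j k s t → proj₁ (bridge i j k s t)) , (λ i j k s t → proj₁ (proj₂ (bridge i j k s t))) ,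
      λ i j k s t ij jk ks st → let e₁ , e₂ , e₃ = proj₂ (proj₂ (bridge i j k s t)) (ij , jk , ks , st)
        in αβ ij jk , e₁ , e₂ , e₃
    where
    σ = σ₁ ∘↪ σ₂ ∘↪ σ₃
    G = H ↾ σ
    Bridge : ∀ i j k s t → V G j k → V G k s → Set
    Bridge i j k s t x y = T (edge G i j k ((w ⇂ σ₂ ⇂ σ₃) i j) x ((γ ⇂ σ) i k)) ×
      T (edge G j k s x y ((γ′ ⇂ σ) j s)) × T (edge G k s t y ((z ⇂ σ₃) s t) ((γ ⇂ σ) k t))
    -- The outcome asks for functions on all five-tuples, so those that are not increasing get junk
    -- vertices.
    bridge : ∀ i j k s t → Σ (V G j k) λ x → Σ (V G k s) λ y → Incr₅ i j k s t → Bridge i j k s t x y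
    bridge i j k s t with (i Fin.<? j) ×-dec (j Fin.<? k) ×-dec (k Fin.<? s) ×-dec (s Fin.<? t)
    ... | no ¬inc = zero , zero , λ inc → contradiction inc ¬inc
    ... | yes (ij , jk , ks , st)
      with y , t₁ ← zP (mono σ₃ ij , mono σ₃ jk , mono σ₃ ks , mono σ₃ st)
      with x , t₂ ← 0<ᵇ-witness _ (T∧ʳ {edge G k s t y ((z ⇂ σ₃) s t) ((γ ⇂ σ) k t)} t₁)
      = x , y , λ _ → T∧ˡ {edge G i j k ((w ⇂ σ₂ ⇂ σ₃) i j) x ((γ ⇂ σ) i k)} t₂ ,
                      T∧ʳ {edge G i j k ((w ⇂ σ₂ ⇂ σ₃) i j) x ((γ ⇂ σ) i k)} t₂ , T∧ˡ t₁

abstract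

  case3 : ∀ q m → ∃ (Case3From q m)
  case3 = case3-proof

-- Outcome (4)

Positions : ℕ → Set
Positions n = Σ (Fin (4 * n)) λ p₁ → Σ (Fin (4 * n)) λ p₂ → Σ (Fin (4 * n)) λ p₃ →
  Σ (Fin (4 * n)) λ p₄ → Σ (Fin (4 * n)) λ p₅ → Incr₅ p₁ p₂ p₃ p₄ p₅ ×
  suc (Fin.toℕ p₁) ≡ n × suc (Fin.toℕ p₂) ≡ 2 * n × Fin.toℕ p₃ ≡ 2 * n ×
  Fin.toℕ p₄ ≡ suc (2 * n) × Fin.toℕ p₅ ≡ 3 * n

-- `p₄` precedes `p₅` because 2n + 1 < 3n for n ≥ 2.
positions : ∀ n → 2 ≤ n → Positions n
positions (suc zero) (s≤s ())
positions n@(suc (suc n′)) 2≤n =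
  let p₁ , e₁ = at {suc n′} (m≤m+n n _)
      p₂ , e₂ = at {suc n′ + 1 * n} (subst (2 * n ≤_) (sym (4n≡ n)) (m≤m+n (2 * n) _))
      p₃ , e₃ = at {2 * n} (subst (2 * n <_) (sym (4n≡ n)) (m<m+n (2 * n) {2 * n} z<s))
      p₄ , e₄ = at {suc (2 * n)} (subst (suc (2 * n) <_) (sym (4n≡ n)) (2+≤ (≤-trans 2≤n (m≤m+n n _))))
      p₅ , e₅ = at {3 * n} (subst (3 * n <_) (sym (4n≡3n+n n)) (m<m+n (3 * n) {n} z<s))
  in p₁ , p₂ , p₃ , p₄ , p₅ ,
     ( subst₂ _<_ (sym e₁) (sym e₂) (m<m+n (suc n′) {1 * n} z<s)
     , subst₂ _<_ (sym e₂) (sym e₃) ≤-refl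
     , subst₂ _<_ (sym e₃) (sym e₄) ≤-refl
     , subst₂ _<_ (sym e₄) (sym e₅) (subst (suc (2 * n) <_) (sym (3n≡ n)) (2+≤ 2≤n)) ) ,
     cong suc e₁ , cong suc e₂ , e₃ , e₄ , e₅
  where
  at : ∀ {k} → k < 4 * n → Σ (Fin (4 * n)) λ p → Fin.toℕ p ≡ k
  at k<4n = Fin.fromℕ< k<4n , Fin.toℕ-fromℕ< k<4n
  2+≤ : ∀ {k} → 2 ≤ k → suc (suc (2 * n)) ≤ 2 * n + k
  2+≤ {k} le = subst (_≤ 2 * n + k) (+-comm (2 * n) 2) (+-monoʳ-≤ (2 * n) le)
  4n≡ : ∀ n → 4 * n ≡ 2 * n + 2 * n
  4n≡ = solve-∀
  3n≡ : ∀ n → 3 * n ≡ 2 * n + n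
  3n≡ = solve-∀
  4n≡3n+n : ∀ n → 4 * n ≡ 3 * n + n
  4n≡3n+n = solve-∀

Case4From : ℕ → ℕ → ℕ → Set
Case4From q n N = (H : PHG N) (γ γ¹ γ² γ′ : Choice H) →
  DenseLinks q H γ¹ → DenseLinks q H γ² →
  (∀ {i j k} → i Fin.< j → j Fin.< k → T (inL q H γ i j k (γ¹ i j))) →
  (∀ {h i j} → h Fin.< i → i Fin.< j → T (inR q H γ h i j (γ² i j))) →
  (∀ {i j k} → i Fin.< j → j Fin.< k →
    Dense₂ q (λ x y → inL q H γ¹ i j k x ∧ inR q H γ² i j k y ∧ edge H i j k x y (γ′ i k))) →
  Σ (4 * n ↪ N) λ σ → Case4 (whole (H ↾ σ)) n

-- `β*` and `α*` exist because γ¹ is a left and γ² a right neighbour of γ. `α` and `β` come from the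
-- dense pairs in L₁ × R₂: first `α` in L₁ with many partners in R₂ through `γ′`, then `β` among the
-- partners.
case4-proof : ∀ q n → 2 ≤ n → ∃ (Case4From q n)
case4-proof q n 2≤n = proj₁ s₁ , go
  where
  s₆ = base-edges q (4 * n)
  s₅ = base-edges q (proj₁ s₆)
  s₄ = choice-before q (proj₁ s₅)
  s₃ = choice-after q (proj₁ s₄)
  s₂ = choice-before (2 * q) (proj₁ s₃)
  s₁ = choice-after (2 * q) (proj₁ s₂)
  go : Case4From q n (proj₁ s₁)
  go H γ γ¹ γ² γ′ links¹ links² γ¹L γ²R dense
    with σ₁ , α , αP ← proj₂ s₁ H
        (λ i j k x → inL q H γ¹ i j k x ∧ (card H j k ≤ᵇ 2 * q * count (λ y → inR q H γ² i j k y ∧ edge H i j k x y (γ′ i k))))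
        (λ i<j j<k → row-split q (dense i<j j<k))
    with σ₂ , β , βP ← proj₂ s₂ (H ↾ σ₁) (λ h i j y → inR q (H ↾ σ₁) (γ² ⇂ σ₁) h i j y ∧ edge (H ↾ σ₁) h i j (α h i) y ((γ′ ⇂ σ₁) h j))
        (λ {h} {i} {j} h<i i<j → ≤ᵇ⇒≤ (card (H ↾ σ₁) i j) _ (T∧ʳ {inL q H γ¹ (to σ₁ h) (to σ₁ i) (to σ₁ j) (α h i)} (αP h<i i<j)))
    with σ₃ , α* , α*E ← proj₂ s₃ (H ↾ σ₁ ↾ σ₂)
        (λ i j k x → edge (H ↾ σ₁ ↾ σ₂) i j k x ((γ² ⇂ σ₁ ⇂ σ₂) j k) ((γ ⇂ σ₁ ⇂ σ₂) i k))
        (λ i<j j<k → inR-dense q (H ↾ σ₁ ↾ σ₂) (γ ⇂ σ₁ ⇂ σ₂) (γ²R (mono σ₁ (mono σ₂ i<j)) (mono σ₁ (mono σ₂ j<k))))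
    with σ₄ , β* , β*E ← proj₂ s₄ (H ↾ σ₁ ↾ σ₂ ↾ σ₃)
        (λ h i j y → edge (H ↾ σ₁ ↾ σ₂ ↾ σ₃) h i j ((γ¹ ⇂ σ₁ ⇂ σ₂ ⇂ σ₃) h i) y ((γ ⇂ σ₁ ⇂ σ₂ ⇂ σ₃) h j))
        (λ h<i i<j → inL-dense q (H ↾ σ₁ ↾ σ₂ ↾ σ₃) (γ ⇂ σ₁ ⇂ σ₂ ⇂ σ₃)
          (γ¹L (mono σ₁ (mono σ₂ (mono σ₃ h<i))) (mono σ₁ (mono σ₂ (mono σ₃ i<j)))))
    with σ₅ , α¹ , β¹ , e¹ ← proj₂ s₅ (H ↾ σ₁ ↾ σ₂ ↾ σ₃ ↾ σ₄) (γ¹ ⇂ σ₁ ⇂ σ₂ ⇂ σ₃ ⇂ σ₄)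
        (λ i<j j<k → links¹ (mono σ₁ (mono σ₂ (mono σ₃ (mono σ₄ i<j)))) (mono σ₁ (mono σ₂ (mono σ₃ (mono σ₄ j<k)))))
    with σ₆ , α² , β² , e² ← proj₂ s₆ (H ↾ σ₁ ↾ σ₂ ↾ σ₃ ↾ σ₄ ↾ σ₅) (γ² ⇂ σ₁ ⇂ σ₂ ⇂ σ₃ ⇂ σ₄ ⇂ σ₅)
        (λ i<j j<k → links² (mono σ₁ (mono σ₂ (mono σ₃ (mono σ₄ (mono σ₅ i<j))))) (mono σ₁ (mono σ₂ (mono σ₃ (mono σ₄ (mono σ₅ j<k))))))
    = σ , (α* ⇂ σ₄ ⇂ σ₅ ⇂ σ₆) , (β* ⇂ σ₅ ⇂ σ₆) , (γ ⇂ σ) , (α¹ ⇂ σ₆) , (β¹ ⇂ σ₆) , (γ¹ ⇂ σ) , α² , β² , (γ² ⇂ σ) ,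
      (λ a b c a<b b<c → β*E (mono σ₅ (mono σ₆ a<b)) (mono σ₅ (mono σ₆ b<c)) ,
        α*E (mono σ₄ (mono σ₅ (mono σ₆ a<b))) (mono σ₄ (mono σ₅ (mono σ₆ b<c))) ,
        e¹ (mono σ₆ a<b) (mono σ₆ b<c) , e² a<b b<c) ,
      special (positions n 2≤n)
    where
    ρ = σ₂ ∘↪ σ₃ ∘↪ σ₄ ∘↪ σ₅ ∘↪ σ₆
    ρ′ = σ₃ ∘↪ σ₄ ∘↪ σ₅ ∘↪ σ₆
    σ = σ₁ ∘↪ ρ
    G = H ↾ σ
    -- `α` and `β` are good for all third indices, so the prescribed positions matter only through
    -- their order; the edge through both has top `γ′`.
    special : Positions n →
      Σ (Fin (4 * n)) λ p₁ → Σ (Fin (4 * n)) λ p₂ → Σ (Fin (4 * n)) λ p₃ → Σ (Fin (4 * n)) λ p₄ → Σ (Fin (4 * n)) λ p₅ →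
        suc (Fin.toℕ p₁) ≡ n × suc (Fin.toℕ p₂) ≡ 2 * n × Fin.toℕ p₃ ≡ 2 * n ×
        Fin.toℕ p₄ ≡ suc (2 * n) × Fin.toℕ p₅ ≡ 3 * n ×
        Σ (V G p₂ p₃) λ x → Σ (V G p₃ p₄) λ y →
          (∃ λ r → T (edge G p₂ p₃ p₅ x r ((γ¹ ⇂ σ) p₂ p₅))) ×
          (∃ λ l → T (edge G p₁ p₃ p₄ l y ((γ² ⇂ σ) p₁ p₄))) ×
          (∃ λ t → T (edge G p₂ p₃ p₄ x y t))
    special (p₁ , p₂ , p₃ , p₄ , p₅ , (p₁₂ , p₂₃ , p₃₄ , p₄₅) , e₁ , e₂ , e₃ , e₄ , e₅) =
      p₁ , p₂ , p₃ , p₄ , p₅ , e₁ , e₂ , e₃ , e₄ , e₅ , (α ⇂ ρ) p₂ p₃ , (β ⇂ ρ′) p₃ p₄ ,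
      dense-witness q (inL-dense q G (γ¹ ⇂ σ) {p₂} {p₃} {p₅} (T∧ˡ (αP (mono ρ p₂₃) (mono ρ (<-trans p₃₄ p₄₅))))) ,
      dense-witness q (inR-dense q G (γ² ⇂ σ) {p₁} {p₃} {p₄} (T∧ˡ (βP (mono ρ′ (<-trans p₁₂ p₂₃)) (mono ρ′ p₃₄)))) ,
      (γ′ ⇂ σ) p₂ p₄ , T∧ʳ {inR q G (γ² ⇂ σ) p₂ p₃ p₄ ((β ⇂ ρ′) p₃ p₄)} (βP (mono ρ′ p₂₃) (mono ρ′ p₃₄))

abstract

  case4 : ∀ q n → 2 ≤ n → ∃ (Case4From q n)
  case4 = case4-proof

abstract

  -- Two sizes, because an `Always` set goes to the construction of an outcome and a `Never` set to
  -- the rest of the argument.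
  ramsey-or : ∀ k M m → ∃ λ N → (χ : List (Fin N) → Bool) →
    (Σ (M ↪ N) (Always k χ)) ⊎ (Σ (m ↪ N) (Never k χ))
  ramsey-or k M m = proj₁ r , λ χ → split χ (proj₂ r χ)
    where
    r : ∃ λ N → (χ : List (Fin N) → Bool) → Σ (M + m ↪ N) λ σ →
      Always k χ σ ⊎ Never k χ σ
    r = ramsey-bool k (M + m)
    split : ∀ {N} (χ : List (Fin N) → Bool) → (Σ (M + m ↪ N) λ σ →
        Always k χ σ ⊎ Never k χ σ) →
      (Σ (M ↪ N) (Always k χ)) ⊎ (Σ (m ↪ N) (Never k χ))
    split χ (σ , inj₁ h) = inj₁ (σ ∘↪ left↪ M m , λ as s len → subst (T ∘ χ) (sym (map-∘ as))
      (h (map (to (left↪ M m)) as) (sorted-map (left↪ M m) s) (trans (length-map _ as) len)))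
    split χ (σ , inj₂ h) = inj₂ (σ ∘↪ right↪ M m , λ as s len → subst (λ l → ¬ T (χ l)) (sym (map-∘ as))
      (h (map (to (right↪ M m)) as) (sorted-map (right↪ M m) s) (trans (length-map _ as) len)))

-- Levels: the largest link density that is not rare

link : ∀ {N} (H : PHG N) i j k → V H i k → ℕ
link H i j k v = count₂ (λ x y → edge H i j k x y v)

Rich : ∀ {N} → ℕ → ℕ → (H : PHG N) → Between H
Rich Q ℓ H i x j v = ℓ * (card H i x * card H x j) ≤ᵇ Q * link H i x j v

NotRare : ∀ {N} (Q : ℕ) (H : PHG N) → Before H → After H → Set
NotRare Q H Φ₁ Φ₃ = ∀ {h i x j k} → Incr₅ h i x j k → Dense Q (λ v → Φ₁ h i j v ∧ Φ₃ i j k v)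

RareAt : ∀ {N} (Q ℓ : ℕ) (H : PHG N) → Before H → After H → Set
RareAt Q ℓ H Φ₁ Φ₃ = ∀ {h i x j k} → Incr₅ h i x j k →
  Q * count (λ v → (Φ₁ h i j v ∧ Φ₃ i j k v) ∧ Rich Q ℓ H i x j v) < card H i j

-- `sparse` carries the maximality. It concerns all vertices of a part subject to the conditions,
-- not only `γ`, and so can bound the edges of a triad.
record Level {N} (Q : ℕ) (H : PHG N) (Φ₁ : Before H) (Φ₃ : After H) (γ : Choice H) (ℓ : ℕ) : Set where
  field
    before : ∀ {h i j} → h Fin.< i → i Fin.< j → T (Φ₁ h i j (γ i j))
    after  : ∀ {i j k} → i Fin.< j → j Fin.< k → T (Φ₃ i j k (γ i j))
    rich   : ∀ {i x j} → i Fin.< x → x Fin.< j → T (Rich Q ℓ H i x j (γ i j))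
    sparse : RareAt Q (suc ℓ) H Φ₁ Φ₃

restrict₃ : ∀ {m N} {W : Fin N → Fin N → Fin N → Set} → (∀ i j k → W i j k) → (σ : m ↪ N) → ∀ i j k → W (to σ i) (to σ j) (to σ k)
restrict₃ Φ σ i j k = Φ (to σ i) (to σ j) (to σ k)

HasLevel : ∀ {N} (Q m : ℕ) (H : PHG N) → Before H → After H → Set
HasLevel {N} Q m H Φ₁ Φ₃ = Σ (m ↪ N) λ σ → Σ (Choice (H ↾ σ)) λ γ → ∃ (Level Q (H ↾ σ) (restrict₃ Φ₁ σ) (restrict₃ Φ₃ σ) γ)

-- Descent on the level. Five-tuples are coloured by whether the vertices of the current level are
-- dense: one colour yields the choice `γ`, the other makes the level rare and leads to the next
-- lower one. Level 0 is met by every vertex.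
level-from : ∀ Q ℓ m → ∃ λ N → (H : PHG N) (Φ₁ : Before H) (Φ₃ : After H) →
  NotRare Q H Φ₁ Φ₃ → RareAt Q (suc ℓ) H Φ₁ Φ₃ → HasLevel Q m H Φ₁ Φ₃
level-from Q zero m = proj₁ cc , go
  where
  cc = common-choice Q m
  go : (H : PHG (proj₁ cc)) (Φ₁ : Before H) (Φ₃ : After H) →
    NotRare Q H Φ₁ Φ₃ → RareAt Q 1 H Φ₁ Φ₃ → HasLevel Q m H Φ₁ Φ₃
  go H Φ₁ Φ₃ dense sparse
    with σ , γ , p₁ , p₂ , p₃ ← proj₂ cc H Φ₁ (Rich Q 0 H) Φ₃ (λ hi ix xj jk → dense (hi , ix , xj , jk))
    = σ , γ , 0 , record { before = p₁ ; after = p₃ ; rich = p₂ ; sparse = λ (hi , ix , xj , jk) → sparse (mono σ hi , mono σ ix , mono σ xj , mono σ jk) }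
level-from Q (suc ℓ) m = proj₁ ro , λ H Φ₁ Φ₃ dense sparse → decide H Φ₁ Φ₃ dense sparse (proj₂ ro (χ H Φ₁ Φ₃))
  where
  cc = common-choice Q m
  rec = level-from Q ℓ m
  ro = ramsey-or 5 (proj₁ cc) (proj₁ rec)
  N = proj₁ ro
  χ : (H : PHG N) (Φ₁ : Before H) (Φ₃ : After H) → List (Fin N) → Bool
  χ H Φ₁ Φ₃ (h ∷ i ∷ x ∷ j ∷ k ∷ []) = card H i j ≤ᵇ Q * count (λ v → (Φ₁ h i j v ∧ Φ₃ i j k v) ∧ Rich Q (suc ℓ) H i x j v)
  χ H Φ₁ Φ₃ _ = false
  shuffle : ∀ a b c → T ((a ∧ b) ∧ c) → T (a ∧ c ∧ b)
  shuffle true true true _ = _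
  decide : (H : PHG N) (Φ₁ : Before H) (Φ₃ : After H) → NotRare Q H Φ₁ Φ₃ → RareAt Q (suc (suc ℓ)) H Φ₁ Φ₃ →
    (Σ (proj₁ cc ↪ N) (Always 5 (χ H Φ₁ Φ₃))) ⊎ (Σ (proj₁ rec ↪ N) (Never 5 (χ H Φ₁ Φ₃))) → HasLevel Q m H Φ₁ Φ₃
  decide H Φ₁ Φ₃ dense sparse (inj₁ (σ , col))
    with σ′ , γ , p₁ , p₂ , p₃ ← proj₂ cc (H ↾ σ) (restrict₃ Φ₁ σ) (Rich Q (suc ℓ) (H ↾ σ)) (restrict₃ Φ₃ σ)
      (λ {h} {i} {x} {j} {k} hi ix xj jk → dense-mono {Q}
        (λ v → shuffle (Φ₁ (to σ h) (to σ i) (to σ j) v) (Φ₃ (to σ i) (to σ j) (to σ k) v) (Rich Q (suc ℓ) (H ↾ σ) i x j v))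
        (≤ᵇ⇒≤ (card (H ↾ σ) i j) _ (col (h ∷ i ∷ x ∷ j ∷ k ∷ []) (sorted₅ hi ix xj jk) refl)))
    = σ ∘↪ σ′ , γ , suc ℓ , record { before = p₁ ; after = p₃ ; rich = p₂ ; sparse = λ (hi , ix , xj , jk) →
        sparse (mono σ (mono σ′ hi) , mono σ (mono σ′ ix) , mono σ (mono σ′ xj) , mono σ (mono σ′ jk)) }
  decide H Φ₁ Φ₃ dense sparse (inj₂ (σ , col))
    with σ′ , γ , ℓ′ , lev ← proj₂ rec (H ↾ σ) (restrict₃ Φ₁ σ) (restrict₃ Φ₃ σ)
      (λ (hi , ix , xj , jk) → dense (mono σ hi , mono σ ix , mono σ xj , mono σ jk))
      (λ {h} {i} {x} {j} {k} (hi , ix , xj , jk) → ≰⇒> (λ le → col (h ∷ i ∷ x ∷ j ∷ k ∷ []) (sorted₅ hi ix xj jk) refl (≤⇒≤ᵇ le)))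
    = σ ∘↪ σ′ , γ , ℓ′ , record { Level lev }

-- A choice of vertices subject to Φ₁ and Φ₃ whose links have the largest density, in units of 1/Q, that is not rare.
LevelIn : ℕ → ℕ → ℕ → Set
LevelIn Q m N = (H : PHG N) (Φ₁ : Before H) (Φ₃ : After H) → NotRare Q H Φ₁ Φ₃ → HasLevel Q m H Φ₁ Φ₃

level-proof : ∀ Q m → ∃ (LevelIn Q m)
level-proof Q m = proj₁ lf , λ H Φ₁ Φ₃ dense → proj₂ lf H Φ₁ Φ₃ dense λ {h} {i} {x} {j} {k} inc →
  subst (_< card H i j) (sym (trans (cong (Q *_) (none H Φ₁ Φ₃ h i x j k)) (*-zeroʳ Q))) z<s
  where
  -- The descent starts where nothing is left: level `suc Q` would be a link of density above 1.
  lf = level-from Q Q m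
  none : ∀ {N} (H : PHG N) (Φ₁ : Before H) (Φ₃ : After H) h i x j k →
    count (λ v → (Φ₁ h i j v ∧ Φ₃ i j k v) ∧ Rich Q (suc Q) H i x j v) ≡ 0
  none H Φ₁ Φ₃ h i x j k = n≤0⇒n≡0 (≤-trans (count-mono (λ v t → poor v (T∧ʳ {Φ₁ h i j v ∧ Φ₃ i j k v} t))) (≤-reflexive (count-false (card H i j))))
    where
    poor : ∀ v → T (Rich Q (suc Q) H i x j v) → T false
    poor v t = contradiction (≤-trans (≤ᵇ⇒≤ (suc Q * (card H i x * card H x j)) _ t) (*-monoʳ-≤ Q (count₂≤ (λ x′ y → edge H i x j x′ y v))))
      (<⇒≱ (*-monoˡ-< (card H i x * card H x j) (n<1+n Q)))

abstract

  level : ∀ Q m → ∃ (LevelIn Q m)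
  level = level-proof

-- Links that avoid outcomes (1) to (4)

module _ {N} (q : ℕ) (H : PHG N) (γ γ′ : Choice H) where

  RR : ∀ a b c d → V H b c → V H c d → Bool
  RR a b c d x y = inR q H γ a b c x ∧ inR q H γ b c d y ∧ edge H b c d x y (γ′ b d)

  LL : ∀ b c d e → V H b c → V H c d → Bool
  LL b c d e x y = inL q H γ c d e y ∧ inL q H γ b c d x ∧ edge H b c d x y (γ′ b d)

  RL : ∀ a b c d e → V H b c → V H c d → Bool
  RL a b c d e x y = inR q H γ a b c x ∧ inL q H γ c d e y ∧ edge H b c d x y (γ′ b d)

  Few : ∀ b c d → (V H b c → V H c d → Bool) → Set
  Few b c d P = q * count₂ P < card H b c * card H c d

  -- The three products of neighbourhoods that `case1`, `case2` and `case3` turn into outcomes; `γ`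
  -- supplies the neighbourhoods, `γ′` the link.
  Avoids : Set
  Avoids = ∀ {a b c d e} → Incr₅ a b c d e →
    Few b c d (RR a b c d) × Few b c d (LL b c d e) × Few b c d (RL a b c d e)

AvoidsOrOutcome : ℕ → ℕ → ℕ → ℕ → Set₁
AvoidsOrOutcome q n m N = (H : PHG N) (γ γ′ : Choice H) → DenseLinks q H γ →
  Outcome n H ⊎ Σ (m ↪ N) λ σ → Avoids q (H ↾ σ) (γ ⇂ σ) (γ′ ⇂ σ)

avoids-or-outcome-proof : ∀ q n m → ∃ (AvoidsOrOutcome q n m)
avoids-or-outcome-proof q n m = proj₁ r₁ , step₁
  where
  c₁ = case1 q (4 * n)
  c₂ = case2 q (4 * n)
  c₃ = case3 q (4 * n)
  r₃ = ramsey-or 5 (proj₁ c₃) m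
  r₂ = ramsey-or 4 (proj₁ c₂) (proj₁ r₃)
  r₁ = ramsey-or 4 (proj₁ c₁) (proj₁ r₂)
  many : ∀ {N} (H : PHG N) b c d → (V H b c → V H c d → Bool) → Bool
  many H b c d P = card H b c * card H c d ≤ᵇ q * count₂ P
  χ₁ χ₂ χ₃ : ∀ {N} (H : PHG N) (γ γ′ : Choice H) → List (Fin N) → Bool
  χ₁ H γ γ′ (a ∷ b ∷ c ∷ d ∷ []) = many H b c d (RR q H γ γ′ a b c d)
  χ₁ H γ γ′ _ = false
  χ₂ H γ γ′ (b ∷ c ∷ d ∷ e ∷ []) = many H b c d (LL q H γ γ′ b c d e)
  χ₂ H γ γ′ _ = false
  χ₃ H γ γ′ (a ∷ b ∷ c ∷ d ∷ e ∷ []) = many H b c d (RL q H γ γ′ a b c d e)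
  χ₃ H γ γ′ _ = false
  step₃ : (H : PHG (proj₁ r₃)) (γ γ′ : Choice H) → DenseLinks q H γ →
    (∀ {a b c d} → a Fin.< b → b Fin.< c → c Fin.< d → Few q H γ γ′ b c d (RR q H γ γ′ a b c d)) →
    (∀ {b c d e} → b Fin.< c → c Fin.< d → d Fin.< e → Few q H γ γ′ b c d (LL q H γ γ′ b c d e)) →
    Outcome n H ⊎ Σ (m ↪ proj₁ r₃) λ σ → Avoids q (H ↾ σ) (γ ⇂ σ) (γ′ ⇂ σ)
  step₃ H γ γ′ links rr ll with proj₂ r₃ (χ₃ H γ γ′)
  ... | inj₁ (σ , col)
    with σ′ , c ← proj₂ c₃ (H ↾ σ) (γ ⇂ σ) (γ′ ⇂ σ) (λ ij jk → links (mono σ ij) (mono σ jk))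
      (λ {a} {b} {c} {d} {e} (ab , bc , cd , de) → ≤ᵇ⇒≤ (card (H ↾ σ) b c * card (H ↾ σ) c d) _
        (col (a ∷ b ∷ c ∷ d ∷ e ∷ []) (sorted₅ ab bc cd de) refl))
    = inj₁ (outcome-↾ σ (outcome-↾ σ′ (whole _ , inj₂ (inj₂ (inj₁ c)))))
  ... | inj₂ (σ , col) = inj₂ (σ , λ {a} {b} {c} {d} {e} (ab , bc , cd , de) →
    rr (mono σ ab) (mono σ bc) (mono σ cd) , ll (mono σ bc) (mono σ cd) (mono σ de) ,
    ≰⇒> (λ le → col (a ∷ b ∷ c ∷ d ∷ e ∷ []) (sorted₅ ab bc cd de) refl (≤⇒≤ᵇ le)))
  step₂ : (H : PHG (proj₁ r₂)) (γ γ′ : Choice H) → DenseLinks q H γ →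
    (∀ {a b c d} → a Fin.< b → b Fin.< c → c Fin.< d → Few q H γ γ′ b c d (RR q H γ γ′ a b c d)) →
    Outcome n H ⊎ Σ (m ↪ proj₁ r₂) λ σ → Avoids q (H ↾ σ) (γ ⇂ σ) (γ′ ⇂ σ)
  step₂ H γ γ′ links rr with proj₂ r₂ (χ₂ H γ γ′)
  ... | inj₁ (σ , col)
    with σ′ , c ← proj₂ c₂ (H ↾ σ) (γ ⇂ σ) (γ′ ⇂ σ)
      (λ {b} {c} {d} {e} bc cd de → ≤ᵇ⇒≤ (card (H ↾ σ) b c * card (H ↾ σ) c d) _
        (col (b ∷ c ∷ d ∷ e ∷ []) (sorted₄ bc cd de) refl))
    = inj₁ (outcome-↾ σ (outcome-↾ σ′ (whole _ , inj₂ (inj₁ c))))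
  ... | inj₂ (σ , col)
    with step₃ (H ↾ σ) (γ ⇂ σ) (γ′ ⇂ σ) (λ ij jk → links (mono σ ij) (mono σ jk)) (λ ab bc cd → rr (mono σ ab) (mono σ bc) (mono σ cd))
      (λ {b} {c} {d} {e} bc cd de → ≰⇒> (λ le → col (b ∷ c ∷ d ∷ e ∷ []) (sorted₄ bc cd de) refl (≤⇒≤ᵇ le)))
  ...   | inj₁ o        = inj₁ (outcome-↾ σ o)
  ...   | inj₂ (σ′ , a) = inj₂ (σ ∘↪ σ′ , a)
  step₁ : AvoidsOrOutcome q n m (proj₁ r₁)
  step₁ H γ γ′ links with proj₂ r₁ (χ₁ H γ γ′)
  ... | inj₁ (σ , col)
    with σ′ , c ← proj₂ c₁ (H ↾ σ) (γ ⇂ σ) (γ′ ⇂ σ)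
      (λ {a} {b} {c} {d} ab bc cd → ≤ᵇ⇒≤ (card (H ↾ σ) b c * card (H ↾ σ) c d) _
        (col (a ∷ b ∷ c ∷ d ∷ []) (sorted₄ ab bc cd) refl))
    = inj₁ (outcome-↾ σ (outcome-↾ σ′ (whole _ , inj₁ c)))
  ... | inj₂ (σ , col)
    with step₂ (H ↾ σ) (γ ⇂ σ) (γ′ ⇂ σ) (λ ij jk → links (mono σ ij) (mono σ jk))
      (λ {a} {b} {c} {d} ab bc cd → ≰⇒> (λ le → col (a ∷ b ∷ c ∷ d ∷ []) (sorted₄ ab bc cd) refl (≤⇒≤ᵇ le)))
  ...   | inj₁ o        = inj₁ (outcome-↾ σ o)
  ...   | inj₂ (σ′ , a) = inj₂ (σ ∘↪ σ′ , a)

abstract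

  avoids-or-outcome : ∀ q n m → ∃ (AvoidsOrOutcome q n m)
  avoids-or-outcome = avoids-or-outcome-proof

-- In each pair the first entry names the choice giving the neighbourhoods, the second the choice
-- giving the link.
AllAvoidsOrOutcome : ℕ → ℕ → List (Fin 3 × Fin 3) → ℕ → ℕ → Set₁
AllAvoidsOrOutcome q n ps m N = (H : PHG N) (γ : Fin 3 → Choice H) → All (λ p → DenseLinks q H (γ (proj₁ p))) ps →
  Outcome n H ⊎ Σ (m ↪ N) λ σ → All (λ p → Avoids q (H ↾ σ) (γ (proj₁ p) ⇂ σ) (γ (proj₂ p) ⇂ σ)) ps

avoids-↾ : ∀ {m N} q (H : PHG N) (γ γ′ : Choice H) (σ : m ↪ N) → Avoids q H γ γ′ → Avoids q (H ↾ σ) (γ ⇂ σ) (γ′ ⇂ σ)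
avoids-↾ q H γ γ′ σ av (ab , bc , cd , de) = av (mono σ ab , mono σ bc , mono σ cd , mono σ de)

all-avoids-or-outcome : ∀ q n ps m → ∃ (AllAvoidsOrOutcome q n ps m)
all-avoids-or-outcome q n []             m = m , λ H γ _ → inj₂ (id↪ , [])
all-avoids-or-outcome q n ((s , t) ∷ ps) m = proj₁ one , go
  where
  rest = all-avoids-or-outcome q n ps m
  one = avoids-or-outcome q n (proj₁ rest)
  restrict : ∀ {m N} {H : PHG N} {γ : Fin 3 → Choice H} (σ : m ↪ N) {ps : List (Fin 3 × Fin 3)} →
    All (λ p → DenseLinks q H (γ (proj₁ p))) ps → All (λ p → DenseLinks q (H ↾ σ) (γ (proj₁ p) ⇂ σ)) ps
  restrict σ []       = []
  restrict {H = H} {γ} σ (_∷_ {x = p} l ls) = (λ ij jk → l (mono σ ij) (mono σ jk)) ∷ restrict {H = H} {γ} σ ls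
  go : AllAvoidsOrOutcome q n ((s , t) ∷ ps) m (proj₁ one)
  go H γ (links ∷ linkss) with proj₂ one H (γ s) (γ t) links
  ... | inj₁ o = inj₁ o
  ... | inj₂ (σ , av) with proj₂ rest (H ↾ σ) (λ s → γ s ⇂ σ) (restrict {H = H} {γ} σ linkss)
  ...   | inj₁ o = inj₁ (outcome-↾ σ o)
  ...   | inj₂ (ρ , avs) = inj₂ (σ ∘↪ ρ , avoids-↾ q (H ↾ σ) (γ s ⇂ σ) (γ t ⇂ σ) ρ av ∷ avs)

CrossesOrOutcome : ℕ → ℕ → ℕ → ℕ → Set₁
CrossesOrOutcome q n m N = (H : PHG N) (γ γ¹ γ² γ′ : Choice H) →
  DenseLinks q H γ¹ → DenseLinks q H γ² →
  (∀ {i j k} → i Fin.< j → j Fin.< k → T (inL q H γ i j k (γ¹ i j))) →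
  (∀ {h i j} → h Fin.< i → i Fin.< j → T (inR q H γ h i j (γ² i j))) →
  Outcome n H ⊎ Σ (m ↪ N) λ σ → let G = H ↾ σ in ∀ {b c d} → b Fin.< c → c Fin.< d →
    q * count₂ (λ x y → inL q G (γ¹ ⇂ σ) b c d x ∧ inR q G (γ² ⇂ σ) b c d y ∧ edge G b c d x y ((γ′ ⇂ σ) b d)) < card G b c * card G c d

crosses-or-outcome : ∀ q n → 2 ≤ n → ∀ m → ∃ (CrossesOrOutcome q n m)
crosses-or-outcome q n 2≤n m = N , go
  where
  c₄ = case4 q n 2≤n
  ro = ramsey-or 3 (proj₁ c₄) m
  N = proj₁ ro
  χ : (H : PHG N) (γ¹ γ² γ′ : Choice H) → List (Fin N) → Bool
  χ H γ¹ γ² γ′ (b ∷ c ∷ d ∷ []) = card H b c * card H c d ≤ᵇ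
    q * count₂ (λ x y → inL q H γ¹ b c d x ∧ inR q H γ² b c d y ∧ edge H b c d x y (γ′ b d))
  χ H γ¹ γ² γ′ _ = false
  go : CrossesOrOutcome q n m N
  go H γ γ¹ γ² γ′ links¹ links² L R with proj₂ ro (χ H γ¹ γ² γ′)
  ... | inj₁ (σ , col)
    with ρ , c ← proj₂ c₄ (H ↾ σ) (γ ⇂ σ) (γ¹ ⇂ σ) (γ² ⇂ σ) (γ′ ⇂ σ)
      (λ ij jk → links¹ (mono σ ij) (mono σ jk)) (λ ij jk → links² (mono σ ij) (mono σ jk))
      (λ ij jk → L (mono σ ij) (mono σ jk)) (λ hi ij → R (mono σ hi) (mono σ ij))
      (λ {b} {c} {d} bc cd → ≤ᵇ⇒≤ (card (H ↾ σ) b c * card (H ↾ σ) c d) _ (col (b ∷ c ∷ d ∷ []) (sorted₃ bc cd) refl))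
    = inj₁ (outcome-↾ σ (outcome-↾ ρ (whole _ , inj₂ (inj₂ (inj₂ c)))))
  ... | inj₂ (σ , col) =
    inj₂ (σ , λ {b} {c} {d} bc cd → ≰⇒> (λ le → col (b ∷ c ∷ d ∷ []) (sorted₃ bc cd) refl (≤⇒≤ᵇ le)))

-- The optimisation problem with maximum 4/27

≤⇒+ : ∀ {m n} → m ≤ n → ∃ λ t → n ≡ m + t
≤⇒+ {m} {n} le = n ∸ m , sym (m+[n∸m]≡n le)

am-gm₂ : ∀ u v → 4 * (u * v) ≤ (u + v) * (u + v)
am-gm₂ u v with ≤-total u v
... | inj₁ u≤v with t , refl ← ≤⇒+ u≤v = subst (4 * (u * (u + t)) ≤_) (ring u t) (m≤m+n _ (t * t))
  where
  ring : ∀ u t → 4 * (u * (u + t)) + t * t ≡ (u + (u + t)) * (u + (u + t))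
  ring = solve-∀
... | inj₂ v≤u with t , refl ← ≤⇒+ v≤u = subst (4 * ((v + t) * v) ≤_) (ring v t) (m≤m+n _ (t * t))
  where
  ring : ∀ v t → 4 * ((v + t) * v) + t * t ≡ (v + t + v) * (v + t + v)
  ring = solve-∀

cube : ℕ → ℕ
cube n = n * (n * n)

-- With the smallest variable split off, the difference of the two sides is 9x(u² - uv + v²) + (u +
-- v)³.
am-gm₃-min : ∀ x u v → 27 * (x * ((x + u) * (x + v))) ≤ cube (x + (x + u) + (x + v))
am-gm₃-min x u v = begin
  27 * (x * ((x + u) * (x + v)))  ≡⟨ left x u v ⟩
  rest + 27 * (x * (u * v))  ≤⟨ +-monoʳ-≤ rest (m≤m+n _ (9 * (x * (u * v)))) ⟩
  rest + (27 * (x * (u * v)) + 9 * (x * (u * v)))  ≡⟨ cong (rest +_) (mid x (u * v)) ⟩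
  rest + 9 * (x * (4 * (u * v)))  ≤⟨ +-monoʳ-≤ rest (*-monoʳ-≤ 9 (*-monoʳ-≤ x (am-gm₂ u v))) ⟩
  rest + 9 * (x * ((u + v) * (u + v)))  ≤⟨ m≤m+n _ (cube (u + v)) ⟩
  rest + 9 * (x * ((u + v) * (u + v))) + cube (u + v)  ≡⟨ right x u v ⟩
  cube (x + (x + u) + (x + v))  ∎
  where
  open ≤-Reasoning
  rest = 27 * (x * (x * x)) + 27 * (x * (x * (u + v)))
  left : ∀ x u v → 27 * (x * ((x + u) * (x + v))) ≡ 27 * (x * (x * x)) + 27 * (x * (x * (u + v))) + 27 * (x * (u * v))
  left = solve-∀
  mid : ∀ x w → 27 * (x * w) + 9 * (x * w) ≡ 9 * (x * (4 * w))
  mid = solve-∀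
  right : ∀ x u v → 27 * (x * (x * x)) + 27 * (x * (x * (u + v))) + 9 * (x * ((u + v) * (u + v))) + (u + v) * ((u + v) * (u + v))
    ≡ (x + (x + u) + (x + v)) * ((x + (x + u) + (x + v)) * (x + (x + u) + (x + v)))
  right = solve-∀

am-gm₃-≤ : ∀ {x y z} → x ≤ y → x ≤ z → 27 * (x * (y * z)) ≤ cube (x + y + z)
am-gm₃-≤ {x} x≤y x≤z with u , refl ← ≤⇒+ x≤y | v , refl ← ≤⇒+ x≤z = am-gm₃-min x u v

am-gm₃ : ∀ x y z → 27 * (x * (y * z)) ≤ cube (x + y + z)
am-gm₃ x y z with ≤-total x y | ≤-total x z | ≤-total y z
... | inj₁ x≤y | inj₁ x≤z | _        = am-gm₃-≤ x≤y x≤z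
... | inj₁ x≤y | inj₂ z≤x | _        = subst₂ _≤_ (cong (27 *_) (rot x y z)) (cong cube (rot+ x y z)) (am-gm₃-≤ z≤x (≤-trans z≤x x≤y))
  where
  rot : ∀ x y z → z * (x * y) ≡ x * (y * z)
  rot = solve-∀
  rot+ : ∀ x y z → z + x + y ≡ x + y + z
  rot+ = solve-∀
... | inj₂ y≤x | _        | inj₁ y≤z = subst₂ _≤_ (cong (27 *_) (rot x y z)) (cong cube (rot+ x y z)) (am-gm₃-≤ y≤x y≤z)
  where
  rot : ∀ x y z → y * (x * z) ≡ x * (y * z)
  rot = solve-∀
  rot+ : ∀ x y z → y + x + z ≡ x + y + z
  rot+ = solve-∀
... | inj₂ y≤x | _        | inj₂ z≤y = subst₂ _≤_ (cong (27 *_) (rot x y z)) (cong cube (rot+ x y z)) (am-gm₃-≤ (≤-trans z≤y y≤x) z≤y)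
  where
  rot : ∀ x y z → z * (x * y) ≡ x * (y * z)
  rot = solve-∀
  rot+ : ∀ x y z → z + x + y ≡ x + y + z
  rot+ = solve-∀

-- `p + o` is to be the weight of X and `p′ + o′` that of its complement, with `p` and `p′` the
-- parts inside L₀ or R₀. Adding the pairs `p * p′` inside gives a product, at most a quarter of the
-- squared total.
split-bound₁ : ∀ p p′ o o′ → 4 * (p * o′ + o * p′ + o * o′) ≤ (p + p′ + (o + o′)) * (p + p′ + (o + o′))
split-bound₁ p p′ o o′ = begin
  4 * (p * o′ + o * p′ + o * o′)  ≤⟨ *-monoʳ-≤ 4 (m≤m+n (p * o′ + o * p′ + o * o′) (p * p′)) ⟩
  4 * (p * o′ + o * p′ + o * o′ + p * p′)  ≡⟨ cong (4 *_) (left p p′ o o′) ⟩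
  4 * ((p + o) * (p′ + o′))  ≤⟨ am-gm₂ (p + o) (p′ + o′) ⟩
  (p + o + (p′ + o′)) * (p + o + (p′ + o′))  ≡⟨ right p p′ o o′ ⟩
  (p + p′ + (o + o′)) * (p + p′ + (o + o′))  ∎
  where
  open ≤-Reasoning
  left : ∀ p p′ o o′ → p * o′ + o * p′ + o * o′ + p * p′ ≡ (p + o) * (p′ + o′)
  left = solve-∀
  right : ∀ p p′ o o′ → (p + o + (p′ + o′)) * (p + o + (p′ + o′)) ≡ (p + p′ + (o + o′)) * (p + p′ + (o + o′))
  right = solve-∀

-- For o ≤ o′ one has op′ ≤ o′p′ and oo′ ≤ o(p + p′), and with po′ these add up to the product. The
-- other case is symmetric.
split-bound₂ : ∀ p p′ o o′ → o + o′ ≤ p + p′ → p * o′ + o * p′ + o * o′ ≤ (p + p′) * (o + o′)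
split-bound₂ p p′ o o′ le with ≤-total o o′
... | inj₁ o≤o′ = begin
  p * o′ + o * p′ + o * o′  ≤⟨ +-mono-≤ (+-monoʳ-≤ (p * o′) (*-monoˡ-≤ p′ o≤o′)) (*-monoʳ-≤ o (≤-trans (m≤n+m o′ o) le)) ⟩
  p * o′ + o′ * p′ + o * (p + p′)  ≡⟨ ring p p′ o o′ ⟩
  (p + p′) * (o + o′)  ∎
  where
  open ≤-Reasoning
  ring : ∀ p p′ o o′ → p * o′ + o′ * p′ + o * (p + p′) ≡ (p + p′) * (o + o′)
  ring = solve-∀
... | inj₂ o′≤o = begin
  p * o′ + o * p′ + o * o′  ≤⟨ +-mono-≤ (+-monoˡ-≤ (o * p′) (*-monoʳ-≤ p o′≤o)) (*-monoˡ-≤ o′ (≤-trans (m≤m+n o o′) le)) ⟩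
  p * o + o * p′ + (p + p′) * o′  ≡⟨ ring p p′ o o′ ⟩
  (p + p′) * (o + o′)  ∎
  where
  open ≤-Reasoning
  ring : ∀ p p′ o o′ → p * o + o * p′ + (p + p′) * o′ ≡ (p + p′) * (o + o′)
  ring = solve-∀

-- The common weight b of y and y′ is paid by the bound on their sum, the excess t of the weight of
-- y by y ≤ ab.
weighted : ∀ b t c {M y y′} → let a = b + t in y ≤ a * b → y + y′ ≤ M →
  a * y + b * y′ + c * (a * b) ≤ b * M + (t + c) * (a * b)
weighted b t c {M} {y} {y′} y≤ sum≤ = begin
  (b + t) * y + b * y′ + c * ((b + t) * b)  ≡⟨ ring b t c y y′ ((b + t) * b) ⟩
  b * (y + y′) + (t * y + c * ((b + t) * b))  ≤⟨ +-mono-≤ (*-monoʳ-≤ b sum≤) (+-monoˡ-≤ _ (*-monoʳ-≤ t y≤)) ⟩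
  b * M + (t * ((b + t) * b) + c * ((b + t) * b)) ≡⟨ cong (b * M +_) (*-distribʳ-+ ((b + t) * b) t c) ⟨
  b * M + (t + c) * ((b + t) * b)  ∎
  where
  open ≤-Reasoning
  ring : ∀ b t c y y′ w → (b + t) * y + b * y′ + c * w ≡ b * (y + y′) + (t * y + c * w)
  ring = solve-∀

-- The hypotheses reduce the objective to ab(a + 2c). The mean inequality for a, 2b and a + 2c,
-- whose sum is 2(a + b + c), finishes; equality means c = 0 and a = 2b.
large-part : ∀ b t c {y y′} → let a = b + t in y ≤ a * b → y + y′ ≤ a * (b + c) →
  27 * (a * y + b * y′ + c * (a * b)) ≤ 4 * cube (a + b + c)
large-part b t c {y} {y′} y≤ sum≤ = *-cancelˡ-≤ 2 (begin
  2 * (27 * (a * y + b * y′ + c * (a * b)))  ≤⟨ *-monoʳ-≤ 2 (*-monoʳ-≤ 27 (weighted b t c y≤ sum≤)) ⟩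
  2 * (27 * (b * (a * (b + c)) + (t + c) * (a * b)))  ≡⟨ left b t c ⟩
  27 * (a * (2 * b * (a + 2 * c)))  ≤⟨ am-gm₃ a (2 * b) (a + 2 * c) ⟩
  cube (a + 2 * b + (a + 2 * c))  ≡⟨ right a b c ⟩
  2 * (4 * cube (a + b + c))  ∎)
  where
  open ≤-Reasoning
  a = b + t
  left : ∀ b t c → 2 * (27 * (b * ((b + t) * (b + c)) + (t + c) * ((b + t) * b))) ≡ 27 * ((b + t) * (2 * b * ((b + t) + 2 * c)))
  left = solve-∀
  right : ∀ a b c → (a + 2 * b + (a + 2 * c)) * ((a + 2 * b + (a + 2 * c)) * (a + 2 * b + (a + 2 * c)))
    ≡ 2 * (4 * ((a + b + c) * ((a + b + c) * (a + b + c))))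
  right = solve-∀

-- The form 10b² - 17bk + 16k² has negative discriminant, 289 - 640. It is what remains of
-- `balanced` after a common factor is split off.
quadratic : ∀ b k → 17 * (b * k) ≤ 10 * (b * b) + 16 * (k * k)
quadratic b k with ≤-total b k
... | inj₁ b≤k with u , refl ← ≤⇒+ b≤k = subst (17 * (b * (b + u)) ≤_) (ring b u) (m≤m+n _ _)
  where
  ring : ∀ b u → 17 * (b * (b + u)) + (9 * (b * b) + 15 * (b * u) + 16 * (u * u)) ≡ 10 * (b * b) + 16 * ((b + u) * (b + u))
  ring = solve-∀
... | inj₂ k≤b with u , refl ← ≤⇒+ k≤b = subst (17 * ((k + u) * k) ≤_) (ring k u) (m≤m+n _ _)
  where
  ring : ∀ k u → 17 * ((k + u) * k) + (9 * (k * k) + 3 * (k * u) + 10 * (u * u)) ≡ 10 * ((k + u) * (k + u)) + 16 * (k * k)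
  ring = solve-∀

-- With S = a + b + c and k = S - 2b, the bounds 4(y + y′) ≤ S² and 2a ≤ S make four times the
-- objective at most bS(S + 2k). Against 16S³, this leaves 27b(2b + 3k) ≤ 16(2b + k)², which is
-- `quadratic`.
balanced : ∀ b t c {y y′} → let a = b + t in a ≤ b + c → y ≤ a * b → 4 * (y + y′) ≤ (a + b + c) * (a + b + c) →
  27 * (a * y + b * y′ + c * (a * b)) ≤ 4 * cube (a + b + c)
balanced b t c {y} {y′} a≤ y≤ sum≤ = *-cancelˡ-≤ 4 (begin
  4 * (27 * (a * y + b * y′ + c * (a * b)))  ≤⟨ *-monoʳ-≤ 4 (*-monoʳ-≤ 27 (weighted b t c y≤ ≤-refl)) ⟩
  4 * (27 * (b * (y + y′) + k * (a * b)))  ≡⟨ left a b k (y + y′) ⟩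
  27 * (b * (4 * (y + y′)) + 2 * (k * b * (2 * a)))  ≤⟨ *-monoʳ-≤ 27 (+-mono-≤ (*-monoʳ-≤ b sum≤) (*-monoʳ-≤ 2 (*-monoʳ-≤ (k * b) 2a≤S))) ⟩
  27 * (b * (S * S) + 2 * (k * b * S))  ≡⟨ cong (λ S → 27 * (b * (S * S) + 2 * (k * b * S))) S≡ ⟩
  27 * (b * ((2 * b + k) * (2 * b + k)) + 2 * (k * b * (2 * b + k))) ≡⟨ mid b k ⟩
  (2 * b + k) * (54 * (b * b) + 64 * (b * k) + 17 * (b * k)) ≤⟨ *-monoʳ-≤ (2 * b + k) (+-monoʳ-≤ (54 * (b * b) + 64 * (b * k)) (quadratic b k)) ⟩
  (2 * b + k) * (54 * (b * b) + 64 * (b * k) + (10 * (b * b) + 16 * (k * k))) ≡⟨ right b k ⟩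
  4 * (4 * cube (2 * b + k))  ≡⟨ cong (λ S → 4 * (4 * cube S)) S≡ ⟨
  4 * (4 * cube S)  ∎)
  where
  open ≤-Reasoning
  a = b + t
  k = t + c
  S = a + b + c
  S≡ : S ≡ 2 * b + k
  S≡ = ring b t c
    where
    ring : ∀ b t c → b + t + b + c ≡ 2 * b + (t + c)
    ring = solve-∀
  2a≤S : 2 * a ≤ S
  2a≤S = begin
    2 * a  ≡⟨ ring a ⟩
    a + a  ≤⟨ +-monoʳ-≤ a a≤ ⟩
    a + (b + c)  ≡⟨ +-assoc a b c ⟨
    S  ∎
    where
    ring : ∀ a → 2 * a ≡ a + a
    ring = solve-∀
  left : ∀ a b k w → 4 * (27 * (b * w + k * (a * b))) ≡ 27 * (b * (4 * w) + 2 * (k * b * (2 * a)))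
  left = solve-∀
  mid : ∀ b k → 27 * (b * ((2 * b + k) * (2 * b + k)) + 2 * (k * b * (2 * b + k))) ≡ (2 * b + k) * (54 * (b * b) + 64 * (b * k) + 17 * (b * k))
  mid = solve-∀
  right : ∀ b k → (2 * b + k) * (54 * (b * b) + 64 * (b * k) + (10 * (b * b) + 16 * (k * k))) ≡ 4 * (4 * ((2 * b + k) * ((2 * b + k) * (2 * b + k))))
  right = solve-∀

ordered : ∀ a b c y y′ → b ≤ a → y ≤ a * b →
  4 * (y + y′) ≤ (a + b + c) * (a + b + c) → (b + c ≤ a → y + y′ ≤ a * (b + c)) →
  27 * (a * y + b * y′ + c * (a * b)) ≤ 4 * cube (a + b + c)
ordered a b c y y′ b≤a y≤ sum≤ large with t , refl ← ≤⇒+ b≤a with b + c ≤? b + t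
... | yes le = large-part b t c y≤ (large le)
... | no ¬le = balanced b t c (<⇒≤ (≰⇒> ¬le)) y≤ sum≤

-- Exchanging a with b and y with y′ changes nothing, so the case b ≤ a suffices.
optimum : ∀ a b c y y′ → y ≤ a * b → y′ ≤ a * b →
  4 * (y + y′) ≤ (a + b + c) * (a + b + c) →
  (b + c ≤ a → y + y′ ≤ a * (b + c)) → (a + c ≤ b → y + y′ ≤ b * (a + c)) →
  27 * (a * y + b * y′ + c * (a * b)) ≤ 4 * cube (a + b + c)
optimum a b c y y′ y≤ y′≤ sum≤ largeᵃ largeᵇ with ≤-total b a
... | inj₁ b≤a = ordered a b c y y′ b≤a y≤ sum≤ largeᵃ
... | inj₂ a≤b = subst₂ _≤_ (cong (27 *_) (swapˡ a b c y y′)) (cong (λ s → 4 * cube (s + c)) (+-comm b a))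
  (ordered b a c y′ y a≤b (subst (y′ ≤_) (*-comm a b) y′≤)
    (subst₂ _≤_ (cong (4 *_) (+-comm y y′)) (cong (λ s → (s + c) * (s + c)) (+-comm a b)) sum≤)
    (λ le → subst (_≤ b * (a + c)) (+-comm y y′) (largeᵇ le)))
  where
  swapˡ : ∀ a b c y y′ → b * y′ + a * y + c * (b * a) ≡ a * y + b * y′ + c * (a * b)
  swapˡ = solve-∀

-- Types of vertices and their weights

data Class : Set where
  left right none : Class

infix 4 _≐_ _≐ᵗ_
_≐_ : Class → Class → Bool
left  ≐ left  = true
right ≐ right = true
none  ≐ none  = true
_     ≐ _     = false

classes : List Class
classes = left ∷ right ∷ none ∷ []

class-∈ : ∀ c → c ∈ classes
class-∈ left  = here refl
class-∈ right = there (here refl)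
class-∈ none  = there (there (here refl))

Type : Set
Type = Class × Class × Class

opaque

  -- Opaque, to keep sums over the 27 types folded; evaluation is allowed only for the finite
  -- checks.
  types : List Type
  types = cartesianProduct classes (cartesianProduct classes classes)

  types-product : types ≡ cartesianProduct classes (cartesianProduct classes classes)
  types-product = refl

  length-types : length types ≡ 27
  length-types = refl

  type-∈ : ∀ t → t ∈ types
  type-∈ (a , b , c) = ∈-cartesianProduct⁺ (class-∈ a) (∈-cartesianProduct⁺ (class-∈ b) (class-∈ c))

_≐ᵗ_ : Type → Type → Bool
(a , b , c) ≐ᵗ (a′ , b′ , c′) = (a ≐ a′) ∧ (b ≐ b′) ∧ (c ≐ c′)

∑-++ : ∀ {A : Set} (xs ys : List A) f → ∑ (xs ++ ys) f ≡ ∑ xs f + ∑ ys f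
∑-++ []       ys f = refl
∑-++ (x ∷ xs) ys f = trans (cong (f x +_) (∑-++ xs ys f)) (sym (+-assoc (f x) _ _))

∑-cartesianProduct : ∀ {A B : Set} (xs : List A) (ys : List B) f →
  ∑ (cartesianProduct xs ys) f ≡ ∑ xs (λ x → ∑ ys (λ y → f (x , y)))
∑-cartesianProduct []       ys f = refl
∑-cartesianProduct (x ∷ xs) ys f = trans (∑-++ (map (x ,_) ys) (cartesianProduct xs ys) f)
  (cong₂ _+_ (cong sum (sym (map-∘ ys))) (∑-cartesianProduct xs ys f))

∑-class : ∀ c (F : Class → ℕ) → ∑ classes (λ s → ⟦ s ≐ c ⟧ * F s) ≡ F c
∑-class left  F = trans (+-identityʳ _) (*-identityˡ (F left))
∑-class right F = trans (+-identityʳ _) (*-identityˡ (F right))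
∑-class none  F = trans (+-identityʳ _) (*-identityˡ (F none))

∑-type : ∀ t (F : Type → ℕ) → ∑ types (λ s → ⟦ s ≐ᵗ t ⟧ * F s) ≡ F t
∑-type t@(a , b , c) F = begin
  ∑ types (λ s → ⟦ s ≐ᵗ t ⟧ * F s)
    ≡⟨ trans (cong (λ ts → ∑ ts (λ s → ⟦ s ≐ᵗ t ⟧ * F s)) types-product) (trans (∑-cartesianProduct classes (cartesianProduct classes classes) (λ s → ⟦ s ≐ᵗ t ⟧ * F s)) (∑-cong classes λ x → ∑-cartesianProduct classes classes (λ yz → ⟦ (x , yz) ≐ᵗ t ⟧ * F (x , yz)))) ⟩
  ∑ classes (λ x → ∑ classes λ y → ∑ classes λ z → ⟦ (x ≐ a) ∧ (y ≐ b) ∧ (z ≐ c) ⟧ * F (x , y , z))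
    ≡⟨ (∑-cong classes λ x → trans (∑-cong classes λ y → trans (∑-cong classes λ z → split (x ≐ a) (y ≐ b) (z ≐ c) (F (x , y , z)))
         (∑-*ˡ classes ⟦ x ≐ a ⟧ (λ z → ⟦ y ≐ b ⟧ * (⟦ z ≐ c ⟧ * F (x , y , z)))))
         (∑-*ˡ classes ⟦ x ≐ a ⟧ (λ y → ∑ classes λ z → ⟦ y ≐ b ⟧ * (⟦ z ≐ c ⟧ * F (x , y , z))))) ⟩
  ∑ classes (λ x → ⟦ x ≐ a ⟧ * ∑ classes λ y → ∑ classes λ z → ⟦ y ≐ b ⟧ * (⟦ z ≐ c ⟧ * F (x , y , z)))
    ≡⟨ ∑-class a (λ x → ∑ classes λ y → ∑ classes λ z → ⟦ y ≐ b ⟧ * (⟦ z ≐ c ⟧ * F (x , y , z))) ⟩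
  ∑ classes (λ y → ∑ classes λ z → ⟦ y ≐ b ⟧ * (⟦ z ≐ c ⟧ * F (a , y , z)))
    ≡⟨ (∑-cong classes λ y → ∑-*ˡ classes ⟦ y ≐ b ⟧ (λ z → ⟦ z ≐ c ⟧ * F (a , y , z))) ⟩
  ∑ classes (λ y → ⟦ y ≐ b ⟧ * ∑ classes λ z → ⟦ z ≐ c ⟧ * F (a , y , z))
    ≡⟨ ∑-class b (λ y → ∑ classes λ z → ⟦ z ≐ c ⟧ * F (a , y , z)) ⟩
  ∑ classes (λ z → ⟦ z ≐ c ⟧ * F (a , b , z))
    ≡⟨ ∑-class c (λ z → F (a , b , z)) ⟩
  F t ∎
  where
  open ≡-Reasoning
  split : ∀ p q r n → ⟦ p ∧ q ∧ r ⟧ * n ≡ ⟦ p ⟧ * (⟦ q ⟧ * (⟦ r ⟧ * n))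
  split false q r n = refl
  split true false r n = refl
  split true true r n = sym (trans (*-identityˡ _) (*-identityˡ _))

∑-by-type : ∀ {n} (τ : Fin n → Type) (F : Type → ℕ) →
  ∑ (allFin n) (F ∘ τ) ≡ ∑ types (λ s → count (λ v → s ≐ᵗ τ v) * F s)
∑-by-type {n} τ F = begin
  ∑ (allFin n) (F ∘ τ)  ≡⟨ ∑-cong (allFin n) (λ v → sym (∑-type (τ v) F)) ⟩
  ∑ (allFin n) (λ v → ∑ types (λ s → ⟦ s ≐ᵗ τ v ⟧ * F s))  ≡⟨ ∑-swap (allFin n) types _ ⟩
  ∑ types (λ s → ∑ (allFin n) (λ v → ⟦ s ≐ᵗ τ v ⟧ * F s))  ≡⟨ ∑-cong types (λ s → trans (∑-*ʳ (allFin n) (F s) _) (cong (_* F s) (sym (count-∑ _)))) ⟩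
  ∑ types (λ s → count (λ v → s ≐ᵗ τ v) * F s)  ∎
  where open ≡-Reasoning

-- x s / Q bounds the frequency of the type s.
Fits : ℕ → (Type → ℕ) → ∀ {n} → (Fin n → Type) → Set
Fits Q x {n} τ = ∀ s → Q * count (λ v → s ≐ᵗ τ v) ≤ x s * n

fits-bound : ∀ Q x {n} (τ : Fin n → Type) → Fits Q x τ → ∀ F →
  Q * ∑ (allFin n) (F ∘ τ) ≤ n * ∑ types (λ s → F s * x s)
fits-bound Q x {n} τ fits F = begin
  Q * ∑ (allFin n) (F ∘ τ)  ≡⟨ cong (Q *_) (∑-by-type τ F) ⟩
  Q * ∑ types (λ s → count (λ v → s ≐ᵗ τ v) * F s)  ≡⟨ ∑-*ˡ types Q (λ s → count (λ v → s ≐ᵗ τ v) * F s) ⟨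
  ∑ types (λ s → Q * (count (λ v → s ≐ᵗ τ v) * F s))  ≤⟨ ∑-mono types each ⟩
  ∑ types (λ s → n * (F s * x s))  ≡⟨ ∑-*ˡ types n (λ s → F s * x s) ⟩
  n * ∑ types (λ s → F s * x s)  ∎
  where
  open ≤-Reasoning
  ring : ∀ x n f → x * n * f ≡ n * (f * x)
  ring = solve-∀
  each : ∀ s → Q * (count (λ v → s ≐ᵗ τ v) * F s) ≤ n * (F s * x s)
  each s = begin
    Q * (count (λ v → s ≐ᵗ τ v) * F s)  ≡⟨ *-assoc Q _ (F s) ⟨
    Q * count (λ v → s ≐ᵗ τ v) * F s  ≤⟨ *-monoˡ-≤ (F s) (fits s) ⟩
    x s * n * F s  ≡⟨ ring (x s) n (F s) ⟩
    n * (F s * x s)  ∎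

class₀ class₁ class₂ : Type → Class
class₀ (a , _ , _) = a
class₁ (_ , b , _) = b
class₂ (_ , _ , c) = c

-- The combinations that `Avoids` makes rare. A vertex in both neighbourhoods has class `left`, so
-- `right` means R without L.
conflict : Class → Class → Bool
conflict left  left  = true
conflict right right = true
conflict right left  = true
conflict _     _     = false

joined : Class → Class → Bool
joined s t = (s ≐ left) ∧ (t ≐ right)

forbidden : Type → Type → Bool
forbidden s t = conflict (class₀ s) (class₀ t) ∨ conflict (class₁ s) (class₁ t) ∨ conflict (class₂ s) (class₂ t) ∨
  joined (class₁ s) (class₂ t)

-- Where the links of γ⁰, γ¹ and γ² can have more than a negligible number of pairs. For γ⁰ only e₀
-- ≤ ab is wanted, so `pair₀` records no further exclusions.
pair₀ pair₁ pair₂ : Type → Type → Bool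
pair₀ s t = joined (class₀ s) (class₀ t)
pair₁ s t = joined (class₁ s) (class₁ t) ∧ not (forbidden s t)
pair₂ s t = joined (class₂ s) (class₂ t) ∧ not (forbidden s t)

module Weights (x : Type → ℕ) where

  weight : (Type → Type → ℕ) → ℕ
  weight f = ∑ types (λ s → ∑ types (λ t → f s t * x t) * x s)

  part : (Type → Bool) → ℕ
  part P = ∑ types (λ s → ⟦ P s ⟧ * x s)

  weight-mono : ∀ {f g} → (∀ s t → f s t ≤ g s t) → weight f ≤ weight g
  weight-mono le = ∑-mono types λ s → *-monoˡ-≤ (x s) (∑-mono types λ t → *-monoˡ-≤ (x t) (le s t))

  weight-cong : ∀ {f g} → (∀ s t → f s t ≡ g s t) → weight f ≡ weight g
  weight-cong eq = ∑-cong types λ s → cong (_* x s) (∑-cong types λ t → cong (_* x t) (eq s t))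

  weight-+ : ∀ f g → weight (λ s t → f s t + g s t) ≡ weight f + weight g
  weight-+ f g = trans (∑-cong types λ s → trans (cong (_* x s) (trans (∑-cong types λ t → *-distribʳ-+ (x t) (f s t) (g s t)) (∑-+ types (λ t → f s t * x t) (λ t → g s t * x t))))
    (*-distribʳ-+ (x s) (∑ types λ t → f s t * x t) (∑ types λ t → g s t * x t)))
    (∑-+ types (λ s → ∑ types (λ t → f s t * x t) * x s) (λ s → ∑ types (λ t → g s t * x t) * x s))

  weight-swap : ∀ f → weight (λ s t → f t s) ≡ weight f
  weight-swap f = trans (∑-cong types λ s → sym (∑-*ʳ types (x s) _)) (trans (∑-swap types types _)
    (∑-cong types λ s → trans (∑-cong types λ t → ring (f s t) (x s) (x t)) (∑-*ʳ types (x s) _)))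
    where
    ring : ∀ f a b → f * a * b ≡ f * b * a
    ring = solve-∀

  weight-* : ∀ P R → weight (λ s t → ⟦ P s ⟧ * ⟦ R t ⟧) ≡ part P * part R
  weight-* P R = trans (∑-cong types λ s → trans (cong (_* x s) (trans (∑-cong types λ t → *-assoc ⟦ P s ⟧ ⟦ R t ⟧ (x t)) (∑-*ˡ types ⟦ P s ⟧ _)))
    (ring ⟦ P s ⟧ (part R) (x s))) (∑-*ʳ types (part R) _)
    where
    ring : ∀ p r a → p * r * a ≡ p * a * r
    ring = solve-∀

  part-+ : ∀ P R S → (∀ s → ⟦ P s ⟧ + ⟦ R s ⟧ ≡ ⟦ S s ⟧) → part P + part R ≡ part S
  part-+ P R S eq = trans (sym (∑-+ types (λ s → ⟦ P s ⟧ * x s) (λ s → ⟦ R s ⟧ * x s))) (∑-cong types λ s →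
    trans (sym (*-distribʳ-+ (x s) ⟦ P s ⟧ ⟦ R s ⟧)) (cong (_* x s) (eq s)))

  part₀ : Class → ℕ
  part₀ c = part (λ s → class₀ s ≐ c)

  total : ℕ
  total = ∑ types x

module Pairing (Z : Class) where

  X pᶻ p̅ᶻ oᶻ o̅ᶻ : Type → Bool
  X s   = (class₁ s ≐ left) ∨ (class₂ s ≐ right)
  pᶻ s  = X s ∧ (class₀ s ≐ Z)
  p̅ᶻ s = not (X s) ∧ (class₀ s ≐ Z)
  oᶻ s  = X s ∧ not (class₀ s ≐ Z)
  o̅ᶻ s = not (X s) ∧ not (class₀ s ≐ Z)

  f g : Type → Type → ℕ
  f s t = ⟦ pair₁ s t ⟧ + ⟦ pair₂ s t ⟧
  g s t = ⟦ pᶻ s ⟧ * ⟦ o̅ᶻ t ⟧ + ⟦ oᶻ s ⟧ * ⟦ p̅ᶻ t ⟧ + ⟦ oᶻ s ⟧ * ⟦ o̅ᶻ t ⟧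

  -- A pair of `pair₁` has only its left end in X, a pair of `pair₂` only its right end: both ends
  -- in X would be a forbidden crossing. No unordered pair counts for both, because right before
  -- left is a conflict, and none lies inside Z, because equal classes `left` or `right` conflict.
  -- Both sides are symmetrised since `g` puts the end in X first. All 27² pairs of types are
  -- evaluated.
  check : Bool
  check = all (λ s → all (λ t → f s t + f t s ≤ᵇ g s t + g t s) types) types

  from-check : T check → ∀ s t → f s t + f t s ≤ g s t + g t s
  from-check ok s t = ≤ᵇ⇒≤ _ _ (All.lookup (all⁺ _ types (All.lookup (all⁺ _ types ok) (type-∈ s))) (type-∈ t))

opaque
  unfolding types

  check-left : T (Pairing.check left)
  check-left = tt

  check-right : T (Pairing.check right)
  check-right = tt

module _ (x : Type → ℕ) where

  open Weights x

  -- `check` compares `f` and `g` only after adding transposes, which doubles the weight on both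
  -- sides.
  pairs-split : ∀ Z → T (Pairing.check Z) → ∃ λ p → ∃ λ p′ → ∃ λ o → ∃ λ o′ →
    weight (λ s t → ⟦ pair₁ s t ⟧) + weight (λ s t → ⟦ pair₂ s t ⟧) ≤ p * o′ + o * p′ + o * o′ ×
    p + p′ ≡ part₀ Z × o + o′ ≡ part (λ s → not (class₀ s ≐ Z))
  pairs-split Z ok = part pᶻ , part p̅ᶻ , part oᶻ , part o̅ᶻ ,
    subst₂ _≤_ (weight-+ (λ s t → ⟦ pair₁ s t ⟧) (λ s t → ⟦ pair₂ s t ⟧)) g-weight (*-cancelˡ-≤ 2 (begin
      2 * weight f  ≡⟨ double f ⟩
      weight (λ s t → f s t + f t s)  ≤⟨ weight-mono (from-check ok) ⟩
      weight (λ s t → g s t + g t s)  ≡⟨ double g ⟨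
      2 * weight g  ∎)) ,
    part-+ pᶻ p̅ᶻ (λ s → class₀ s ≐ Z) (λ s → cases (X s) (class₀ s ≐ Z)) ,
    part-+ oᶻ o̅ᶻ (λ s → not (class₀ s ≐ Z)) (λ s → cases (X s) (not (class₀ s ≐ Z)))
    where
    open Pairing Z
    open ≤-Reasoning
    double : ∀ h → 2 * weight h ≡ weight (λ s t → h s t + h t s)
    double h = trans (cong (weight h +_) (trans (+-identityʳ _) (sym (weight-swap h)))) (sym (weight-+ h (λ s t → h t s)))
    g-weight : weight g ≡ part pᶻ * part o̅ᶻ + part oᶻ * part p̅ᶻ + part oᶻ * part o̅ᶻ
    g-weight = trans (weight-+ (λ s t → ⟦ pᶻ s ⟧ * ⟦ o̅ᶻ t ⟧ + ⟦ oᶻ s ⟧ * ⟦ p̅ᶻ t ⟧) _)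
      (cong₂ _+_ (trans (weight-+ (λ s t → ⟦ pᶻ s ⟧ * ⟦ o̅ᶻ t ⟧) _) (cong₂ _+_ (weight-* pᶻ o̅ᶻ) (weight-* oᶻ p̅ᶻ))) (weight-* oᶻ o̅ᶻ))
    cases : ∀ a b → ⟦ a ∧ b ⟧ + ⟦ not a ∧ b ⟧ ≡ ⟦ b ⟧
    cases true  b = +-identityʳ ⟦ b ⟧
    cases false b = refl

  private
    a = part₀ left
    b = part₀ right
    c = part₀ none
    W = weight (λ s t → ⟦ pair₁ s t ⟧) + weight (λ s t → ⟦ pair₂ s t ⟧)

  parts-total : a + b + c ≡ total
  parts-total = trans (cong (_+ c) (part-+ (λ s → class₀ s ≐ left) (λ s → class₀ s ≐ right) (λ s → not (class₀ s ≐ none)) (λ s → two (class₀ s))))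
    (trans (part-+ (λ s → not (class₀ s ≐ none)) (λ s → class₀ s ≐ none) (λ _ → true) (λ s → three (class₀ s))) (∑-cong types λ s → *-identityˡ (x s)))
    where
    two : ∀ k → ⟦ k ≐ left ⟧ + ⟦ k ≐ right ⟧ ≡ ⟦ not (k ≐ none) ⟧
    two left  = refl
    two right = refl
    two none  = refl
    three : ∀ k → ⟦ not (k ≐ none) ⟧ + ⟦ k ≐ none ⟧ ≡ 1
    three left  = refl
    three right = refl
    three none  = refl

  not-left : b + c ≡ part (λ s → not (class₀ s ≐ left))
  not-left = part-+ (λ s → class₀ s ≐ right) (λ s → class₀ s ≐ none) _ (λ s → two (class₀ s))
    where
    two : ∀ k → ⟦ k ≐ right ⟧ + ⟦ k ≐ none ⟧ ≡ ⟦ not (k ≐ left) ⟧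
    two left  = refl
    two right = refl
    two none  = refl

  not-right : a + c ≡ part (λ s → not (class₀ s ≐ right))
  not-right = part-+ (λ s → class₀ s ≐ left) (λ s → class₀ s ≐ none) _ (λ s → two (class₀ s))
    where
    two : ∀ k → ⟦ k ≐ left ⟧ + ⟦ k ≐ none ⟧ ≡ ⟦ not (k ≐ right) ⟧
    two left  = refl
    two right = refl
    two none  = refl

  pairs-bound : 4 * W ≤ (a + b + c) * (a + b + c) × (b + c ≤ a → W ≤ a * (b + c)) × (a + c ≤ b → W ≤ b * (a + c))
  pairs-bound =
    (let p , p′ , o , o′ , W≤ , z , r = pairs-split left check-left in
      subst (λ S → 4 * W ≤ S * S) (trans (cong₂ _+_ z (trans r (sym not-left))) (sym (+-assoc a b c)))
        (≤-trans (*-monoʳ-≤ 4 W≤) (split-bound₁ p p′ o o′))) ,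
    (λ le → let p , p′ , o , o′ , W≤ , z , r = pairs-split left check-left in
      subst₂ (λ u v → W ≤ u * v) z (trans r (sym not-left))
        (≤-trans W≤ (split-bound₂ p p′ o o′ (subst₂ _≤_ (trans not-left (sym r)) (sym z) le)))) ,
    (λ le → let p , p′ , o , o′ , W≤ , z , r = pairs-split right check-right in
      subst₂ (λ u v → W ≤ u * v) z (trans r (sym not-right))
        (≤-trans W≤ (split-bound₂ p p′ o o′ (subst₂ _≤_ (trans not-right (sym r)) (sym z) le))))

-- From links to weights: the error terms

∑₂ : ∀ n m → (Fin n → Fin m → ℕ) → ℕ
∑₂ n m f = ∑ (allFin n) λ x → ∑ (allFin m) (f x)

count₂-∑₂ : ∀ {n m} (p : Fin n → Fin m → Bool) → count₂ p ≡ ∑₂ n m (λ x y → ⟦ p x y ⟧)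
count₂-∑₂ p = trans (count₂-∑ p) (∑-cong (allFin _) (λ x → count-∑ (p x)))

∑₂-+ : ∀ n m (f g : Fin n → Fin m → ℕ) → ∑₂ n m (λ x y → f x y + g x y) ≡ ∑₂ n m f + ∑₂ n m g
∑₂-+ n m f g = trans (∑-cong (allFin n) λ x → ∑-+ (allFin m) (f x) (g x)) (∑-+ (allFin n) (λ x → ∑ (allFin m) (f x)) (λ x → ∑ (allFin m) (g x)))

∑₂-mono : ∀ n m {f g : Fin n → Fin m → ℕ} → (∀ x y → f x y ≤ g x y) → ∑₂ n m f ≤ ∑₂ n m g
∑₂-mono n m le = ∑-mono (allFin n) λ x → ∑-mono (allFin m) (le x)

Small : ℕ → ℕ → ∀ {n m} → (Fin n → Fin m → ℕ) → Set
Small q k {n} {m} f = q * ∑₂ n m f ≤ k * (n * m)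

small-+ : ∀ q k l {n m} (f g : Fin n → Fin m → ℕ) → Small q k f → Small q l g → Small q (k + l) (λ x y → f x y + g x y)
small-+ q k l {n} {m} f g sf sg = begin
  q * ∑₂ n m (λ x y → f x y + g x y)  ≡⟨ cong (q *_) (∑₂-+ n m f g) ⟩
  q * (∑₂ n m f + ∑₂ n m g)  ≡⟨ *-distribˡ-+ q _ _ ⟩
  q * ∑₂ n m f + q * ∑₂ n m g  ≤⟨ +-mono-≤ sf sg ⟩
  k * (n * m) + l * (n * m)  ≡⟨ *-distribʳ-+ (n * m) k l ⟨
  (k + l) * (n * m)  ∎
  where open ≤-Reasoning

small-mono : ∀ q k {n m} {f g : Fin n → Fin m → ℕ} → (∀ x y → f x y ≤ g x y) → Small q k g → Small q k f
small-mono q k {n} {m} le s = ≤-trans (*-monoʳ-≤ q (∑₂-mono n m le)) s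

small-few : ∀ q {n m} (p : Fin n → Fin m → Bool) → q * count₂ p < n * m → Small q 1 (λ x y → ⟦ p x y ⟧)
small-few q {n} {m} p lt = subst₂ _≤_ (cong (q *_) (count₂-∑₂ p)) (sym (*-identityˡ (n * m))) (<⇒≤ lt)

-- A non-neighbour lies in less than a 1/q proportion of its possible edges, so all non-neighbours
-- together lose at most a 1/q proportion of the pairs.
small-rows : ∀ q {n m} (e : Fin n → Fin m → Bool) → Small q 1 (λ x y → ⟦ e x y ∧ not (m ≤ᵇ q * count (e x)) ⟧)
small-rows q {n} {m} e = begin
  q * ∑₂ n m (λ x y → ⟦ e x y ∧ not (m ≤ᵇ q * count (e x)) ⟧)  ≡⟨ ∑-*ˡ (allFin n) q _ ⟨
  ∑ (allFin n) (λ x → q * ∑ (allFin m) (λ y → ⟦ e x y ∧ not (m ≤ᵇ q * count (e x)) ⟧))  ≤⟨ ∑-mono (allFin n) row ⟩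
  ∑ (allFin n) (λ _ → m)  ≡⟨ ∑F-const n m ⟩
  n * m  ≡⟨ *-identityˡ (n * m) ⟨
  1 * (n * m)  ∎
  where
  open ≤-Reasoning
  row : ∀ x → q * ∑ (allFin m) (λ y → ⟦ e x y ∧ not (m ≤ᵇ q * count (e x)) ⟧) ≤ m
  row x with m ≤ᵇ q * count (e x) in eq
  ... | true  = ≤-trans (*-monoʳ-≤ q (∑-mono (allFin m) (λ y → ⟦⟧-mono {e x y ∧ false} {false} (T∧ʳ {e x y}))))
                  (≤-trans (≤-reflexive (trans (cong (q *_) (trans (∑F-const m 0) (*-zeroʳ m))) (*-zeroʳ q))) z≤n)
  ... | false = ≤-trans (*-monoʳ-≤ q (≤-trans (∑-mono (allFin m) (λ y → ⟦⟧-mono {e x y ∧ true} (T∧ˡ {e x y}))) (≤-reflexive (sym (count-∑ (e x))))))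
                  (<⇒≤ (≰⇒> (λ le → subst T eq (≤⇒≤ᵇ le))))

small-swap : ∀ q k {n m} (f : Fin n → Fin m → ℕ) → Small q k (λ y x → f x y) → Small q k f
small-swap q k {n} {m} f s = subst₂ _≤_ (cong (q *_) (∑-swap (allFin m) (allFin n) (λ y x → f x y))) (cong (k *_) (*-comm m n)) s

class-of : Bool → Bool → Class
class-of l r = if l then left else if r then right else none

small-conflict : ∀ q {n m} (e : Fin n → Fin m → Bool) (lx rx : Fin n → Bool) (ly ry : Fin m → Bool) →
  q * count₂ (λ x y → rx x ∧ ry y ∧ e x y) < n * m →
  q * count₂ (λ x y → ly y ∧ lx x ∧ e x y) < n * m →
  q * count₂ (λ x y → rx x ∧ ly y ∧ e x y) < n * m →
  Small q 3 (λ x y → ⟦ e x y ∧ conflict (class-of (lx x) (rx x)) (class-of (ly y) (ry y)) ⟧)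
small-conflict q e lx rx ly ry rr ll rl = small-mono q 3 (λ x y → cover (e x y) (lx x) (rx x) (ly y) (ry y))
  (small-+ q 1 2 (λ x y → ⟦ rx x ∧ ry y ∧ e x y ⟧) (λ x y → ⟦ ly y ∧ lx x ∧ e x y ⟧ + ⟦ rx x ∧ ly y ∧ e x y ⟧) (small-few q _ rr)
    (small-+ q 1 1 (λ x y → ⟦ ly y ∧ lx x ∧ e x y ⟧) (λ x y → ⟦ rx x ∧ ly y ∧ e x y ⟧) (small-few q _ ll) (small-few q _ rl)))
  where
  cover : ∀ e lx rx ly ry → ⟦ e ∧ conflict (class-of lx rx) (class-of ly ry) ⟧ ≤ ⟦ rx ∧ ry ∧ e ⟧ + (⟦ ly ∧ lx ∧ e ⟧ + ⟦ rx ∧ ly ∧ e ⟧)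
  cover false _     _     _     _     = z≤n
  cover true  true  rx    true  ry    = ≤-trans (m≤m+n 1 _) (m≤n+m _ ⟦ rx ∧ ry ∧ true ⟧)
  cover true  true  rx    false true  = z≤n
  cover true  true  rx    false false = z≤n
  cover true  false false ly    ry    = z≤n
  cover true  false true  true  ry    = m≤n+m 1 ⟦ ry ∧ true ⟧
  cover true  false true  false true  = ≤-refl
  cover true  false true  false false = z≤n

-- Outside L × R one end is a non-neighbour. Inside, the left end has class `left` and the right end
-- class `right`, unless the latter also lies in L, which is a conflict.
joined-cover : ∀ e lx rx ly ry → let s = class-of lx rx ; t = class-of ly ry in
  ⟦ e ⟧ ≤ ⟦ joined s t ⟧ + (⟦ e ∧ conflict s t ⟧ + (⟦ e ∧ not lx ⟧ + ⟦ e ∧ not ry ⟧))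
joined-cover false _     _     _     _     = z≤n
joined-cover true  true  _     true  _     = m≤m+n 1 _
joined-cover true  true  _     false true  = ≤-refl
joined-cover true  true  _     false false = ≤-refl
joined-cover true  false rx    ly    ry    = ≤-trans (m≤m+n 1 _)
  (≤-trans (m≤n+m _ ⟦ conflict (class-of false rx) (class-of ly ry) ⟧) (m≤n+m _ ⟦ joined (class-of false rx) (class-of ly ry) ⟧))

-- Each way of being forbidden is charged to its own error term. The hypothesis is `joined-cover`
-- for γ¹, whose conflict is among those charged.
forbidden-cover₁ : ∀ e J k₀ k₁ k₂ j n → ⟦ e ⟧ ≤ ⟦ J ⟧ + (⟦ e ∧ k₁ ⟧ + n) →
  ⟦ e ⟧ ≤ ⟦ J ∧ not (k₀ ∨ k₁ ∨ k₂ ∨ j) ⟧ + (⟦ e ∧ k₀ ⟧ + (⟦ e ∧ k₁ ⟧ + (⟦ e ∧ k₂ ⟧ + (⟦ e ∧ j ⟧ + n))))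
forbidden-cover₁ false _     _     _     _     _     n h = z≤n
forbidden-cover₁ true  J     true  k₁    k₂    j     n h = ≤-trans (m≤m+n 1 _) (m≤n+m _ ⟦ J ∧ false ⟧)
forbidden-cover₁ true  J     false true  k₂    j     n h = ≤-trans (m≤m+n 1 _) (m≤n+m _ ⟦ J ∧ false ⟧)
forbidden-cover₁ true  J     false false true  j     n h = ≤-trans (m≤m+n 1 _) (m≤n+m _ ⟦ J ∧ false ⟧)
forbidden-cover₁ true  J     false false false true  n h = ≤-trans (m≤m+n 1 _) (m≤n+m _ ⟦ J ∧ false ⟧)
forbidden-cover₁ true  true  false false false false n h = s≤s z≤n
forbidden-cover₁ true  false false false false false n h = h

forbidden-cover₂ : ∀ e J k₀ k₁ k₂ j n → ⟦ e ⟧ ≤ ⟦ J ⟧ + (⟦ e ∧ k₂ ⟧ + n) →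
  ⟦ e ⟧ ≤ ⟦ J ∧ not (k₀ ∨ k₁ ∨ k₂ ∨ j) ⟧ + (⟦ e ∧ k₀ ⟧ + (⟦ e ∧ k₁ ⟧ + (⟦ e ∧ k₂ ⟧ + (⟦ e ∧ j ⟧ + n))))
forbidden-cover₂ false _     _     _     _     _     n h = z≤n
forbidden-cover₂ true  J     true  k₁    k₂    j     n h = ≤-trans (m≤m+n 1 _) (m≤n+m _ ⟦ J ∧ false ⟧)
forbidden-cover₂ true  J     false true  k₂    j     n h = ≤-trans (m≤m+n 1 _) (m≤n+m _ ⟦ J ∧ false ⟧)
forbidden-cover₂ true  J     false false true  j     n h = ≤-trans (m≤m+n 1 _) (m≤n+m _ ⟦ J ∧ false ⟧)
forbidden-cover₂ true  J     false false false true  n h = ≤-trans (m≤m+n 1 _) (m≤n+m _ ⟦ J ∧ false ⟧)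
forbidden-cover₂ true  true  false false false false n h = s≤s z≤n
forbidden-cover₂ true  false false false false false n h = h

-- Summation over one end and then the other, by `fits-bound`, replaces vertices by types: a link
-- density becomes a quadratic form in `x`.
link-bound : ∀ Q k x {n m} (τ₁ : Fin n → Type) (τ₂ : Fin m → Type) → Fits Q x τ₁ → Fits Q x τ₂ →
  (e : Fin n → Fin m → Bool) (w : Type → Type → Bool) (err : Fin n → Fin m → ℕ) → Small (Q * Q) k err →
  (∀ v v′ → ⟦ e v v′ ⟧ ≤ ⟦ w (τ₁ v) (τ₂ v′) ⟧ + err v v′) →
  Q * Q * count₂ e ≤ n * m * (Weights.weight x (λ s t → ⟦ w s t ⟧) + k)
link-bound Q k x {n} {m} τ₁ τ₂ fits₁ fits₂ e w err small cover = begin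
  Q * Q * count₂ e  ≡⟨ cong (Q * Q *_) (count₂-∑₂ e) ⟩
  Q * Q * ∑₂ n m (λ v v′ → ⟦ e v v′ ⟧)  ≤⟨ *-monoʳ-≤ (Q * Q) (∑₂-mono n m cover) ⟩
  Q * Q * ∑₂ n m (λ v v′ → ⟦ w (τ₁ v) (τ₂ v′) ⟧ + err v v′)  ≡⟨ cong (Q * Q *_) (∑₂-+ n m _ err) ⟩
  Q * Q * (∑₂ n m (λ v v′ → ⟦ w (τ₁ v) (τ₂ v′) ⟧) + ∑₂ n m err)  ≡⟨ *-distribˡ-+ (Q * Q) _ _ ⟩
  Q * Q * ∑₂ n m (λ v v′ → ⟦ w (τ₁ v) (τ₂ v′) ⟧) + Q * Q * ∑₂ n m err  ≤⟨ +-mono-≤ main small ⟩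
  n * m * weight W + k * (n * m)  ≡⟨ ring (n * m) (weight W) k ⟩
  n * m * (weight W + k)  ∎
  where
  open ≤-Reasoning
  open Weights x using (weight)
  W : Type → Type → ℕ
  W s t = ⟦ w s t ⟧
  F : Type → ℕ
  F s = ∑ types (λ t → W s t * x t)
  ring : ∀ a b c → a * b + c * a ≡ a * (b + c)
  ring = solve-∀
  swap : ∀ a b c → a * (b * c) ≡ b * (a * c)
  swap = solve-∀
  swap′ : ∀ a b c → a * (b * c) ≡ b * a * c
  swap′ = solve-∀
  main : Q * Q * ∑₂ n m (λ v v′ → W (τ₁ v) (τ₂ v′)) ≤ n * m * weight W
  main = begin
    Q * Q * ∑₂ n m (λ v v′ → W (τ₁ v) (τ₂ v′))  ≡⟨ *-assoc Q Q _ ⟩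
    Q * (Q * ∑₂ n m (λ v v′ → W (τ₁ v) (τ₂ v′)))  ≡⟨ cong (Q *_) (∑-*ˡ (allFin n) Q (λ v → ∑ (allFin m) (λ v′ → W (τ₁ v) (τ₂ v′)))) ⟨
    Q * ∑ (allFin n) (λ v → Q * ∑ (allFin m) (λ v′ → W (τ₁ v) (τ₂ v′)))  ≤⟨ *-monoʳ-≤ Q (∑-mono (allFin n) λ v → fits-bound Q x τ₂ fits₂ (W (τ₁ v))) ⟩
    Q * ∑ (allFin n) (λ v → m * F (τ₁ v))  ≡⟨ cong (Q *_) (∑-*ˡ (allFin n) m (F ∘ τ₁)) ⟩
    Q * (m * ∑ (allFin n) (F ∘ τ₁))  ≡⟨ swap Q m _ ⟩
    m * (Q * ∑ (allFin n) (F ∘ τ₁))  ≤⟨ *-monoʳ-≤ m (fits-bound Q x τ₁ fits₁ F) ⟩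
    m * (n * weight W)  ≡⟨ swap′ m n (weight W) ⟩
    n * m * weight W  ∎

triadEdges-by-top : ∀ {N} (H : PHG N) b c d → triadEdges H b c d ≡ ∑ (allFin (card H b d)) (link H b c d)
triadEdges-by-top H b c d =
  trans (∑-cong (allFin (card H b c)) λ x → ∑-swap (allFin (card H c d)) (allFin (card H b d)) (λ y v → ⟦ edge H b c d x y v ⟧))
    (trans (∑-swap (allFin (card H b c)) (allFin (card H b d)) (λ x v → ∑ (allFin (card H c d)) λ y → ⟦ edge H b c d x y v ⟧))
      (∑-cong (allFin (card H b d)) λ v → sym (count₂-∑₂ (λ x y → edge H b c d x y v))))

-- Bounds on the three levels and on a triad

module Frame {N} (Q : ℕ) (H : PHG N) (γ⁰ γ¹ γ² : Choice H) where

  q : ℕ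
  q = Q * Q

  class-at : Choice H → ∀ h i j k → V H i j → Class
  class-at γ h i j k v = class-of (inL q H γ i j k v) (inR q H γ h i j v)

  type-at : ∀ h i j k → V H i j → Type
  type-at h i j k v = class-at γ⁰ h i j k v , class-at γ¹ h i j k v , class-at γ² h i j k v

  Crosses : Choice H → Fin N → Fin N → Fin N → Set
  Crosses γ b c d = q * count₂ (λ x y → inL q H γ¹ b c d x ∧ inR q H γ² b c d y ∧ edge H b c d x y (γ b d)) < card H b c * card H c d

  module _ {a b c d e : Fin N} (inc : Incr₅ a b c d e) (x : Type → ℕ)
           (fits₁ : Fits Q x (type-at a b c d)) (fits₂ : Fits Q x (type-at b c d e)) where

    open Weights x

    area : ℕ
    area = card H b c * card H c d

    module _ (γ : Choice H) where

      inLink : V H b c → V H c d → Bool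
      inLink x y = edge H b c d x y (γ b d)

      clash : Choice H → V H b c → V H c d → ℕ
      clash γ′ x y = ⟦ inLink x y ∧ conflict (class-at γ′ a b c d x) (class-at γ′ b c d e y) ⟧

      clash-small : ∀ γ′ → Avoids q H γ′ γ → Small q 3 (clash γ′)
      clash-small γ′ avoids = let rr , ll , rl = avoids inc in
        small-conflict q inLink (inL q H γ′ b c d) (inR q H γ′ a b c) (inL q H γ′ c d e) (inR q H γ′ b c d) rr ll rl

      outside : V H b c → V H c d → ℕ
      outside x y = ⟦ inLink x y ∧ not (inL q H γ b c d x) ⟧ + ⟦ inLink x y ∧ not (inR q H γ b c d y) ⟧

      outside-small : Small q 2 outside
      outside-small = small-+ q 1 1 (λ x y → ⟦ inLink x y ∧ not (inL q H γ b c d x) ⟧) (λ x y → ⟦ inLink x y ∧ not (inR q H γ b c d y) ⟧)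
        (small-rows q inLink) (small-swap q 1 (λ x y → ⟦ inLink x y ∧ not (inR q H γ b c d y) ⟧) (small-rows q (λ y x → inLink x y)))

      cross : V H b c → V H c d → ℕ
      cross x y = ⟦ inLink x y ∧ joined (class-at γ¹ a b c d x) (class-at γ² b c d e y) ⟧

      cross-small : Crosses γ b c d → Small q 1 cross
      cross-small few = small-mono q 1 (λ x y → ⟦⟧-mono (both (inLink x y) (inL q H γ¹ b c d x) (inR q H γ¹ a b c x) (inL q H γ² c d e y) (inR q H γ² b c d y)))
        (small-few q _ few)
        where
        both : ∀ e l r l′ r′ → T (e ∧ joined (class-of l r) (class-of l′ r′)) → T (l ∧ r′ ∧ e)
        both true true  r     false true  t = _
        both true true  r     true  true  ()
        both true true  r     true  false ()
        both true true  r     false false ()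
        both true false true  l′    r′    ()
        both true false false l′    r′    ()

      links-bound : ∀ {k} (w : Type → Type → Bool) (err : V H b c → V H c d → ℕ) → Small q k err →
        (∀ x y → ⟦ inLink x y ⟧ ≤ ⟦ w (type-at a b c d x) (type-at b c d e y) ⟧ + err x y) →
        ∀ {ℓ} → T (Rich Q ℓ H b c d (γ b d)) → Q * ℓ ≤ weight (λ s t → ⟦ w s t ⟧) + k
      links-bound {k} w err small cover {ℓ} rich = *-cancelˡ-≤ area (begin
        area * (Q * ℓ)  ≡⟨ ring area Q ℓ ⟩
        Q * (ℓ * area)  ≤⟨ *-monoʳ-≤ Q (≤ᵇ⇒≤ (ℓ * area) _ rich) ⟩
        Q * (Q * link H b c d (γ b d))  ≡⟨ *-assoc Q Q _ ⟨
        Q * Q * link H b c d (γ b d)  ≤⟨ link-bound Q k x (type-at a b c d) (type-at b c d e) fits₁ fits₂ inLink w err small cover ⟩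
        area * (weight (λ s t → ⟦ w s t ⟧) + k) ∎)
        where
        open ≤-Reasoning
        ring : ∀ a b c → a * (b * c) ≡ b * (c * a)
        ring = solve-∀

    level₀ : ∀ {ℓ} → Avoids q H γ⁰ γ⁰ → T (Rich Q ℓ H b c d (γ⁰ b d)) → Q * ℓ ≤ part₀ left * part₀ right + 12
    level₀ {ℓ} av rich = ≤-trans
      (links-bound γ⁰ pair₀ (λ x y → clash γ⁰ γ⁰ x y + outside γ⁰ x y)
        (small-+ q 3 2 (clash γ⁰ γ⁰) (outside γ⁰) (clash-small γ⁰ γ⁰ av) (outside-small γ⁰))
        (λ x y → joined-cover (inLink γ⁰ x y) (inL q H γ⁰ b c d x) (inR q H γ⁰ a b c x) (inL q H γ⁰ c d e y) (inR q H γ⁰ b c d y)) {ℓ} rich)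
      (+-mono-≤ (≤-reflexive (trans (weight-cong λ s t → ⟦⟧-∧ (class₀ s ≐ left) (class₀ t ≐ right)) (weight-* (λ s → class₀ s ≐ left) (λ t → class₀ t ≐ right))))
        -- The error 3 + 2 is rounded up to 12, the error of the other two levels.
        (m≤m+n 5 7))

    private
      clashes : Choice H → V H b c → V H c d → Bool
      clashes γ x y = conflict (class-at γ a b c d x) (class-at γ b c d e y)
      err : Choice H → V H b c → V H c d → ℕ
      err γ x y = clash γ γ⁰ x y + (clash γ γ¹ x y + (clash γ γ² x y + (cross γ x y + outside γ x y)))
      err-small : ∀ γ → (∀ {γ′} → γ′ ≡ γ⁰ ⊎ γ′ ≡ γ¹ ⊎ γ′ ≡ γ² → Avoids q H γ′ γ) → Crosses γ b c d → Small q 12 (err γ)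
      -- 12 = 3 + 3 + 3 + 1 + 2: three conflicts for each of γ⁰, γ¹ and γ², the crossing pairs, and
      -- non-neighbours at either end.
      err-small γ av few =
        small-+ q 3 9 (clash γ γ⁰) (λ x y → clash γ γ¹ x y + (clash γ γ² x y + (cross γ x y + outside γ x y))) (clash-small γ γ⁰ (av (inj₁ refl)))
          (small-+ q 3 6 (clash γ γ¹) (λ x y → clash γ γ² x y + (cross γ x y + outside γ x y)) (clash-small γ γ¹ (av (inj₂ (inj₁ refl))))
            (small-+ q 3 3 (clash γ γ²) (λ x y → cross γ x y + outside γ x y) (clash-small γ γ² (av (inj₂ (inj₂ refl))))
              (small-+ q 1 2 (cross γ) (outside γ) (cross-small γ few) (outside-small γ))))

    level₁ : ∀ {ℓ} → (∀ {γ′} → γ′ ≡ γ⁰ ⊎ γ′ ≡ γ¹ ⊎ γ′ ≡ γ² → Avoids q H γ′ γ¹) → Crosses γ¹ b c d →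
      T (Rich Q ℓ H b c d (γ¹ b d)) → Q * ℓ ≤ weight (λ s t → ⟦ pair₁ s t ⟧) + 12
    level₁ {ℓ} av few = links-bound γ¹ pair₁ (err γ¹) (err-small γ¹ av few)
      (λ x y → forbidden-cover₁ (inLink γ¹ x y) (joined (class-at γ¹ a b c d x) (class-at γ¹ b c d e y)) (clashes γ⁰ x y) (clashes γ¹ x y) (clashes γ² x y)
        (joined (class-at γ¹ a b c d x) (class-at γ² b c d e y)) (outside γ¹ x y)
        (joined-cover (inLink γ¹ x y) (inL q H γ¹ b c d x) (inR q H γ¹ a b c x) (inL q H γ¹ c d e y) (inR q H γ¹ b c d y))) {ℓ}

    level₂ : ∀ {ℓ} → (∀ {γ′} → γ′ ≡ γ⁰ ⊎ γ′ ≡ γ¹ ⊎ γ′ ≡ γ² → Avoids q H γ′ γ²) → Crosses γ² b c d →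
      T (Rich Q ℓ H b c d (γ² b d)) → Q * ℓ ≤ weight (λ s t → ⟦ pair₂ s t ⟧) + 12
    level₂ {ℓ} av few = links-bound γ² pair₂ (err γ²) (err-small γ² av few)
      (λ x y → forbidden-cover₂ (inLink γ² x y) (joined (class-at γ² a b c d x) (class-at γ² b c d e y)) (clashes γ⁰ x y) (clashes γ¹ x y) (clashes γ² x y)
        (joined (class-at γ¹ a b c d x) (class-at γ² b c d e y)) (outside γ² x y)
        (joined-cover (inLink γ² x y) (inL q H γ² b c d x) (inR q H γ² a b c x) (inL q H γ² c d e y) (inR q H γ² b c d y))) {ℓ}

  -- Y s bounds the level of the vertices of V_bd of class s, except for those counted by `sparse`.
  module _ (ℓ₀ ℓ₁ ℓ₂ : ℕ) where

    Y : Class → ℕ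
    Y left  = suc (ℓ₀ ⊓ ℓ₁)
    Y right = suc (ℓ₀ ⊓ ℓ₂)
    Y none  = suc ℓ₀

    -- `z` is `Q` times a link and `t` the number of possible pairs. An ordinary vertex obeys ℓ₀,
    -- also ℓ₁ as a left neighbour of γ⁰ and ℓ₂ as a right one; hence the minima in `Y`. An
    -- exceptional vertex is charged a full link. `r ∧ true` is the form that the condition on γ²
    -- takes in `Level`.
    top-cover : ∀ z t l r R₀ R₁ R₂ → z ≤ Q * t → (¬ T R₀ → z ≤ suc ℓ₀ * t) → (¬ T R₁ → z ≤ suc ℓ₁ * t) → (¬ T R₂ → z ≤ suc ℓ₂ * t) →
      z ≤ t * Y (class-of l r) + Q * t * (⟦ R₀ ⟧ + (⟦ l ∧ R₁ ⟧ + ⟦ (r ∧ true) ∧ R₂ ⟧))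
    top-cover z t l r true R₁ R₂ all _ _ _ = ≤-trans all (≤-trans (m≤m*n (Q * t) (suc _)) (m≤n+m _ _))
    top-cover z t true r false true R₂ all _ _ _ = ≤-trans all (≤-trans (m≤m*n (Q * t) (suc _)) (m≤n+m _ _))
    top-cover z t true r false false R₂ all h₀ h₁ h₂ with ⊓-sel ℓ₀ ℓ₁
    ... | inj₁ eq rewrite eq = ≤-trans (h₀ id) (≤-trans (≤-reflexive (*-comm (suc ℓ₀) t)) (m≤m+n _ _))
    ... | inj₂ eq rewrite eq = ≤-trans (h₁ id) (≤-trans (≤-reflexive (*-comm (suc ℓ₁) t)) (m≤m+n _ _))
    top-cover z t false true false R₁ true all _ _ _ = ≤-trans all (≤-trans (m≤m*n (Q * t) 1) (m≤n+m _ _))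
    top-cover z t false true false R₁ false all h₀ h₁ h₂ with ⊓-sel ℓ₀ ℓ₂
    ... | inj₁ eq rewrite eq = ≤-trans (h₀ id) (≤-trans (≤-reflexive (*-comm (suc ℓ₀) t)) (m≤m+n _ _))
    ... | inj₂ eq rewrite eq = ≤-trans (h₂ id) (≤-trans (≤-reflexive (*-comm (suc ℓ₂) t)) (m≤m+n _ _))
    top-cover z t false false false R₁ R₂ all h₀ _ _ = ≤-trans (h₀ id) (≤-trans (≤-reflexive (*-comm (suc ℓ₀) t)) (m≤m+n _ _))

    -- Three exceptional sets of proportion at most 1/Q each, with full links, amount to `3 * Q` in
    -- units of 1/Q².
    triad-bound : ∀ {a b c d e} (x : Type → ℕ) → Fits Q x (type-at a b d e) →
      Q * count (λ v → Rich Q (suc ℓ₀) H b c d v) ≤ card H b d →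
      Q * count (λ v → inL q H γ⁰ b d e v ∧ Rich Q (suc ℓ₁) H b c d v) ≤ card H b d →
      Q * count (λ v → (inR q H γ⁰ a b d v ∧ true) ∧ Rich Q (suc ℓ₂) H b c d v) ≤ card H b d →
      Q * Q * triadEdges H b c d ≤ card H b c * card H c d * card H b d *
        (∑ types (λ s → Y (class₀ s) * x s) + 3 * Q)
    triad-bound {a} {b} {c} {d} {e} x fits sp₀ sp₁ sp₂ = begin
      Q * Q * triadEdges H b c d  ≡⟨ cong (Q * Q *_) (triadEdges-by-top H b c d) ⟩
      Q * Q * ∑ vs (λ v → link H b c d v)  ≡⟨ trans (*-assoc Q Q _) (cong (Q *_) (sym (∑-*ˡ vs Q _))) ⟩
      Q * ∑ vs (λ v → Q * link H b c d v)  ≤⟨ *-monoʳ-≤ Q (∑-mono vs cover) ⟩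
      Q * ∑ vs (λ v → t * Y (class₀ (τ v)) + Q * t * (⟦ R₀ v ⟧ + (⟦ R₁ v ⟧ + ⟦ R₂ v ⟧)))
        ≡⟨ cong (Q *_) (trans (∑-+ vs (λ v → t * Y (class₀ (τ v))) _) (cong₂ _+_ (∑-*ˡ vs t _)
             (trans (∑-*ˡ vs (Q * t) _) (cong (Q * t *_) (trans (∑-+ vs (λ v → ⟦ R₀ v ⟧) _) (cong₂ _+_ (sym (count-∑ R₀))
               (trans (∑-+ vs (λ v → ⟦ R₁ v ⟧) _) (cong₂ _+_ (sym (count-∑ R₁)) (sym (count-∑ R₂)))))))))) ⟩
      Q * (t * ∑ vs (Y ∘ class₀ ∘ τ) + Q * t * (count R₀ + (count R₁ + count R₂)))
        ≡⟨ ring Q t _ (count R₀) (count R₁) (count R₂) ⟩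
      t * (Q * ∑ vs (Y ∘ class₀ ∘ τ)) + t * Q * (Q * count R₀ + (Q * count R₁ + Q * count R₂))
        ≤⟨ +-mono-≤ (*-monoʳ-≤ t (fits-bound Q x τ fits (Y ∘ class₀))) (*-monoʳ-≤ (t * Q) (+-mono-≤ sp₀ (+-mono-≤ sp₁ sp₂))) ⟩
      t * (w * ∑ types (λ s → Y (class₀ s) * x s)) + t * Q * (w + (w + w))
        ≡⟨ ring′ t w _ Q ⟩
      t * w * (∑ types (λ s → Y (class₀ s) * x s) + 3 * Q) ∎
      where
      open ≤-Reasoning
      vs = allFin (card H b d)
      t = card H b c * card H c d
      w = card H b d
      τ : V H b d → Type
      τ = type-at a b d e
      R₀ R₁ R₂ : V H b d → Bool
      R₀ v = Rich Q (suc ℓ₀) H b c d v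
      R₁ v = inL q H γ⁰ b d e v ∧ Rich Q (suc ℓ₁) H b c d v
      R₂ v = (inR q H γ⁰ a b d v ∧ true) ∧ Rich Q (suc ℓ₂) H b c d v
      poor : ∀ ℓ v → ¬ T (Rich Q ℓ H b c d v) → Q * link H b c d v ≤ ℓ * t
      poor ℓ v ¬rich = <⇒≤ (≰⇒> (λ le → ¬rich (≤⇒≤ᵇ le)))
      cover : ∀ v → Q * link H b c d v ≤ t * Y (class₀ (τ v)) + Q * t * (⟦ R₀ v ⟧ + (⟦ R₁ v ⟧ + ⟦ R₂ v ⟧))
      cover v = top-cover (Q * link H b c d v) t (inL q H γ⁰ b d e v) (inR q H γ⁰ a b d v)
        (Rich Q (suc ℓ₀) H b c d v) (Rich Q (suc ℓ₁) H b c d v) (Rich Q (suc ℓ₂) H b c d v)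
        (*-monoʳ-≤ Q (count₂≤ (λ x y → edge H b c d x y v))) (poor (suc ℓ₀) v) (poor (suc ℓ₁) v) (poor (suc ℓ₂) v)
      ring : ∀ Q t y c₀ c₁ c₂ → Q * (t * y + Q * t * (c₀ + (c₁ + c₂))) ≡ t * (Q * y) + t * Q * (Q * c₀ + (Q * c₁ + Q * c₂))
      ring = solve-∀
      ring′ : ∀ t w y Q → t * (w * y) + t * Q * (w + (w + w)) ≡ t * w * (y + 3 * Q)
      ring′ = solve-∀

-- Frequencies of types independent of the indices

Homogeneous : ∀ {N c} → ℕ → (List (Fin N) → Fin c) → ∀ {m} → m ↪ N → Set
Homogeneous k f σ = ∃ λ col → ∀ as → Sorted as → length as ≡ k → f (map (to σ) as) ≡ col

homogeneous-∘ : ∀ {N c k} {f : List (Fin N) → Fin c} {m l} (σ : m ↪ N) (ρ : l ↪ m) → Homogeneous k f σ → Homogeneous k f (σ ∘↪ ρ)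
homogeneous-∘ {f = f} σ ρ (col , h) = col , λ as s len →
  trans (cong f (map-∘ as)) (h (map (to ρ) as) (sorted-map ρ s) (trans (length-map _ as) len))

homogenise : ∀ {A : Set} c k (ts : List A) m → ∃ λ N → (f : A → List (Fin N) → Fin c) →
  Σ (m ↪ N) λ σ → All (λ t → Homogeneous k (f t) σ) ts
homogenise c k []       m = m , λ f → id↪ , []
homogenise c k (t ∷ ts) m = proj₁ one , go
  where
  rest = homogenise c k ts m
  one = ramsey-fin c k (proj₁ rest)
  go : (f : _ → List (Fin (proj₁ one)) → Fin c) → Σ (m ↪ proj₁ one) λ σ → All (λ t → Homogeneous k (f t) σ) (t ∷ ts)
  go f with σ , col , h ← proj₂ one (f t)
       with ρ , hs ← proj₂ rest (λ t as → f t (map (to σ) as))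
    = σ ∘↪ ρ , homogeneous-∘ {f = f t} σ ρ (col , h) ∷ All.map (λ {t} (col , h) → col , λ as s len → trans (cong (f t) (map-∘ as)) (h as s len)) hs

-- A density rounded down to a multiple of 1/Q: it takes finitely many values and can serve as a
-- colour.
frequency : ∀ Q {n} (p : Fin (suc n) → Bool) → Fin (suc Q)
frequency Q {n} p = Fin.fromℕ< {Q * count p / suc n} (s≤s (begin
  Q * count p / suc n  ≤⟨ /-monoˡ-≤ (suc n) (*-monoʳ-≤ Q (count≤ p)) ⟩
  Q * suc n / suc n  ≡⟨ m*n/n≡m Q (suc n) ⟩
  Q  ∎))
  where open ≤-Reasoning

frequency-≤ : ∀ Q {n} (p : Fin (suc n) → Bool) → Fin.toℕ (frequency Q p) * suc n ≤ Q * count p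
frequency-≤ Q {n} p rewrite Fin.toℕ-fromℕ< {Q * count p / suc n} {suc Q} (s≤s (≤-trans (/-monoˡ-≤ (suc n) (*-monoʳ-≤ Q (count≤ p))) (≤-reflexive (m*n/n≡m Q (suc n))))) = m/n*n≤m (Q * count p) (suc n)

frequency-> : ∀ Q {n} (p : Fin (suc n) → Bool) → Q * count p ≤ suc (Fin.toℕ (frequency Q p)) * suc n
frequency-> Q {n} p rewrite Fin.toℕ-fromℕ< {Q * count p / suc n} {suc Q} (s≤s (≤-trans (/-monoˡ-≤ (suc n) (*-monoʳ-≤ Q (count≤ p))) (≤-reflexive (m*n/n≡m Q (suc n))))) = begin
  Q * count p  ≡⟨ m≡m%n+[m/n]*n (Q * count p) (suc n) ⟩
  Q * count p % suc n + Q * count p / suc n * suc n ≤⟨ +-monoˡ-≤ _ (<⇒≤ (m%n<n (Q * count p) (suc n))) ⟩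
  suc n + Q * count p / suc n * suc n  ∎
  where open ≤-Reasoning

-- Rounded down, the frequencies add up to at most `Q`; rounding up adds one for each of the 27
-- types.
total≤ : ∀ Q {n} (τ : Fin (suc n) → Type) →
  ∑ types (λ s → suc (Fin.toℕ (frequency Q (λ v → s ≐ᵗ τ v)))) ≤ Q + 27
total≤ Q {n} τ = begin
  ∑ types (λ s → 1 + u s)  ≡⟨ ∑-+ types (λ _ → 1) u ⟩
  ∑ types (λ _ → 1) + ∑ types u  ≡⟨ cong (_+ ∑ types u) (trans (∑-const types 1) (trans (*-identityʳ _) length-types)) ⟩
  27 + ∑ types u  ≤⟨ +-monoʳ-≤ 27 (*-cancelʳ-≤ (∑ types u) Q (suc n) bound) ⟩
  27 + Q  ≡⟨ +-comm 27 Q ⟩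
  Q + 27  ∎
  where
  open ≤-Reasoning
  u : Type → ℕ
  u s = Fin.toℕ (frequency Q (λ v → s ≐ᵗ τ v))
  bound : ∑ types u * suc n ≤ Q * suc n
  bound = begin
    ∑ types u * suc n  ≡⟨ ∑-*ʳ types (suc n) u ⟨
    ∑ types (λ s → u s * suc n)  ≤⟨ ∑-mono types (λ s → frequency-≤ Q (λ v → s ≐ᵗ τ v)) ⟩
    ∑ types (λ s → Q * count (λ v → s ≐ᵗ τ v))  ≡⟨ ∑-*ˡ types Q _ ⟩
    Q * ∑ types (λ s → count (λ v → s ≐ᵗ τ v))  ≡⟨ cong (Q *_) (∑-cong types λ s → sym (*-identityʳ _)) ⟩
    Q * ∑ types (λ s → count (λ v → s ≐ᵗ τ v) * 1)  ≡⟨ cong (Q *_) (∑-by-type τ (λ _ → 1)) ⟨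
    Q * ∑ (allFin (suc n)) (λ _ → 1)  ≡⟨ cong (Q *_) (trans (∑F-const (suc n) 1) (*-identityʳ (suc n))) ⟩
    Q * suc n  ∎

-- The densities of all 27 types become independent of the indices.
Fitting : ∀ {N} → ℕ → (H : PHG N) (γ⁰ γ¹ γ² : Choice H) → Set
Fitting Q H γ⁰ γ¹ γ² = Σ (Type → ℕ) λ x → ∀ {h i j k} → h Fin.< i → i Fin.< j → j Fin.< k →
  Fits Q x (Frame.type-at Q H γ⁰ γ¹ γ² h i j k) × ∑ types x ≤ Q + 27

fit-proof : ∀ Q m → ∃ λ N → (H : PHG N) (γ⁰ γ¹ γ² : Choice H) → Σ (m ↪ N) λ σ → Fitting Q (H ↾ σ) (γ⁰ ⇂ σ) (γ¹ ⇂ σ) (γ² ⇂ σ)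
fit-proof Q m = proj₁ hom , go
  where
  hom = homogenise (suc Q) 4 types m
  go : (H : PHG (proj₁ hom)) (γ⁰ γ¹ γ² : Choice H) → Σ (m ↪ proj₁ hom) λ σ → Fitting Q (H ↾ σ) (γ⁰ ⇂ σ) (γ¹ ⇂ σ) (γ² ⇂ σ)
  go H γ⁰ γ¹ γ² = fitted (proj₂ hom f)
    where
    f : Type → List (Fin (proj₁ hom)) → Fin (suc Q)
    f s (h ∷ i ∷ j ∷ k ∷ []) = frequency Q (λ v → s ≐ᵗ Frame.type-at Q H γ⁰ γ¹ γ² h i j k v)
    f s _ = zero
    fitted : (Σ (m ↪ proj₁ hom) λ σ → All (λ t → Homogeneous 4 (f t) σ) types) →
      Σ (m ↪ proj₁ hom) λ σ → Fitting Q (H ↾ σ) (γ⁰ ⇂ σ) (γ¹ ⇂ σ) (γ² ⇂ σ)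
    fitted (σ , hs) = σ , (λ s → suc (Fin.toℕ (col s))) , λ {h} {i} {j} {k} hi ij jk →
      (λ s → subst (λ c → Q * count (λ v → s ≐ᵗ τ h i j k v) ≤ suc (Fin.toℕ c) * card (H ↾ σ) i j) (eq s hi ij jk)
        (frequency-> Q (λ v → s ≐ᵗ τ h i j k v))) ,
      subst (_≤ Q + 27) (∑-cong types λ s → cong (suc ∘ Fin.toℕ) (eq s hi ij jk)) (total≤ Q (τ h i j k))
      where
      τ = Frame.type-at Q (H ↾ σ) (γ⁰ ⇂ σ) (γ¹ ⇂ σ) (γ² ⇂ σ)
      col : Type → Fin (suc Q)
      col s = proj₁ (All.lookup hs (type-∈ s))
      eq : ∀ s {h i j k} → h Fin.< i → i Fin.< j → j Fin.< k → f s (map (to σ) (h ∷ i ∷ j ∷ k ∷ [])) ≡ col s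
      eq s hi ij jk = proj₂ (All.lookup hs (type-∈ s)) _ (sorted₄ hi ij jk) refl

abstract

  fit : ∀ Q m → ∃ λ N → (H : PHG N) (γ⁰ γ¹ γ² : Choice H) → Σ (m ↪ N) λ σ → Fitting Q (H ↾ σ) (γ⁰ ⇂ σ) (γ¹ ⇂ σ) (γ² ⇂ σ)
  fit = fit-proof

-- 4/27 + 1/r, with denominators cleared
DensityAbove : ∀ {N} → ℕ → PHG N → Set
DensityAbove {N} r H = ∀ {i j k : Fin N} → i Fin.< j → j Fin.< k →
  (4 * r + 27) * (card H i j * card H i k * card H j k) ≤ 27 * r * triadEdges H i j k

level-↾ : ∀ {m N Q} {H : PHG N} {Φ₁ : Before H} {Φ₃ : After H} {γ : Choice H} {ℓ} (σ : m ↪ N) →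
  Level Q H Φ₁ Φ₃ γ ℓ → Level Q (H ↾ σ) (restrict₃ Φ₁ σ) (restrict₃ Φ₃ σ) (γ ⇂ σ) ℓ
level-↾ σ lev = record
  { before = λ hi ij → before (mono σ hi) (mono σ ij)
  ; after  = λ ij jk → after (mono σ ij) (mono σ jk)
  ; rich   = λ ix xj → rich (mono σ ix) (mono σ xj)
  ; sparse = λ (hi , ix , xj , jk) → sparse (mono σ hi , mono σ ix , mono σ xj , mono σ jk)
  }
  where open Level lev

-- The extremal choices and the contradiction

record Setup {N} (Q r : ℕ) (H : PHG N) : Set where
  field
    γ⁰ γ¹ γ² : Choice H
    ℓ₀ ℓ₁ ℓ₂ : ℕ
    lev₀  : Level Q H (λ _ _ _ _ → true) (λ _ _ _ _ → true) γ⁰ ℓ₀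
    lev₁  : Level Q H (λ _ _ _ _ → true) (inL (Q * Q) H γ⁰) γ¹ ℓ₁
    lev₂  : Level Q H (inR (Q * Q) H γ⁰) (λ _ _ _ _ → true) γ² ℓ₂
    dense : DensityAbove r H

  γ : Fin 3 → Choice H
  γ zero             = γ⁰
  γ (suc zero)       = γ¹
  γ (suc (suc zero)) = γ²

setup-↾ : ∀ {m N Q r} {H : PHG N} (σ : m ↪ N) → Setup Q r H → Setup Q r (H ↾ σ)
setup-↾ σ S = record
  { γ⁰ = γ⁰ ⇂ σ ; γ¹ = γ¹ ⇂ σ ; γ² = γ² ⇂ σ ; ℓ₀ = ℓ₀ ; ℓ₁ = ℓ₁ ; ℓ₂ = ℓ₂
  ; lev₀ = level-↾ σ lev₀ ; lev₁ = level-↾ σ lev₁ ; lev₂ = level-↾ σ lev₂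
  ; dense = λ ij jk → dense (mono σ ij) (mono σ jk) }
  where open Setup S

Y-split : ∀ (x : Type → ℕ) (Y : Class → ℕ) → let open Weights x in
  ∑ types (λ s → Y (class₀ s) * x s) ≡ Y left * part₀ left + Y right * part₀ right + Y none * part₀ none
Y-split x Y = begin
  ∑ types (λ s → Y (class₀ s) * x s)  ≡⟨ ∑-cong types (λ s → split (class₀ s) (x s)) ⟩
  ∑ types (λ s → Y left * l s + Y right * r s + Y none * n s)
    ≡⟨ trans (∑-+ types (λ s → Y left * l s + Y right * r s) (λ s → Y none * n s)) (cong₂ _+_ (trans (∑-+ types (λ s → Y left * l s) (λ s → Y right * r s))
         (cong₂ _+_ (∑-*ˡ types (Y left) l) (∑-*ˡ types (Y right) r))) (∑-*ˡ types (Y none) n)) ⟩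
  Y left * part₀ left + Y right * part₀ right + Y none * part₀ none ∎
  where
  open Weights x
  open ≡-Reasoning
  l r n : Type → ℕ
  l s = ⟦ class₀ s ≐ left ⟧ * x s
  r s = ⟦ class₀ s ≐ right ⟧ * x s
  n s = ⟦ class₀ s ≐ none ⟧ * x s
  eq₁ : ∀ a b c w → a * w ≡ a * (1 * w) + b * (0 * w) + c * (0 * w)
  eq₁ = solve-∀
  eq₂ : ∀ a b c w → b * w ≡ a * (0 * w) + b * (1 * w) + c * (0 * w)
  eq₂ = solve-∀
  eq₃ : ∀ a b c w → c * w ≡ a * (0 * w) + b * (0 * w) + c * (1 * w)
  eq₃ = solve-∀
  split : ∀ k w → Y k * w ≡ Y left * (⟦ k ≐ left ⟧ * w) + Y right * (⟦ k ≐ right ⟧ * w) + Y none * (⟦ k ≐ none ⟧ * w)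
  split left  w = eq₁ (Y left) (Y right) (Y none) w
  split right w = eq₂ (Y left) (Y right) (Y none) w
  split none  w = eq₃ (Y left) (Y right) (Y none) w

-- `12 + Q` collects the error 12 of each level bound and the unit by which `Y` exceeds each level.
weighted-levels : ∀ Q a b c m₁ m₂ m₃ y y′ → Q * m₁ ≤ y + 12 → Q * m₂ ≤ y′ + 12 → Q * m₃ ≤ a * b + 12 →
  Q * (suc m₁ * a + suc m₂ * b + suc m₃ * c) ≤ a * y + b * y′ + c * (a * b) + (a + b + c) * (12 + Q)
weighted-levels Q a b c m₁ m₂ m₃ y y′ h₁ h₂ h₃ = begin
  Q * (suc m₁ * a + suc m₂ * b + suc m₃ * c)  ≡⟨ left′ Q a b c m₁ m₂ m₃ ⟩
  a * (Q * m₁) + b * (Q * m₂) + c * (Q * m₃) + (a + b + c) * Q  ≤⟨ +-monoˡ-≤ _ (+-mono-≤ (+-mono-≤ (*-monoʳ-≤ a h₁) (*-monoʳ-≤ b h₂)) (*-monoʳ-≤ c h₃)) ⟩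
  a * (y + 12) + b * (y′ + 12) + c * (a * b + 12) + (a + b + c) * Q  ≡⟨ right′ Q a b c y y′ (a * b) ⟩
  a * y + b * y′ + c * (a * b) + (a + b + c) * (12 + Q)  ∎
  where
  open ≤-Reasoning
  left′ : ∀ Q a b c m₁ m₂ m₃ → Q * ((1 + m₁) * a + (1 + m₂) * b + (1 + m₃) * c) ≡ a * (Q * m₁) + b * (Q * m₂) + c * (Q * m₃) + (a + b + c) * Q
  left′ = solve-∀
  right′ : ∀ Q a b c y y′ w → a * (y + 12) + b * (y′ + 12) + c * (w + 12) + (a + b + c) * Q ≡ a * y + b * y′ + c * w + (a + b + c) * (12 + Q)
  right′ = solve-∀

cube-mono : ∀ {m n} → m ≤ n → cube m ≤ cube n
cube-mono le = *-mono-≤ le (*-mono-≤ le le)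

-- The roundings cost at most 541rQ², where 541 = 432 + 100 + 9 after the lower terms are absorbed
-- using Q ≥ 100. The surplus 1/r in the density is worth 27Q³, which is 2700rQ² for Q = 100r.
slack : ∀ r′ → let r = suc r′ ; Q = 100 * r in
  r * (4 * cube (Q + 27) + 27 * ((Q + 27) * (12 + Q)) + 81 * (Q * Q)) < (4 * r + 27) * cube Q
slack r′ = begin-strict
  r * (4 * cube (Q + 27) + 27 * ((Q + 27) * (12 + Q)) + 81 * (Q * Q))  ≡⟨ cong (r *_) (expand Q) ⟩
  r * (4 * cube Q + (432 * (Q * Q) + (9801 * Q + 87480)))  ≤⟨ *-monoʳ-≤ r (+-monoʳ-≤ (4 * cube Q) (+-monoʳ-≤ (432 * (Q * Q)) (+-mono-≤ 9801Q≤ 87480≤))) ⟩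
  r * (4 * cube Q + (432 * (Q * Q) + (100 * (Q * Q) + 9 * (Q * Q))))  ≡⟨ collect r (cube Q) (Q * Q) ⟩
  4 * r * cube Q + 541 * (r * (Q * Q))  <⟨ +-monoʳ-< (4 * r * cube Q) (*-monoˡ-< (r * (Q * Q)) {541} {2700} (≤ᵇ⇒≤ _ _ tt)) ⟩
  4 * r * cube Q + 2700 * (r * (Q * Q))  ≡⟨ final r ⟩
  (4 * r + 27) * cube Q  ∎
  where
  open ≤-Reasoning
  r = suc r′
  Q = 100 * r
  100≤Q : 100 ≤ Q
  100≤Q = m≤m*n 100 r
  9801Q≤ : 9801 * Q ≤ 100 * (Q * Q)
  9801Q≤ = subst (9801 * Q ≤_) (*-assoc 100 Q Q) (*-monoˡ-≤ Q (≤-trans (≤ᵇ⇒≤ 9801 10000 tt) (*-monoʳ-≤ 100 100≤Q)))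
  87480≤ : 87480 ≤ 9 * (Q * Q)
  87480≤ = ≤-trans (≤ᵇ⇒≤ 87480 90000 tt) (*-monoʳ-≤ 9 (*-mono-≤ 100≤Q 100≤Q))
  expand : ∀ Q → 4 * ((Q + 27) * ((Q + 27) * (Q + 27))) + 27 * ((Q + 27) * (12 + Q)) + 81 * (Q * Q)
    ≡ 4 * (Q * (Q * Q)) + (432 * (Q * Q) + (9801 * Q + 87480))
  expand = solve-∀
  collect : ∀ r u v → r * (4 * u + (432 * v + (100 * v + 9 * v))) ≡ 4 * r * u + 541 * (r * v)
  collect = solve-∀
  final : ∀ r → 4 * r * (100 * r * (100 * r * (100 * r))) + 2700 * (r * (100 * r * (100 * r))) ≡ (4 * r + 27) * (100 * r * (100 * r * (100 * r)))
  final = solve-∀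

-- All but a 1/Q proportion of the tops have links below `suc ℓ`, and the exceptional ones add at
-- most one more unit.
sparse-bound : ∀ Q {N} (H : PHG N) {γ ℓ} → Level Q H (λ _ _ _ _ → true) (λ _ _ _ _ → true) γ ℓ →
  ∀ {h i x j k} → Incr₅ h i x j k →
  Q * triadEdges H i x j ≤ card H i x * card H x j * card H i j * (ℓ + 2)
sparse-bound Q H {γ} {ℓ} lev {h} {i} {x} {j} {k} inc = begin
  Q * triadEdges H i x j  ≡⟨ trans (cong (Q *_) (triadEdges-by-top H i x j)) (sym (∑-*ˡ vs Q _)) ⟩
  ∑ vs (λ v → Q * link H i x j v)  ≤⟨ ∑-mono vs cover ⟩
  ∑ vs (λ v → suc ℓ * t + t * Q * ⟦ R v ⟧)  ≡⟨ trans (∑-+ vs (λ _ → suc ℓ * t) (λ v → t * Q * ⟦ R v ⟧))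
                                                                (cong₂ _+_ (∑F-const w (suc ℓ * t)) (trans (∑-*ˡ vs (t * Q) _) (cong (t * Q *_) (sym (count-∑ R))))) ⟩
  w * (suc ℓ * t) + t * Q * count R  ≡⟨ cong (w * (suc ℓ * t) +_) (*-assoc t Q _) ⟩
  w * (suc ℓ * t) + t * (Q * count R)  ≤⟨ +-monoʳ-≤ (w * (suc ℓ * t)) (*-monoʳ-≤ t (<⇒≤ (Level.sparse lev inc))) ⟩
  w * (suc ℓ * t) + t * w  ≡⟨ ring w ℓ t ⟩
  t * w * (ℓ + 2)  ∎
  where
  open ≤-Reasoning
  vs = allFin (card H i j)
  t = card H i x * card H x j
  w = card H i j
  R : V H i j → Bool
  R v = Rich Q (suc ℓ) H i x j v
  ring : ∀ w ℓ t → w * ((1 + ℓ) * t) + t * w ≡ t * w * (ℓ + 2)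
  ring = solve-∀
  cover : ∀ v → Q * link H i x j v ≤ suc ℓ * t + t * Q * ⟦ R v ⟧
  cover v with R v in eq
  ... | true  = ≤-trans (*-monoʳ-≤ Q (count₂≤ (λ u y → edge H i x j u y v))) (≤-trans (≤-reflexive (trans (*-comm Q t) (sym (*-identityʳ (t * Q))))) (m≤n+m _ (suc ℓ * t)))
  ... | false = ≤-trans (<⇒≤ (≰⇒> (λ le → subst T eq (≤⇒≤ᵇ le)))) (m≤m+n (suc ℓ * t) _)

module Contradiction (r Q : ℕ) .{{_ : NonZero r}} (large : 81 < 4 * Q)
  (slack : r * (4 * cube (Q + 27) + 27 * ((Q + 27) * (12 + Q)) + 81 * (Q * Q)) < (4 * r + 27) * cube Q) where

  private
    q : ℕ
    q = Q * Q

  -- `y` and `y′` play e₁ and e₂ in units of 1/Q². One `x` describes the types in all parts, so the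
  -- a, b, c that weight the tops in `V_bd` are those that bound the links between `V_bc` and
  -- `V_cd`. The edge count of one triad then contradicts its density by `slack`.
  conclude : ∀ {N} (H : PHG N) (S : Setup Q r H) → let open Setup S in ∀ {a b c d e} → Incr₅ a b c d e →
    (x : Type → ℕ) → ∑ types x ≤ Q + 27 → Fits Q x (Frame.type-at Q H γ⁰ γ¹ γ² a b d e) →
    let open Weights x ; A = part₀ left ; B = part₀ right ; C = part₀ none in ∀ y y′ →
    y ≤ A * B → y′ ≤ A * B → 4 * (y + y′) ≤ (A + B + C) * (A + B + C) →
    (B + C ≤ A → y + y′ ≤ A * (B + C)) → (A + C ≤ B → y + y′ ≤ B * (A + C)) →
    Q * (ℓ₀ ⊓ ℓ₁) ≤ y + 12 → Q * (ℓ₀ ⊓ ℓ₂) ≤ y′ + 12 → Q * ℓ₀ ≤ A * B + 12 → ⊥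
  conclude H S {a} {b} {c} {d} {e} inc@(_ , bc , cd , _) x total≤ fits y y′ y≤ y′≤ s₁ s₂ s₃ l₁ l₂ l₀ =
    <-irrefl refl (begin-strict
      K * ((4 * r + 27) * cube Q)  ≡⟨ ring₁ (card H b c) (card H c d) (card H b d) (4 * r + 27) (cube Q) ⟩
      cube Q * ((4 * r + 27) * (card H b c * card H b d * card H c d)) ≤⟨ *-monoʳ-≤ (cube Q) (dense bc cd) ⟩
      cube Q * (27 * r * edges)  ≡⟨ ring₂ Q r edges ⟩
      r * (27 * (Q * (Q * Q * edges)))  ≤⟨ *-monoʳ-≤ r (*-monoʳ-≤ 27 (*-monoʳ-≤ Q bound)) ⟩
      r * (27 * (Q * (K * (M + 3 * Q))))  ≡⟨ ring₃ r Q K M ⟩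
      K * (r * (27 * (Q * M) + 81 * (Q * Q)))  ≤⟨ *-monoʳ-≤ K (*-monoʳ-≤ r (+-monoˡ-≤ (81 * (Q * Q)) QM≤)) ⟩
      K * (r * (4 * cube (Q + 27) + 27 * ((Q + 27) * (12 + Q)) + 81 * (Q * Q))) <⟨ *-monoʳ-< K slack ⟩
      K * ((4 * r + 27) * cube Q)  ∎)
    where
    open ≤-Reasoning
    open Setup S
    open Weights x
    A = part₀ left
    B = part₀ right
    C = part₀ none
    Y = Frame.Y Q H γ⁰ γ¹ γ² ℓ₀ ℓ₁ ℓ₂
    M = ∑ types (λ s → Y (class₀ s) * x s)
    K = card H b c * card H c d * card H b d
    edges = triadEdges H b c d
    bound : Q * Q * edges ≤ K * (M + 3 * Q)
    bound = Frame.triad-bound Q H γ⁰ γ¹ γ² ℓ₀ ℓ₁ ℓ₂ {a} {b} {c} {d} {e} x fits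
      (<⇒≤ (Level.sparse lev₀ inc)) (<⇒≤ (Level.sparse lev₁ inc)) (<⇒≤ (Level.sparse lev₂ inc))
    S≤ : A + B + C ≤ Q + 27
    S≤ = subst (_≤ Q + 27) (sym (parts-total x)) total≤
    QM≤ : 27 * (Q * M) ≤ 4 * cube (Q + 27) + 27 * ((Q + 27) * (12 + Q))
    QM≤ = begin
      27 * (Q * M)  ≡⟨ cong (λ M → 27 * (Q * M)) (Y-split x Y) ⟩
      27 * (Q * (Y left * A + Y right * B + Y none * C))  ≤⟨ *-monoʳ-≤ 27 (weighted-levels Q A B C (ℓ₀ ⊓ ℓ₁) (ℓ₀ ⊓ ℓ₂) ℓ₀ y y′ l₁ l₂ l₀) ⟩
      27 * (A * y + B * y′ + C * (A * B) + (A + B + C) * (12 + Q))  ≡⟨ *-distribˡ-+ 27 (A * y + B * y′ + C * (A * B)) ((A + B + C) * (12 + Q)) ⟩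
      27 * (A * y + B * y′ + C * (A * B)) + 27 * ((A + B + C) * (12 + Q))
        ≤⟨ +-mono-≤ (≤-trans (optimum A B C y y′ y≤ y′≤ s₁ s₂ s₃) (*-monoʳ-≤ 4 (cube-mono S≤))) (*-monoʳ-≤ 27 (*-monoˡ-≤ (12 + Q) S≤)) ⟩
      4 * cube (Q + 27) + 27 * ((Q + 27) * (12 + Q))  ∎
    ring₁ : ∀ u v w s t → u * v * w * (s * t) ≡ t * (s * (u * w * v))
    ring₁ = solve-∀
    ring₂ : ∀ Q r e → Q * (Q * Q) * (27 * r * e) ≡ r * (27 * (Q * (Q * Q * e)))
    ring₂ = solve-∀
    ring₃ : ∀ r Q K M → r * (27 * (Q * (K * (M + 3 * Q)))) ≡ K * (r * (27 * (Q * M) + 81 * (Q * Q)))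
    ring₃ = solve-∀

  product≤ : ∀ a b c → 4 * (a * b) ≤ (a + b + c) * (a + b + c)
  product≤ a b c = ≤-trans (am-gm₂ a b) (*-mono-≤ (m≤m+n (a + b) c) (m≤m+n (a + b) c))

  -- Here y or y′ may be taken to be 0, and the bound ab on the other one suffices.
  poor-contradiction : ∀ {N} (H : PHG N) (S : Setup Q r H) → let open Setup S in
    ∀ {a b c d e : Fin N} → Incr₅ a b c d e → Fitting Q H γ⁰ γ¹ γ² → Avoids q H γ⁰ γ⁰ → ℓ₁ ≡ 0 ⊎ ℓ₂ ≡ 0 → ⊥
  poor-contradiction H S inc@(ab , bc , cd , de) (x , fits) avoids poor = go poor
    where
    open Setup S
    open Weights x
    A = part₀ left
    B = part₀ right
    C = part₀ none
    l₀ : Q * ℓ₀ ≤ A * B + 12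
    l₀ = Frame.level₀ Q H γ⁰ γ¹ γ² inc x (proj₁ (fits ab bc cd)) (proj₁ (fits bc cd de)) {ℓ₀} avoids (Level.rich lev₀ bc cd)
    zero≤ : ∀ {ℓ} → ℓ ≡ 0 → Q * (ℓ₀ ⊓ ℓ) ≤ 12
    zero≤ refl = ≤-trans (≤-reflexive (trans (cong (Q *_) (⊓-zeroʳ ℓ₀)) (*-zeroʳ Q))) z≤n
    min≤ : ∀ ℓ → Q * (ℓ₀ ⊓ ℓ) ≤ A * B + 12
    min≤ ℓ = ≤-trans (*-monoʳ-≤ Q (m⊓n≤m ℓ₀ ℓ)) l₀
    go : ℓ₁ ≡ 0 ⊎ ℓ₂ ≡ 0 → ⊥
    go (inj₁ eq) = conclude H S inc x (proj₂ (fits ab bc cd)) (proj₁ (fits ab (<-trans bc cd) de)) 0 (A * B) z≤n ≤-refl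
      (product≤ A B C) (λ _ → *-monoʳ-≤ A (m≤m+n B C)) (λ _ → ≤-trans (≤-reflexive (*-comm A B)) (*-monoʳ-≤ B (m≤m+n A C)))
      (zero≤ eq) (min≤ ℓ₂) l₀
    go (inj₂ eq) = conclude H S inc x (proj₂ (fits ab bc cd)) (proj₁ (fits ab (<-trans bc cd) de)) (A * B) 0 ≤-refl z≤n
      (subst (λ w → 4 * w ≤ (A + B + C) * (A + B + C)) (sym (+-identityʳ (A * B))) (product≤ A B C))
      (λ _ → subst (_≤ A * (B + C)) (sym (+-identityʳ (A * B))) (*-monoʳ-≤ A (m≤m+n B C)))
      (λ _ → subst (_≤ B * (A + C)) (sym (+-identityʳ (A * B))) (≤-trans (≤-reflexive (*-comm A B)) (*-monoʳ-≤ B (m≤m+n A C))))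
      (min≤ ℓ₁) (zero≤ eq) l₀

  -- `optimum` wants y and y′ below ab, so the weights of the pairs are capped there. This is
  -- legitimate because `Y` takes minima with ℓ₀, and ℓ₀ obeys the bound ab.
  rich-contradiction : ∀ {N} (H : PHG N) (S : Setup Q r H) → let open Setup S in
    ∀ {a b c d e : Fin N} → Incr₅ a b c d e → Fitting Q H γ⁰ γ¹ γ² → (∀ s t → Avoids q H (γ s) (γ t)) →
    Frame.Crosses Q H γ⁰ γ¹ γ² γ¹ b c d → Frame.Crosses Q H γ⁰ γ¹ γ² γ² b c d → ⊥
  rich-contradiction H S {b = b} {c} {d} inc@(ab , bc , cd , de) (x , fits) avoids cross₁ cross₂ =
    conclude H S inc x (proj₂ (fits ab bc cd)) (proj₁ (fits ab (<-trans bc cd) de)) (W₁ ⊓ (A * B)) (W₂ ⊓ (A * B))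
      (m⊓n≤n W₁ (A * B)) (m⊓n≤n W₂ (A * B)) (≤-trans (*-monoʳ-≤ 4 sum≤) (proj₁ pb))
      (λ le → ≤-trans sum≤ (proj₁ (proj₂ pb) le)) (λ le → ≤-trans sum≤ (proj₂ (proj₂ pb) le))
      (both l₁) (both l₂) l₀
    where
    open Setup S
    open Weights x
    A = part₀ left
    B = part₀ right
    W₁ = weight (λ s t → ⟦ pair₁ s t ⟧)
    W₂ = weight (λ s t → ⟦ pair₂ s t ⟧)
    pb = pairs-bound x
    sum≤ : W₁ ⊓ (A * B) + W₂ ⊓ (A * B) ≤ W₁ + W₂
    sum≤ = +-mono-≤ (m⊓n≤m W₁ (A * B)) (m⊓n≤m W₂ (A * B))
    cases : ∀ t {γ′} → γ′ ≡ γ⁰ ⊎ γ′ ≡ γ¹ ⊎ γ′ ≡ γ² → Avoids q H γ′ (γ t)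
    cases t (inj₁ refl)        = avoids zero t
    cases t (inj₂ (inj₁ refl)) = avoids (suc zero) t
    cases t (inj₂ (inj₂ refl)) = avoids (suc (suc zero)) t
    l₀ : Q * ℓ₀ ≤ A * B + 12
    l₀ = Frame.level₀ Q H γ⁰ γ¹ γ² inc x (proj₁ (fits ab bc cd)) (proj₁ (fits bc cd de)) {ℓ₀} (avoids zero zero) (Level.rich lev₀ bc cd)
    l₁ : Q * ℓ₁ ≤ W₁ + 12
    l₁ = Frame.level₁ Q H γ⁰ γ¹ γ² inc x (proj₁ (fits ab bc cd)) (proj₁ (fits bc cd de)) {ℓ₁} (cases (suc zero)) cross₁ (Level.rich lev₁ bc cd)
    l₂ : Q * ℓ₂ ≤ W₂ + 12
    l₂ = Frame.level₂ Q H γ⁰ γ¹ γ² inc x (proj₁ (fits ab bc cd)) (proj₁ (fits bc cd de)) {ℓ₂} (cases (suc (suc zero))) cross₂ (Level.rich lev₂ bc cd)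
    both : ∀ {ℓ W} → Q * ℓ ≤ W + 12 → Q * (ℓ₀ ⊓ ℓ) ≤ W ⊓ (A * B) + 12
    both {ℓ} {W} l = subst (Q * (ℓ₀ ⊓ ℓ) ≤_) (sym (+-distribʳ-⊓ 12 W (A * B)))
      (⊓-glb (≤-trans (*-monoʳ-≤ Q (m⊓n≤n ℓ₀ ℓ)) l) (≤-trans (*-monoʳ-≤ Q (m⊓n≤m ℓ₀ ℓ)) l₀))

  -- For ℓ ≤ 1 a triad would have density at most 3/Q, which is below 4/27 when 81 < 4Q. Level 2 is
  -- what `dense-core` asks for.
  level₀≥2 : ∀ {N} (H : PHG N) {γ ℓ} → DensityAbove r H → Level Q H (λ _ _ _ _ → true) (λ _ _ _ _ → true) γ ℓ →
    ∀ {h i x j k : Fin N} → Incr₅ h i x j k → 2 ≤ ℓ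
  level₀≥2 H {γ} {ℓ} dense lev {h} {i} {x} {j} {k} inc@(_ , ix , xj , _) with 2 ≤? ℓ
  ... | yes le = le
  ... | no ¬le = contradiction (*-cancelˡ-≤ {4 * Q} {81} (K * r) {{m*n≢0 K r}} (begin
      K * r * (4 * Q)  ≡⟨ ring₀ K r Q ⟩
      Q * (4 * r * K)  ≤⟨ *-monoʳ-≤ Q (*-monoˡ-≤ K (m≤m+n (4 * r) 27)) ⟩
      Q * ((4 * r + 27) * K)  ≡⟨ cong (λ K → Q * ((4 * r + 27) * K)) (ring₁ (card H i x) (card H x j) (card H i j)) ⟩
      Q * ((4 * r + 27) * (card H i x * card H i j * card H x j))  ≤⟨ *-monoʳ-≤ Q (dense ix xj) ⟩
      Q * (27 * r * triadEdges H i x j)  ≡⟨ ring₂ Q r (triadEdges H i x j) ⟩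
      27 * r * (Q * triadEdges H i x j)  ≤⟨ *-monoʳ-≤ (27 * r) (sparse-bound Q H {γ} {ℓ} lev inc) ⟩
      27 * r * (K * (ℓ + 2))  ≤⟨ *-monoʳ-≤ (27 * r) (*-monoʳ-≤ K (+-monoˡ-≤ 2 (s≤s⁻¹ (≰⇒> ¬le)))) ⟩
      27 * r * (K * 3)  ≡⟨ ring₃ r K ⟩
      K * r * 81  ∎)) (<⇒≱ large)
    where
    open ≤-Reasoning
    K = card H i x * card H x j * card H i j
    ring₀ : ∀ K r Q → K * r * (4 * Q) ≡ Q * (4 * r * K)
    ring₀ = solve-∀
    ring₁ : ∀ u v w → u * v * w ≡ u * w * v
    ring₁ = solve-∀
    ring₂ : ∀ Q r e → Q * (27 * r * e) ≡ 27 * r * (Q * e)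
    ring₂ = solve-∀
    ring₃ : ∀ r K → 27 * r * (K * 3) ≡ K * r * 81
    ring₃ = solve-∀

-- Of the link density 2/Q, rows of non-neighbours carry at most 1/Q. The other 1/Q needs at least a
-- 1/Q proportion of neighbours.
dense-core : ∀ Q .{{_ : NonZero Q}} {n m} (e : Fin n → Fin (suc m) → Bool) →
  2 * (n * suc m) ≤ Q * count₂ e → Dense Q (λ v → suc m ≤ᵇ Q * Q * count (e v))
dense-core Q {n} {m} e rich = *-cancelʳ-≤ n (Q * count L) (suc m) (+-cancelʳ-≤ (n * suc m) _ _ (begin
  n * suc m + n * suc m  ≡⟨ twice (n * suc m) ⟩
  2 * (n * suc m)  ≤⟨ rich ⟩
  Q * count₂ e  ≡⟨ cong (Q *_) (count₂-∑₂ e) ⟩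
  Q * ∑₂ n (suc m) (λ v y → ⟦ e v y ⟧)  ≤⟨ *-monoʳ-≤ Q (∑₂-mono n (suc m) (λ v y → cover (e v y) (L v))) ⟩
  Q * ∑₂ n (suc m) (λ v y → ⟦ L v ⟧ + out v y)  ≡⟨ trans (cong (Q *_) (∑₂-+ n (suc m) (λ v _ → ⟦ L v ⟧) out)) (*-distribˡ-+ Q (∑₂ n (suc m) (λ v _ → ⟦ L v ⟧)) (∑₂ n (suc m) out)) ⟩
  Q * ∑₂ n (suc m) (λ v _ → ⟦ L v ⟧) + Q * ∑₂ n (suc m) out ≤⟨ +-mono-≤ (≤-reflexive (cong (Q *_) inside)) few ⟩
  Q * (count L * suc m) + n * suc m  ≡⟨ cong (_+ n * suc m) (*-assoc Q (count L) (suc m)) ⟨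
  Q * count L * suc m + n * suc m  ∎))
  where
  open ≤-Reasoning
  L : Fin n → Bool
  L v = suc m ≤ᵇ Q * Q * count (e v)
  out : Fin n → Fin (suc m) → ℕ
  out v y = ⟦ e v y ∧ not (L v) ⟧
  twice : ∀ a → a + a ≡ 2 * a
  twice = solve-∀
  cover : ∀ e l → ⟦ e ⟧ ≤ ⟦ l ⟧ + ⟦ e ∧ not l ⟧
  cover false l     = z≤n
  cover true  true  = ≤-refl
  cover true  false = ≤-refl
  inside : ∑₂ n (suc m) (λ v _ → ⟦ L v ⟧) ≡ count L * suc m
  inside = trans (∑-cong (allFin n) λ v → trans (∑F-const (suc m) ⟦ L v ⟧) (*-comm (suc m) ⟦ L v ⟧))
    (trans (∑-*ʳ (allFin n) (suc m) (λ v → ⟦ L v ⟧)) (cong (_* suc m) (sym (count-∑ L))))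
  few : Q * ∑₂ n (suc m) out ≤ n * suc m
  few = ≤-trans (*-monoˡ-≤ (∑₂ n (suc m) out) (m≤m*n Q Q)) (≤-trans (small-rows (Q * Q) e) (≤-reflexive (*-identityˡ _)))

module _ {N} (Q : ℕ) .{{_ : NonZero Q}} (H : PHG N) (γ : Choice H) {ℓ : ℕ} where

  dense-inL : 2 ≤ ℓ → ∀ {i j k} → T (Rich Q ℓ H i j k (γ i k)) → Dense Q (inL (Q * Q) H γ i j k)
  dense-inL 2≤ℓ {i} {j} {k} rich = dense-core Q (λ x y → edge H i j k x y (γ i k))
    (≤-trans (*-monoˡ-≤ (card H i j * card H j k) 2≤ℓ) (≤ᵇ⇒≤ (ℓ * (card H i j * card H j k)) _ rich))

  dense-inR : 2 ≤ ℓ → ∀ {h i j} → T (Rich Q ℓ H h i j (γ h j)) → Dense Q (inR (Q * Q) H γ h i j)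
  dense-inR 2≤ℓ {h} {i} {j} rich = dense-core Q (λ y x → edge H h i j x y (γ h j))
    (subst₂ _≤_ (cong (2 *_) (*-comm (card H h i) (card H i j))) (cong (Q *_) (count₂-swap (λ x y → edge H h i j x y (γ h j))))
      (≤-trans (*-monoˡ-≤ (card H h i * card H i j) 2≤ℓ) (≤ᵇ⇒≤ (ℓ * (card H h i * card H i j)) _ rich)))

  dense-links : 1 ≤ ℓ → (∀ {i j k} → i Fin.< j → j Fin.< k → T (Rich Q ℓ H i j k (γ i k))) → DenseLinks (Q * Q) H γ
  dense-links 1≤ℓ rich {i} {j} {k} ij jk = begin
    card H i j * card H j k  ≡⟨ *-identityˡ _ ⟨
    1 * (card H i j * card H j k)  ≤⟨ *-monoˡ-≤ (card H i j * card H j k) 1≤ℓ ⟩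
    ℓ * (card H i j * card H j k)  ≤⟨ ≤ᵇ⇒≤ (ℓ * (card H i j * card H j k)) _ (rich ij jk) ⟩
    Q * link H i j k (γ i k)  ≤⟨ *-monoˡ-≤ (link H i j k (γ i k)) (m≤m*n Q Q) ⟩
    Q * Q * link H i j k (γ i k)  ∎
    where open ≤-Reasoning

-- Assembling the cases

module Assembly (r Q : ℕ) .{{_ : NonZero r}} .{{_ : NonZero Q}} (large : 81 < 4 * Q)
  (slack : r * (4 * cube (Q + 27) + 27 * ((Q + 27) * (12 + Q)) + 81 * (Q * Q)) < (4 * r + 27) * cube Q) where

  open Contradiction r Q large slack

  private
    q : ℕ
    q = Q * Q

  SetupIn : ℕ → ℕ → Set
  SetupIn m N = (H : PHG N) → DensityAbove r H → Σ (m ↪ N) λ σ → Setup Q r (H ↾ σ)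

  -- γ⁰ is unconstrained; since its level is at least 2, its left and right neighbours are dense,
  -- which is the condition `NotRare` for choosing γ¹ and γ² among them.
  set-up-proof : ∀ m → ∃ (SetupIn m)
  set-up-proof m = proj₁ l₀ , go
    where
    l₂ = level Q m
    l₁ = level Q (proj₁ l₂)
    l₀ = level Q (proj₁ l₁)
    everything : ∀ n → Dense Q {n} (λ _ → true)
    everything n = subst (λ c → n ≤ Q * c) (sym (trans (count-∑ {n} (λ _ → true)) (trans (∑F-const n 1) (*-identityʳ n)))) (m≤n*m n Q)
    density-↾ : ∀ {m N} {H : PHG N} (σ : m ↪ N) → DensityAbove r H → DensityAbove r (H ↾ σ)
    density-↾ σ dense ij jk = dense (mono σ ij) (mono σ jk)
    go : SetupIn m (proj₁ l₀)
    go H dense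
      with σ₀ , γ⁰ , ℓ₀ , lev₀ ← proj₂ l₀ H (λ _ _ _ _ → true) (λ _ _ _ _ → true) (λ {_} {i} {_} {j} _ → everything (card H i j))
      with σ₁ , γ¹ , ℓ₁ , lev₁ ← proj₂ l₁ (H ↾ σ₀) (λ _ _ _ _ → true) (inL q (H ↾ σ₀) γ⁰)
        (λ inc@(_ , ix , xj , jk) → dense-inL Q (H ↾ σ₀) γ⁰ {ℓ₀} (level₀≥2 (H ↾ σ₀) (density-↾ {H = H} σ₀ dense) lev₀ inc)
          (Level.rich lev₀ (<-trans ix xj) jk))
      with σ₂ , γ² , ℓ₂ , lev₂ ← proj₂ l₂ (H ↾ σ₀ ↾ σ₁) (inR q (H ↾ σ₀ ↾ σ₁) (γ⁰ ⇂ σ₁)) (λ _ _ _ _ → true)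
        (λ inc@(hi , ix , xj , _) → dense-mono {Q} (λ v t → T∧ t _) (dense-inR Q (H ↾ σ₀ ↾ σ₁) (γ⁰ ⇂ σ₁) {ℓ₀}
          (level₀≥2 (H ↾ σ₀ ↾ σ₁) (density-↾ {H = H ↾ σ₀} σ₁ (density-↾ {H = H} σ₀ dense)) (level-↾ σ₁ lev₀) inc)
          (Level.rich lev₀ (mono σ₁ hi) (mono σ₁ (<-trans ix xj)))))
      = σ₀ ∘↪ σ₁ ∘↪ σ₂ , record
        { γ⁰ = γ⁰ ⇂ σ₁ ⇂ σ₂ ; γ¹ = γ¹ ⇂ σ₂ ; γ² = γ² ; ℓ₀ = ℓ₀ ; ℓ₁ = ℓ₁ ; ℓ₂ = ℓ₂
        ; lev₀ = level-↾ σ₂ (level-↾ σ₁ lev₀) ; lev₁ = level-↾ σ₂ lev₁ ; lev₂ = lev₂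
        ; dense = λ ij jk → dense (mono σ₀ (mono σ₁ (mono σ₂ ij))) (mono σ₀ (mono σ₁ (mono σ₂ jk))) }

  abstract

    set-up : ∀ m → ∃ (SetupIn m)
    set-up = set-up-proof

  first : Incr₅ {5} zero (suc zero) (suc (suc zero)) (suc (suc (suc zero))) (suc (suc (suc (suc zero))))
  first = s≤s z≤n , s≤s (s≤s z≤n) , s≤s (s≤s (s≤s z≤n)) , s≤s (s≤s (s≤s (s≤s z≤n)))

  module _ (n : ℕ) (2≤n : 2 ≤ n) where

    fitted : ∃ λ N → (H : PHG N) (γ⁰ γ¹ γ² : Choice H) → Σ (5 ↪ N) λ σ → Fitting Q (H ↾ σ) (γ⁰ ⇂ σ) (γ¹ ⇂ σ) (γ² ⇂ σ)
    fitted = fit Q 5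

    pairs : List (Fin 3 × Fin 3)
    pairs = cartesianProduct (allFin 3) (allFin 3)

    -- The links of γ¹ or γ² may be empty here, so only the link of γ⁰ is tested, against the
    -- neighbourhoods of γ⁰ itself.
    poor-case : ∃ λ N → (H : PHG N) (S : Setup Q r H) → Setup.ℓ₁ S ≡ 0 ⊎ Setup.ℓ₂ S ≡ 0 → 1 ≤ Setup.ℓ₀ S → Outcome n H
    poor-case = proj₁ avoiding , go
      where
      avoiding = avoids-or-outcome q n (proj₁ fitted)
      go : (H : PHG (proj₁ avoiding)) (S : Setup Q r H) → Setup.ℓ₁ S ≡ 0 ⊎ Setup.ℓ₂ S ≡ 0 → 1 ≤ Setup.ℓ₀ S → Outcome n H
      go H S poor 1≤ℓ₀ with proj₂ avoiding H (Setup.γ⁰ S) (Setup.γ⁰ S) (dense-links Q H (Setup.γ⁰ S) {Setup.ℓ₀ S} 1≤ℓ₀ (Level.rich (Setup.lev₀ S)))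
      ... | inj₁ o = o
      ... | inj₂ (σ , av)
        with ρ , fits ← proj₂ fitted (H ↾ σ) (Setup.γ⁰ S ⇂ σ) (Setup.γ¹ S ⇂ σ) (Setup.γ² S ⇂ σ)
        = ⊥-elim (poor-contradiction (H ↾ σ ↾ ρ) (setup-↾ ρ (setup-↾ σ S)) first fits (avoids-↾ q (H ↾ σ) (Setup.γ⁰ S ⇂ σ) (Setup.γ⁰ S ⇂ σ) ρ av) poor)

    rich-case : ∃ λ N → (H : PHG N) (S : Setup Q r H) → 1 ≤ Setup.ℓ₀ S → 1 ≤ Setup.ℓ₁ S → 1 ≤ Setup.ℓ₂ S → Outcome n H
    rich-case = proj₁ c₁ , go
      where
      avoiding = all-avoids-or-outcome q n pairs (proj₁ fitted)
      c₂ = crosses-or-outcome q n 2≤n (proj₁ avoiding)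
      c₁ = crosses-or-outcome q n 2≤n (proj₁ c₂)
      module _ {N} (H : PHG N) (S : Setup Q r H) (1≤ℓ₀ : 1 ≤ Setup.ℓ₀ S) (1≤ℓ₁ : 1 ≤ Setup.ℓ₁ S) (1≤ℓ₂ : 1 ≤ Setup.ℓ₂ S) where
        open Setup S
        links⁰ : DenseLinks q H γ⁰
        links⁰ = dense-links Q H γ⁰ {ℓ₀} 1≤ℓ₀ (Level.rich lev₀)
        links¹ : DenseLinks q H γ¹
        links¹ = dense-links Q H γ¹ {ℓ₁} 1≤ℓ₁ (Level.rich lev₁)
        links² : DenseLinks q H γ²
        links² = dense-links Q H γ² {ℓ₂} 1≤ℓ₂ (Level.rich lev₂)
        links : ∀ s → DenseLinks q H (γ s)
        links zero             = links⁰
        links (suc zero)       = links¹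
        links (suc (suc zero)) = links²
      Cross : ∀ {N} (H : PHG N) (γ¹ γ² γ : Choice H) → Set
      Cross H γ¹ γ² γ = ∀ {b c d} → b Fin.< c → c Fin.< d →
        q * count₂ (λ x y → inL q H γ¹ b c d x ∧ inR q H γ² b c d y ∧ edge H b c d x y (γ b d)) < card H b c * card H c d
      go₂ : (H : PHG (proj₁ avoiding)) (S : Setup Q r H) → 1 ≤ Setup.ℓ₀ S → 1 ≤ Setup.ℓ₁ S → 1 ≤ Setup.ℓ₂ S →
        Cross H (Setup.γ¹ S) (Setup.γ² S) (Setup.γ¹ S) → Cross H (Setup.γ¹ S) (Setup.γ² S) (Setup.γ² S) → Outcome n H
      go₂ H S h₀ h₁ h₂ cr₁ cr₂ with proj₂ avoiding H (Setup.γ S) (All.universal (λ p {i} {j} {k} → links H S h₀ h₁ h₂ (proj₁ p) {i} {j} {k}) pairs)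
      ... | inj₁ o = o
      ... | inj₂ (σ , avs)
        with ρ , fits ← proj₂ fitted (H ↾ σ) (Setup.γ⁰ S ⇂ σ) (Setup.γ¹ S ⇂ σ) (Setup.γ² S ⇂ σ)
        = ⊥-elim (rich-contradiction (H ↾ σ ↾ ρ) (setup-↾ ρ (setup-↾ σ S)) first fits av
            (cr₁ (mono σ (mono ρ b<c)) (mono σ (mono ρ c<d))) (cr₂ (mono σ (mono ρ b<c)) (mono σ (mono ρ c<d))))
        where
        b<c = proj₁ (proj₂ first)
        c<d = proj₁ (proj₂ (proj₂ first))
        avσ : ∀ s t → Avoids q (H ↾ σ) (Setup.γ S s ⇂ σ) (Setup.γ S t ⇂ σ)
        avσ s t = All.lookup avs (∈-cartesianProduct⁺ (∈-allFin s) (∈-allFin t))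
        avρ : ∀ s t → Avoids q (H ↾ σ ↾ ρ) (Setup.γ S s ⇂ σ ⇂ ρ) (Setup.γ S t ⇂ σ ⇂ ρ)
        avρ s t = avoids-↾ q (H ↾ σ) (Setup.γ S s ⇂ σ) (Setup.γ S t ⇂ σ) ρ (avσ s t)
        -- Both sides agree by computation only after a case distinction on `s`.
        γ-↾ : ∀ s → Setup.γ (setup-↾ ρ (setup-↾ σ S)) s ≡ Setup.γ S s ⇂ σ ⇂ ρ
        γ-↾ zero             = refl
        γ-↾ (suc zero)       = refl
        γ-↾ (suc (suc zero)) = refl
        av : ∀ s t → Avoids q (H ↾ σ ↾ ρ) (Setup.γ (setup-↾ ρ (setup-↾ σ S)) s) (Setup.γ (setup-↾ ρ (setup-↾ σ S)) t)
        av s t = subst₂ (Avoids q (H ↾ σ ↾ ρ)) (sym (γ-↾ s)) (sym (γ-↾ t)) (avρ s t)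
      go : (H : PHG (proj₁ c₁)) (S : Setup Q r H) → 1 ≤ Setup.ℓ₀ S → 1 ≤ Setup.ℓ₁ S → 1 ≤ Setup.ℓ₂ S → Outcome n H
      go H S h₀ h₁ h₂ with proj₂ c₁ H (Setup.γ⁰ S) (Setup.γ¹ S) (Setup.γ² S) (Setup.γ¹ S)
        (links¹ H S h₀ h₁ h₂) (links² H S h₀ h₁ h₂) (Level.after (Setup.lev₁ S)) (Level.before (Setup.lev₂ S))
      ... | inj₁ o = o
      ... | inj₂ (σ , cr₁)
        with proj₂ c₂ (H ↾ σ) (Setup.γ⁰ S ⇂ σ) (Setup.γ¹ S ⇂ σ) (Setup.γ² S ⇂ σ) (Setup.γ² S ⇂ σ)
          (links¹ (H ↾ σ) (setup-↾ σ S) h₀ h₁ h₂) (links² (H ↾ σ) (setup-↾ σ S) h₀ h₁ h₂)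
          (Level.after (Setup.lev₁ (setup-↾ σ S))) (Level.before (Setup.lev₂ (setup-↾ σ S)))
      ...   | inj₁ o = outcome-↾ σ o
      ...   | inj₂ (ρ , cr₂) = outcome-↾ σ (outcome-↾ ρ (go₂ (H ↾ σ ↾ ρ) (setup-↾ ρ (setup-↾ σ S)) h₀ h₁ h₂
              (λ bc cd → cr₁ (mono ρ bc) (mono ρ cd)) cr₂))

    solve : ∃ λ N → (H : PHG N) → DensityAbove r H → Outcome n H
    solve = proj₁ st , go
      where
      R P : ℕ
      R = proj₁ rich-case
      P = proj₁ poor-case
      -- The levels are known only after the setup, so indices are reserved for both cases. The five
      -- in front give the quintuple that `level₀≥2` needs.
      st = set-up (5 + (R + P))
      tail : R + P ↪ 5 + (R + P)
      tail = right↪ 5 (R + P)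
      head : 5 ↪ 5 + (R + P)
      head = left↪ 5 (R + P)
      ℓ₀≥1 : (H : PHG (5 + (R + P))) (S : Setup Q r H) → 1 ≤ Setup.ℓ₀ S
      ℓ₀≥1 H S = ≤-trans (n≤1+n 1) (level₀≥2 (H ↾ head) (Setup.dense S′) (Setup.lev₀ S′) first)
        where S′ = setup-↾ head S
      by-levels : (H : PHG (5 + (R + P))) (S : Setup Q r H) → Outcome n H
      by-levels H S with 1 ≤? Setup.ℓ₁ S | 1 ≤? Setup.ℓ₂ S
      ... | yes h₁ | yes h₂ = outcome-↾ ρ (proj₂ rich-case (H ↾ ρ) (setup-↾ ρ S) (ℓ₀≥1 H S) h₁ h₂)
        where ρ = tail ∘↪ left↪ R P
      ... | no  h₁ | _      = outcome-↾ ρ (proj₂ poor-case (H ↾ ρ) (setup-↾ ρ S) (inj₁ (n<1⇒n≡0 (≰⇒> h₁))) (ℓ₀≥1 H S))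
        where ρ = tail ∘↪ right↪ R P
      ... | yes _  | no h₂  = outcome-↾ ρ (proj₂ poor-case (H ↾ ρ) (setup-↾ ρ S) (inj₂ (n<1⇒n≡0 (≰⇒> h₂))) (ℓ₀≥1 H S))
        where ρ = tail ∘↪ right↪ R P
      go : (H : PHG (proj₁ st)) → DensityAbove r H → Outcome n H
      go H dense with σ , S ← proj₂ st H dense = outcome-↾ σ (by-levels (H ↾ σ) S)

-- From rational densities to natural numbers, and the conclusion

-- A positive numerator is at least 1, so δ may be replaced by 1/r with r = `suc d`; then 4/27 + 1/r
-- = (4r + 27)/(27r).
clear-denominators : ∀ p d .(cop : Coprime (suc p) (suc d)) C E →
  ((ℤ.+ 4 ℚ./ 27) ℚ.+ mkℚ (ℤ.+ suc p) d cop) ℚ.* (ℤ.+ C ℚ./ 1) ℚ.≤ (ℤ.+ E ℚ./ 1) →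
  (4 * suc d + 27) * C ≤ 27 * suc d * E
clear-denominators p d cop C E le = begin
  (4 * suc d + 27) * C  ≤⟨ *-monoˡ-≤ C (+-monoʳ-≤ (4 * suc d) (m≤n*m 27 (suc p))) ⟩
  (4 * suc d + suc p * 27) * C  ≡⟨ *-identityʳ _ ⟨
  (4 * suc d + suc p * 27) * C * 1  ≤⟨ ℤ.drop‿+≤+ integers ⟩
  E * (27 * suc d * 1)  ≡⟨ ring E (suc d) ⟩
  27 * suc d * E  ∎
  where
  open ≤-Reasoning
  δᵘ : ℚᵘ
  δᵘ = mkℚᵘ (ℤ.+ suc p) d
  -- Rational sums and products are normalised, which hides their denominators; the unnormalised
  -- rationals keep them visible.
  homo : toℚᵘ (((ℤ.+ 4 ℚ./ 27) ℚ.+ mkℚ (ℤ.+ suc p) d cop) ℚ.* (ℤ.+ C ℚ./ 1)) ℚᵘ.≃ (mkℚᵘ (ℤ.+ 4) 26 ℚᵘ.+ δᵘ) ℚᵘ.* mkℚᵘ (ℤ.+ C) 0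
  homo = ℚᵘ.≃-trans (ℚ.toℚᵘ-homo-* ((ℤ.+ 4 ℚ./ 27) ℚ.+ mkℚ (ℤ.+ suc p) d cop) (ℤ.+ C ℚ./ 1))
    (ℚᵘ.*-cong (ℚᵘ.≃-trans (ℚ.toℚᵘ-homo-+ (ℤ.+ 4 ℚ./ 27) (mkℚ (ℤ.+ suc p) d cop)) (ℚᵘ.+-congˡ {toℚᵘ (ℤ.+ 4 ℚ./ 27)} {mkℚᵘ (ℤ.+ 4) 26} δᵘ (ℚ.toℚᵘ-fromℚᵘ (mkℚᵘ (ℤ.+ 4) 26))))
      (ℚ.toℚᵘ-fromℚᵘ (mkℚᵘ (ℤ.+ C) 0)))
  unnormalised : (mkℚᵘ (ℤ.+ 4) 26 ℚᵘ.+ δᵘ) ℚᵘ.* mkℚᵘ (ℤ.+ C) 0 ℚᵘ.≤ mkℚᵘ (ℤ.+ E) 0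
  unnormalised = ℚᵘ.≤-respˡ-≃ homo (ℚᵘ.≤-respʳ-≃ (ℚ.toℚᵘ-fromℚᵘ (mkℚᵘ (ℤ.+ E) 0)) (ℚ.toℚᵘ-mono-≤ le))
  integers : ℤ.+ ((4 * suc d + suc p * 27) * C * 1) ℤ.≤ ℤ.+ (E * (27 * suc d * 1))
  integers = subst₂ ℤ._≤_
    (trans (cong (ℤ._* ℤ.+ 1) (sym (ℤ.pos-* (4 * suc d + suc p * 27) C))) (sym (ℤ.pos-* ((4 * suc d + suc p * 27) * C) 1)))
    (sym (ℤ.pos-* E (27 * suc d * 1)))
    (ℚᵘ.drop-*≤* unnormalised)
  ring : ∀ E r → E * (27 * r * 1) ≡ 27 * r * E
  ring = solve-∀

density⇒above : ∀ {N} (H : PHG N) p d .(cop : Coprime (suc p) (suc d)) → DensityAtLeast H ((ℤ.+ 4 ℚ./ 27) ℚ.+ mkℚ (ℤ.+ suc p) d cop) → DensityAbove (suc d) H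
density⇒above H p d cop dense {i} {j} {k} ij jk =
  clear-denominators p d cop (card H i j * card H i k * card H j k) (triadEdges H i j k) (dense i j k ij jk)

-- For n ≤ 1 there are no five indices, and the third alternative is vacuous.
small-outcome : ∀ n → n < 2 → (H : PHG (4 * n)) → Outcome n H
small-outcome n n<2 H = whole H , inj₂ (inj₂ (inj₁ (z , z , z , z , z , z , (λ _ _ _ _ _ → zero) , (λ _ _ _ _ _ → zero) ,
  λ i j k s t ij jk ks st → ⊥-elim (<⇒≱ (Fin.toℕ<n t) (≤-trans (*-monoʳ-≤ 4 (s≤s⁻¹ n<2)) (above ij jk ks st))))))
  where
  z : Choice H
  z _ _ = zero
  above : ∀ {i j k s t : Fin (4 * n)} → i Fin.< j → j Fin.< k → k Fin.< s → s Fin.< t → 4 ≤ Fin.toℕ t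
  above ij jk ks st = ≤-trans (s≤s (≤-trans (s≤s (≤-trans (s≤s (≤-trans (s≤s z≤n) ij)) jk)) ks)) st

abstract

  large-outcome : ∀ d n → 2 ≤ n → ∃ λ N → (H : PHG N) → DensityAbove (suc d) H → Outcome n H
  large-outcome d n 2≤n = Assembly.solve (suc d) (100 * suc d)
    (≤-trans (≤ᵇ⇒≤ 82 400 _) (*-monoʳ-≤ 4 (m≤m*n 100 (suc d)))) (slack d) n 2≤n

IsPositive : ℤ.ℤ → Set
IsPositive (ℤ.+ suc _) = ⊤
IsPositive _         = ⊥

<⇒numerator-positive : ∀ {δ} → 0ℚ ℚ.< δ → IsPositive (ℚ.↥ δ)
<⇒numerator-positive {mkℚ (ℤ.+ suc _) _ _} 0<δ = tt
<⇒numerator-positive {δ@(mkℚ (ℤ.+ zero) _ _)} 0<δ with () ← positive {δ} 0<δ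
<⇒numerator-positive {δ@(mkℚ ℤ.-[1+ _ ] _ _)} 0<δ with () ← positive {δ} 0<δ

theorem29 : (δ : ℚ) → 0ℚ ℚ.< δ → (n : ℕ) →
    ∃ λ (N : ℕ) → (H : PHG N) → DensityAtLeast H ((ℤ.+ 4 ℚ./ 27) ℚ.+ δ) →
    Σ (Sub H (4 * n)) λ H₀ → Case1 H₀ ⊎ Case2 H₀ ⊎ Case3 H₀ ⊎ Case4 H₀ n
theorem29 (mkℚ (ℤ.+ suc p) d cop) 0<δ n = by-size (2 ≤? n)
  where
  by-size : Dec (2 ≤ n) → ∃ λ N → (H : PHG N) → DensityAtLeast H ((ℤ.+ 4 ℚ./ 27) ℚ.+ mkℚ (ℤ.+ suc p) d cop) → Outcome n H
  by-size (no  2≰n) = 4 * n , λ H _ → small-outcome n (≰⇒> 2≰n) H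
  by-size (yes 2≤n) = proj₁ (large-outcome d n 2≤n) , λ H dense → proj₂ (large-outcome d n 2≤n) H (density⇒above H p d cop dense)
theorem29 (mkℚ (ℤ.+ zero) d cop) 0<δ n = ⊥-elim (<⇒numerator-positive 0<δ)
theorem29 (mkℚ ℤ.-[1+ p ] d cop) 0<δ n = ⊥-elim (<⇒numerator-positive 0<δ)
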